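{- Let $\Gamma$ be a finite simplicial complex with $\dim\Gamma\le 2$. Then the following are equivalent: (a) $\Gamma$ is an obstruction to shellability; (b) $\Gamma$ is an obstruction to partitionability; (c) $\Gamma$ is an obstruction to sequential Cohen-Macaulayness. In other words, within the class of simplicial complexes of dimension at most $2$, the set of obstructions to shellability, the set of obstructions to partitionability and the set of obstructions to sequential Cohen-Macaulayness coincide.
   Context: A simplicial complex $\Gamma$ is a family of subsets (faces) of a finite set closed under taking subsets; $\dim\sigma=|\sigma|-1$, facets are inclusion-maximal faces, $V(\Gamma)$ is the set of vertices $v$ with $\{v\}\in\Gamma$. For $W\subseteq V(\Gamma)$, the restriction $\Gamma[W]$ is the subcomplex of faces of $\Gamma$ contained in $W$. The link of a face $\tau$ is $\mathrm{link}_\Gamma(\tau)=\{\eta\in\Gamma:\eta\cap\tau=\emptyset,\ \eta\cup\tau\in\Gamma\}$. The pure $i$-skeleton $\mathrm{pure}_i(\Gamma)$ is the set of all subfaces of $i$-dimensional faces of $\Gamma$. A sequence of all facets $\sigma_1,\dots,\sigma_t$ is a shelling if for every $2\le j\le t$, $(\bigcup_{i<j}\overline{\sigma_i})\cap\overline{\sigma_j}$ is a pure $(\dim\sigma_j-1)$-dimensional complex, where $\overline{\sigma}$ is the set of all subsets of $\sigma$ (facets may have different dimensions); $\Gamma$ is shellable if it has a shelling. $\Gamma$ is partitionable if $\Gamma$ is a disjoint union of intervals $[\tau_\sigma,\sigma]=\{\eta:\tau_\sigma\subseteq\eta\subseteq\sigma\}$, one for each facet $\sigma$, with $\tau_\sigma\subseteq\sigma$.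 A pure complex $\Gamma$ is Cohen-Macaulay (over $\mathbb{Z}$) if for every $\tau\in\Gamma$, $\widetilde H_k(\mathrm{link}_\Gamma(\tau);\mathbb{Z})=0$ for all $k\ne\dim\mathrm{link}_\Gamma(\tau)$; $\Gamma$ is sequentially Cohen-Macaulay if $\mathrm{pure}_i(\Gamma)$ is Cohen-Macaulay for all $0\le i\le\dim\Gamma$. For a property $\mathcal P$, $\Gamma$ is an obstruction to $\mathcal P$ if $\Gamma$ does not satisfy $\mathcal P$ but $\Gamma[W]$ satisfies $\mathcal P$ for every $W\subsetneq V(\Gamma)$. -}

module Defs where

open import Data.Nat using (ℕ; zero; suc; _≤_)
open import Data.Integer using (ℤ; 0ℤ; -1ℤ; _+_; _*_; _^_)
open import Data.Bool using (Bool; T; if_then_else_)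
open import Data.Fin using (Fin; zero; suc; _<?_)
open import Data.Fin.Subset using (Subset; _⊆_; _∈_; _∉_; _∩_; _∪_; ⊥; ⁅_⁆; ∣_∣)
open import Data.Fin.Subset.Properties using (_∈?_)
open import Data.List using (List; []; _∷_; _++_)
open import Data.List.Relation.Unary.All using (All)
open import Data.List.Relation.Unary.Any using (Any)
open import Data.List.Relation.Unary.Unique.Propositional using (Unique)
import Data.List.Membership.Propositional as LM
open import Data.Product using (Σ; ∃; ∃-syntax; _×_; _,_)
open import Relation.Nullary using (¬_; does)
open import Relation.Binary.PropositionalEquality using (_≡_; _≢_)

record SimplicialComplex (n : ℕ) : Set where
  field
    face : Subset n → Bool
    down-closed : ∀ σ τ → τ ⊆ σ → T (face σ) → T (face τ)
open SimplicialComplex public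

Fam : ℕ → Set₁
Fam n = Subset n → Set

Faces : ∀ {n} → SimplicialComplex n → Fam n
Faces Γ σ = T (face Γ σ)

DimAtMost2 : ∀ {n} → SimplicialComplex n → Set
DimAtMost2 Γ = ∀ σ → Faces Γ σ → ∣ σ ∣ ≤ 3

module _ {n : ℕ} where

  IsFacet : Fam n → Subset n → Set
  IsFacet F σ = F σ × (∀ τ → F τ → σ ⊆ τ → τ ≡ σ)

  -- the largest face size is d  (i.e. dim = d - 1)
  HasTopSize : Fam n → ℕ → Set
  HasTopSize F d = (∃[ σ ] (F σ × ∣ σ ∣ ≡ d)) × (∀ σ → F σ → ∣ σ ∣ ≤ d)

  -- pure with all facets of size d (dimension d - 1)
  PureOfSize : Fam n → ℕ → Set
  PureOfSize F d = ∀ η → F η → (∣ η ∣ ≤ d) × (∃[ η' ] (η ⊆ η' × F η' × ∣ η' ∣ ≡ d))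

  Pure : Fam n → Set
  Pure F = ∃[ d ] PureOfSize F d

  Vert : Fam n → Fin n → Set
  Vert F v = F ⁅ v ⁆

  Restrict : Fam n → Subset n → Fam n
  Restrict F W σ = F σ × σ ⊆ W

  Link : Fam n → Subset n → Fam n
  Link F τ η = (η ∩ τ ≡ ⊥) × F (η ∪ τ)

  PureSkel : Fam n → ℕ → Fam n
  PureSkel F i η = ∃[ σ ] (F σ × η ⊆ σ × ∣ σ ∣ ≡ suc i)

  -- Shellability
  -- (⋃_{i<j} ̄σ_i) ∩ ̄σ_j
  Inter : List (Subset n) → Subset n → Fam n
  Inter pre σ η = η ⊆ σ × Any (λ ρ → η ⊆ ρ) pre

  IsShelling : Fam n → List (Subset n) → Set
  IsShelling F l =
    All (IsFacet F) l × Unique l × (∀ σ → IsFacet F σ → σ LM.∈ l) ×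
    (∀ pre σ post → l ≡ pre ++ σ ∷ post → pre ≢ [] →
       ∃[ d ] (suc d ≡ ∣ σ ∣ × PureOfSize (Inter pre σ) d))

  Shellable : Fam n → Set
  Shellable F = ∃[ l ] IsShelling F l

  -- Partitionability: intervals [r σ , σ], one per facet, disjoint, covering
  Partitionable : Fam n → Set
  Partitionable F = Σ (Subset n → Subset n) λ r →
    (∀ σ → IsFacet F σ → r σ ⊆ σ) ×
    (∀ η → F η → ∃[ σ ] (IsFacet F σ × r σ ⊆ η × η ⊆ σ)) ×
    (∀ η σ σ' → IsFacet F σ → IsFacet F σ' →
       r σ ⊆ η → η ⊆ σ → r σ' ⊆ η → η ⊆ σ' → σ ≡ σ')

  ℤsum : ∀ {m} → (Fin m → ℤ) → ℤ
  ℤsum {zero} f = 0ℤ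
  ℤsum {suc m} f = f zero + ℤsum (λ i → f (suc i))

  ℕsum : ∀ {m} → (Fin m → ℕ) → ℕ
  ℕsum {zero} f = 0
  ℕsum {suc m} f = f zero Data.Nat.+ ℕsum (λ i → f (suc i))

  below : Subset n → Fin n → ℕ
  below η v = ℕsum λ u → if does (u ∈? η) then (if does (u <? v) then 1 else 0) else 0

  -- chains: ℤ-valued functions on subsets; boundary map
  -- (∂c)(η) = Σ_{v ∉ η} (-1)^{#{u∈η : u<v}} c(η ∪ {v})
  ∂ : (Subset n → ℤ) → Subset n → ℤ
  ∂ c η = ℤsum λ v → if does (v ∈? η) then 0ℤ else ((-1ℤ ^ below η v) * c (η ∪ ⁅ v ⁆))

  -- c is a chain supported on the faces of F of size m (dimension m - 1)
  IsChain : Fam n → ℕ → (Subset n → ℤ) → Set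
  IsChain F m c = ∀ σ → ¬ (F σ × ∣ σ ∣ ≡ m) → c σ ≡ 0ℤ

  -- reduced homology in degree m - 1 vanishes (m - 1 ≥ -1)
  Acyclic : Fam n → ℕ → Set
  Acyclic F m = ∀ c → IsChain F m c → (∀ η → ∂ c η ≡ 0ℤ) →
    ∃[ d ] (IsChain F (suc m) d × (∀ σ → ∂ d σ ≡ c σ))

  CohenMacaulay : Fam n → Set
  CohenMacaulay F = Pure F ×
    (∀ τ → F τ → ∀ d → HasTopSize (Link F τ) d → ∀ m → m ≢ d → Acyclic (Link F τ) m)

  SeqCohenMacaulay : Fam n → Set
  SeqCohenMacaulay F = ∀ D → HasTopSize F D → ∀ i → suc i ≤ D → CohenMacaulay (PureSkel F i)

  Obstruction : (Fam n → Set) → Fam n → Set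
  Obstruction P F = ¬ P F ×
    (∀ W → (∀ v → v ∈ W → Vert F v) → (∃[ v ] (Vert F v × v ∉ W)) → P (Restrict F W))

{-# OPTIONS --safe #-}
module Submission where

-- Shellable complexes are partitionable and sequentially Cohen-Macaulay in every dimension: each facet σ of a
-- shelling adds an interval [r, σ] of faces, these intervals form the partition, and for r ≠ σ the interval is
-- contracted by a chain homotopy adding a vertex of σ outside r, also inside links and skeleta.
-- Conversely, a complex of dimension at most 2 is shellable unless some induced subcomplex is one of six
-- obstacles, none of which is partitionable or sequentially Cohen-Macaulay. Three of them are disconnected:
-- two disjoint edges, two triangles sharing a vertex with disconnected link, two disjoint triangles. The other
-- three are the bands of triangles i, i+1, i+2 modulo 5, 6 or 7, whose core circle is detected by a 1-cocycle.
-- To find a shelling or an obstacle, delete a vertex v, shell the remaining triangles, and attach the star of v.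
-- This works if the link of v meets the deletion of v in a connected graph. If no such v exists, some triangle vab
-- has a and b in different components of that graph for v, and a shortest strip of triangles from a to b
-- avoiding v closes up through vab to one of the three bands.

open import Defs
open import Data.Nat as ℕ using (ℕ; zero; suc; _≤_; _<_; z≤n; s≤s)
import Data.Nat.Properties as ℕₚ
open import Data.Integer as ℤ using (ℤ; 0ℤ; 1ℤ; -1ℤ)
import Data.Integer.Properties as ℤₚ
open import Data.Bool using (Bool; true; false; T; if_then_else_)
import Data.Bool.Properties as Boolₚ
open import Data.Empty as Empty using (⊥-elim)
open import Data.Nat.GeneralisedArithmetic using (fold)
import Data.Nat.DivMod as DivMod
open import Data.Unit using (tt)
open import Data.Fin as Fin using (Fin; zero; suc; #_)
open import Data.Fin.Properties as Finₚ using (any?; all?)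
open import Data.Fin.Subset using (Subset; _⊆_; _∈_; _∉_; _∩_; _∪_; _-_; ⊥; ⊤; ⁅_⁆; ∣_∣; inside; outside)
open import Data.Fin.Subset.Properties as Subₚ using (_∈?_; _⊆?_; ⊆-antisym; anySubset?; x∈⁅x⁆; x∈⁅y⁆⇒x≡y; x∈p∪q⁻; x∈p∪q⁺)
open import Data.Vec as Vec using ([]; _∷_; here; there; lookup; tabulate)
import Data.Vec.Properties as Vecₚ
import Data.Integer.Solver as ℤsolver
open import Data.List using (List; []; _∷_; _++_; reverse; length; map; filter)
import Data.List.Properties as Listₚ
open import Data.List.Relation.Unary.All as All using (All; []; _∷_)
open import Data.List.Relation.Unary.Any as Any using (Any; here; there)
import Data.List.Relation.Unary.Any.Properties as Anyₚ
open import Data.List.Relation.Unary.AllPairs using ([]; _∷_)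
open import Data.List.Relation.Unary.Unique.Propositional using (Unique)
import Data.List.Membership.Propositional as LM
import Data.List.Membership.Propositional.Properties as LMₚ
open import Data.Product using (∃-syntax; _×_; _,_; proj₁; proj₂)
open import Data.Sum using (_⊎_; inj₁; inj₂; [_,_]′)
open import Function using (_∘_; id)
open import Function.Bundles using (_⇔_; mk⇔; Equivalence)
open import Relation.Nullary using (¬_; Dec; yes; no; does)
open import Relation.Nullary.Decidable using (_×-dec_; _⊎-dec_; _→-dec_; ¬?; map′; dec-true; dec-false; decidable-stable; True; toWitness)
open import Relation.Binary.Definitions using (Tri; tri<; tri≈; tri>)
open import Relation.Binary.PropositionalEquality

-- Already in dimension 1 partitionability does not imply shellability: an edge beside a disjoint
-- hollow triangle is partitionable. The properties can therefore be compared only through induced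
-- subcomplexes. An obstacle prescribes only the top-dimensional faces that matter on its vertex
-- set, so each stands for a family of complexes with different lower faces. The lengths 5, 6, 7
-- belong to strips of two, three and four triangles: three more triangles, all through v, close the
-- strip. A strip of one triangle is impossible, because the edge ab would then join its ends in the
-- deletion of v. The strip must be a shortest one over all crossings of v, since a surplus triangle
-- inside a band is often excluded by the shorter strip that it would create.

private
  variable
    n : ℕ

-- Finite subsets

∈-split : ∀ {p q : Subset n} {x} → x ∈ p ∪ q → x ∈ p ⊎ x ∈ q
∈-split {p = p} {q} = x∈p∪q⁻ p q

∈-left : ∀ {p q : Subset n} {x} → x ∈ p → x ∈ p ∪ q
∈-left h = x∈p∪q⁺ (inj₁ h)

∈-right : ∀ {p q : Subset n} {x} → x ∈ q → x ∈ p ∪ q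
∈-right h = x∈p∪q⁺ (inj₂ h)

∪-lub : ∀ {p q r : Subset n} → p ⊆ r → q ⊆ r → p ∪ q ⊆ r
∪-lub f g h = [ f , g ]′ (∈-split h)

⁅⁆⊆ : ∀ {p : Subset n} {x} → x ∈ p → ⁅ x ⁆ ⊆ p
⁅⁆⊆ {x = x} h i with refl ← x∈⁅y⁆⇒x≡y x i = h

∈-del⁺ : ∀ {p : Subset n} {x y} → x ∈ p → x ≢ y → x ∈ p - y
∈-del⁺ = Subₚ.x∈p∧x≢y⇒x∈p-y

∈-del⁻ : ∀ {p : Subset n} {x y} → x ∈ p - y → x ∈ p
∈-del⁻ {p = p} {y = y} = Subₚ.p─q⊆p p ⁅ y ⁆

∉-del : ∀ {p : Subset n} x → x ∉ p - x
∉-del {p = inside  ∷ p} zero ()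
∉-del {p = outside ∷ p} zero ()
∉-del {p = _ ∷ p} (suc x) (there h) = ∉-del {p = p} x h

∈-del≢ : ∀ {p : Subset n} {x y} → x ∈ p - y → x ≢ y
∈-del≢ {p = p} {y = y} h refl = ∉-del {p = p} y h

⊆-del : ∀ {p q : Subset n} {x} → p ⊆ q → x ∉ p → p ⊆ q - x
⊆-del {p = p} f x∉p h = ∈-del⁺ (f h) (λ { refl → x∉p h })

∣-del∣ : ∀ {p : Subset n} {x} → x ∈ p → suc ∣ p - x ∣ ≡ ∣ p ∣
∣-del∣ {p = inside ∷ p} here = cong (λ s → suc ∣ s ∣) (Subₚ.p─⊥≡p p)
∣-del∣ {p = inside ∷ p} (there h) = cong suc (∣-del∣ h)
∣-del∣ {p = outside ∷ p} (there h) = ∣-del∣ h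

add-del : ∀ {p : Subset n} {x} → x ∈ p → (p - x) ∪ ⁅ x ⁆ ≡ p
add-del {p = p} {x} h = ⊆-antisym (∪-lub ∈-del⁻ (⁅⁆⊆ h)) λ {y} i → case′ y i (y Fin.≟ x)
  where
  case′ : ∀ y → y ∈ p → Dec (y ≡ x) → y ∈ (p - x) ∪ ⁅ x ⁆
  case′ y i (yes refl) = ∈-right {p = p - x} (x∈⁅x⁆ x)
  case′ y i (no y≢x) = ∈-left (∈-del⁺ i y≢x)

del-add : ∀ {p : Subset n} {x} → x ∉ p → (p ∪ ⁅ x ⁆) - x ≡ p
del-add {p = p} {x} x∉p = ⊆-antisym
  (λ h → [ id , (λ i → ⊥-elim (∈-del≢ {p = p ∪ ⁅ x ⁆} h (x∈⁅y⁆⇒x≡y x i))) ]′ (∈-split (∈-del⁻ h)))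
  (⊆-del ∈-left x∉p)

∣-add∣ : ∀ {p : Subset n} {x} → x ∉ p → ∣ p ∪ ⁅ x ⁆ ∣ ≡ suc ∣ p ∣
∣-add∣ {p = p} {x} x∉p =
  trans (sym (∣-del∣ (∈-right {p = p} (x∈⁅x⁆ x)))) (cong (suc ∘ ∣_∣) (del-add x∉p))

Disjoint : Subset n → Subset n → Set
Disjoint p q = ∀ x → x ∈ p → x ∉ q

disjoint⇒∩≡⊥ : ∀ {p q : Subset n} → Disjoint p q → p ∩ q ≡ ⊥
disjoint⇒∩≡⊥ {p = p} {q} d = Subₚ.Empty-unique λ (x , h) →
  d x (proj₁ (Subₚ.x∈p∩q⁻ p q h)) (proj₂ (Subₚ.x∈p∩q⁻ p q h))

∩≡⊥⇒disjoint : ∀ {p q : Subset n} → p ∩ q ≡ ⊥ → Disjoint p q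
∩≡⊥⇒disjoint e _ h i = Subₚ.∉⊥ (subst (_ ∈_) e (Subₚ.x∈p∩q⁺ (h , i)))

disjoint-tail : ∀ {s t} {p q : Subset n} → Disjoint (s ∷ p) (t ∷ q) → Disjoint p q
disjoint-tail d _ h i = d _ (there h) (there i)

∣∪∣-disjoint : ∀ {p q : Subset n} → Disjoint p q → ∣ p ∪ q ∣ ≡ ∣ p ∣ ℕ.+ ∣ q ∣
∣∪∣-disjoint {p = []} {[]} d = refl
∣∪∣-disjoint {p = inside ∷ p} {inside ∷ q} d = ⊥-elim (d _ here here)
∣∪∣-disjoint {p = inside ∷ p} {outside ∷ q} d = cong suc (∣∪∣-disjoint (disjoint-tail d))
∣∪∣-disjoint {p = outside ∷ p} {inside ∷ q} d =
  trans (cong suc (∣∪∣-disjoint (disjoint-tail d))) (sym (ℕₚ.+-suc ∣ p ∣ ∣ q ∣))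
∣∪∣-disjoint {p = outside ∷ p} {outside ∷ q} d = ∣∪∣-disjoint (disjoint-tail d)

∣⊆∣ : ∀ (p q : Subset n) → p ⊆ q → ∣ p ∣ ≤ ∣ q ∣
∣⊆∣ p q = Subₚ.p⊆q⇒∣p∣≤∣q∣

⊈⇒∃ : ∀ {p q : Subset n} → ¬ (p ⊆ q) → ∃[ x ] (x ∈ p × x ∉ q)
⊈⇒∃ {p = p} {q} p⊈q with any? (λ x → (x ∈? p) ×-dec ¬? (x ∈? q))
... | yes w = w
... | no ¬w = ⊥-elim (p⊈q λ {x} h → decidable-stable (x ∈? q) λ x∉q → ¬w (x , h , x∉q))

⊆∧∣≤∣⇒≡ : ∀ (p q : Subset n) → p ⊆ q → ∣ q ∣ ≤ ∣ p ∣ → p ≡ q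
⊆∧∣≤∣⇒≡ p q f le with q ⊆? p
... | yes g = ⊆-antisym f g
... | no ¬g = ⊥-elim (ℕₚ.<⇒≱ (Subₚ.p⊂q⇒∣p∣<∣q∣ (f , ⊈⇒∃ ¬g)) le)

∣∣≡0⇒≡⊥ : ∀ {p : Subset n} → ∣ p ∣ ≡ 0 → p ≡ ⊥
∣∣≡0⇒≡⊥ {n} {p} e = sym (⊆∧∣≤∣⇒≡ ⊥ p Subₚ.⊥⊆ (subst (_≤ ∣ ⊥ {n} ∣) (sym e) z≤n))

nonempty : ∀ {p : Subset n} {k} → ∣ p ∣ ≡ suc k → ∃[ x ] x ∈ p
nonempty {n} {p} e with Subₚ.nonempty? p
... | yes w = w
... | no ¬w with refl ← Subₚ.Empty-unique ¬w with () ← trans (sym (Subₚ.∣⊥∣≡0 n)) e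

intermediate : ∀ {p q : Subset n} {k} → p ⊆ q → ∣ p ∣ ≤ k → k ≤ ∣ q ∣ →
  ∃[ r ] (p ⊆ r × r ⊆ q × ∣ r ∣ ≡ k)
intermediate {n} {p} {q} {k} p⊆q p≤k k≤q = go (∣ q ∣ ℕ.∸ k) q p⊆q id (sym (ℕₚ.m∸n+n≡m k≤q))
  where
  go : ∀ m (s : Subset n) → p ⊆ s → s ⊆ q → ∣ s ∣ ≡ m ℕ.+ k → ∃[ r ] (p ⊆ r × r ⊆ q × ∣ r ∣ ≡ k)
  go zero s p⊆s s⊆q e = s , p⊆s , s⊆q , e
  go (suc m) s p⊆s s⊆q e =
    let x , x∈s , x∉p = ⊈⇒∃ λ f → ℕₚ.<⇒≱ (ℕₚ.≤-trans (s≤s (ℕₚ.m≤n+m k m)) (ℕₚ.≤-reflexive (sym e)))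
                                     (ℕₚ.≤-trans (∣⊆∣ s p f) p≤k)
    in go m (s - x) (⊆-del p⊆s x∉p) (s⊆q ∘ ∈-del⁻) (ℕₚ.suc-injective (trans (∣-del∣ {p = s} x∈s) e))

lookup⇒∈ : ∀ {p : Subset n} {x} → lookup p x ≡ true → x ∈ p
lookup⇒∈ {p = p} {x} = Vecₚ.lookup⇒[]= x p

∈⇒lookup : ∀ {p : Subset n} {x} → x ∈ p → lookup p x ≡ true
∈⇒lookup = Vecₚ.[]=⇒lookup

⟪_⟫ : {P : Fin n → Set} → (∀ x → Dec (P x)) → Subset n
⟪ P? ⟫ = tabulate (does ∘ P?)

∈-⟪⟫⁺ : ∀ {P : Fin n → Set} (P? : ∀ x → Dec (P x)) {x} → P x → x ∈ ⟪ P? ⟫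
∈-⟪⟫⁺ P? {x} h = lookup⇒∈ (trans (Vecₚ.lookup∘tabulate _ x) (dec-true (P? x) h))

∈-⟪⟫⁻ : ∀ {P : Fin n → Set} (P? : ∀ x → Dec (P x)) {x} → x ∈ ⟪ P? ⟫ → P x
∈-⟪⟫⁻ P? {x} h with P? x | trans (sym (Vecₚ.lookup∘tabulate (does ∘ P?) x)) (∈⇒lookup h)
... | yes p | _ = p
... | no _ | ()

allSubsets : ∀ n → List (Subset n)
allSubsets zero = [] ∷ []
allSubsets (suc n) = map (inside ∷_) (allSubsets n) ++ map (outside ∷_) (allSubsets n)

∈-allSubsets : ∀ (p : Subset n) → p LM.∈ allSubsets n
∈-allSubsets [] = here refl
∈-allSubsets (inside ∷ p) = LMₚ.∈-++⁺ˡ (LMₚ.∈-map⁺ (inside ∷_) (∈-allSubsets p))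
∈-allSubsets {suc n} (outside ∷ p) = LMₚ.∈-++⁺ʳ (map (inside ∷_) (allSubsets n)) (LMₚ.∈-map⁺ (outside ∷_) (∈-allSubsets p))

_≟ₛ_ : (p q : Subset n) → Dec (p ≡ q)
_≟ₛ_ = Vecₚ.≡-dec Boolₚ._≟_

allSubset? : {P : Subset n → Set} → (∀ p → Dec (P p)) → Dec (∀ p → P p)
allSubset? P? with anySubset? (¬? ∘ P?)
... | yes (p , ¬h) = no λ h → ¬h (h p)
... | no ¬w = yes λ p → decidable-stable (P? p) λ ¬h → ¬w (p , ¬h)

infix 4 _∈ₗ_ _∉ₗ_
_∈ₗ_ _∉ₗ_ : {A : Set} → A → List A → Set
_∈ₗ_ = LM._∈_
x ∉ₗ l = ¬ (x ∈ₗ l)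

-- Shellings and partitions

Cov : List (Subset n) → Subset n → Set
Cov pre η = Any (λ ρ → η ⊆ ρ) pre

Cov? : ∀ (pre : List (Subset n)) η → Dec (Cov pre η)
Cov? pre η = Any.any? (λ ρ → η ⊆? ρ) pre

Cov-⊆ : ∀ {pre : List (Subset n)} {η θ} → η ⊆ θ → Cov pre θ → Cov pre η
Cov-⊆ f (here g) = here (g ∘ f)
Cov-⊆ f (there c) = there (Cov-⊆ f c)

∈⇒Cov : ∀ {pre : List (Subset n)} {σ η} → σ ∈ₗ pre → η ⊆ σ → Cov pre η
∈⇒Cov (here refl) f = here f
∈⇒Cov (there h) f = there (∈⇒Cov h f)

Cov⇒∈ : ∀ {pre : List (Subset n)} {η} → Cov pre η → ∃[ σ ] (σ ∈ₗ pre × η ⊆ σ)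
Cov⇒∈ (here f) = _ , here refl , f
Cov⇒∈ (there h) = let σ , i , f = Cov⇒∈ h in σ , there i , f

-- σ meets the complex generated by pre in a union of codimension-one faces of σ.
Attach : List (Subset n) → Subset n → Set
Attach pre σ = ∀ η → η ⊆ σ → Cov pre η → ∃[ x ] (x ∈ σ × x ∉ η × Cov pre (σ - x))

-- Written with the last face first. Maximality of the faces is not part of this notion.
data Shelled {n} : List (Subset n) → Set where
  []  : Shelled []
  add : ∀ {pre σ} → ¬ Cov pre σ → Attach pre σ → Shelled pre → Shelled (σ ∷ pre)

ShelledBy : Fam n → List (Subset n) → Set
ShelledBy F l = Shelled l × All (IsFacet F) l × (∀ σ → IsFacet F σ → σ ∈ₗ l)

unique-split : ∀ {A : Set} (xs : List A) {x ys} → Unique (xs ++ x ∷ ys) → x ∉ₗ xs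
unique-split (z ∷ xs) (z# ∷ u) (here refl) = All.lookup z# (LMₚ.∈-++⁺ʳ xs (here refl)) refl
unique-split (z ∷ xs) (z# ∷ u) (there h) = unique-split xs u h

-- A facet inside an earlier facet would equal it by maximality, against uniqueness of the entries;
-- this gives freshness. A face of σ with one vertex fewer omits exactly one x, so it is σ - x,
-- which turns purity of the intersection into `Attach`.
shelling⇒shelledBy : ∀ {F : Fam n} {l} → IsShelling F l → ShelledBy F (reverse l)
shelling⇒shelledBy {n} {F} {l} (facets , uniq , complete , pure) =
  go [] l refl [] , All.tabulate (λ h → All.lookup facets (Anyₚ.reverse⁻ h)) , λ σ h → Anyₚ.reverse⁺ (complete σ h)
  where
  go : ∀ acc rest → l ≡ acc Data.List.ʳ++ rest → Shelled acc → Shelled (rest Data.List.ʳ++ acc)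
  go acc [] e s = s
  go acc (σ ∷ rest) e s = go (σ ∷ acc) rest e (add fresh attach s)
    where
    e′ : l ≡ reverse acc ++ σ ∷ rest
    e′ = trans e (Listₚ.ʳ++-defn acc)
    σ-facet : IsFacet F σ
    σ-facet = All.lookup facets (subst (σ ∈ₗ_) (sym e′) (LMₚ.∈-++⁺ʳ (reverse acc) (here refl)))
    fresh : ¬ Cov acc σ
    fresh c = unique-split (reverse acc) (subst Unique e′ uniq) (Anyₚ.reverse⁺ σ∈acc)
      where
      ρ = proj₁ (Cov⇒∈ c)
      ρ∈acc = proj₁ (proj₂ (Cov⇒∈ c))
      ρ-facet : IsFacet F ρ
      ρ-facet = All.lookup facets (subst (ρ ∈ₗ_) (sym e′) (LMₚ.∈-++⁺ˡ (Anyₚ.reverse⁺ ρ∈acc)))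
      σ∈acc : σ ∈ₗ acc
      σ∈acc = subst (_∈ₗ acc) (proj₂ σ-facet ρ (proj₁ ρ-facet) (proj₂ (proj₂ (Cov⇒∈ c)))) ρ∈acc
    attach : Attach acc σ
    attach η η⊆σ c with pure (reverse acc) σ rest e′ (λ { z → Anyₚ.¬Any[] (subst (λ l → Cov l η) z (Anyₚ.reverse⁺ c)) })
    ... | d , sd≡ , p with proj₂ (p η (η⊆σ , Anyₚ.reverse⁺ c))
    ... | η′ , η⊆η′ , (η′⊆σ , c′) , ∣η′∣≡d =
      let x , x∈σ , x∉η′ = ⊈⇒∃ λ f → ℕₚ.<⇒≱ (subst (_≤ ∣ σ ∣) (cong suc (sym ∣η′∣≡d)) (ℕₚ.≤-reflexive sd≡)) (∣⊆∣ σ η′ f)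
          η′≡ = ⊆∧∣≤∣⇒≡ η′ (σ - x) (⊆-del η′⊆σ x∉η′)
                  (ℕₚ.≤-reflexive (trans (ℕₚ.suc-injective (trans (∣-del∣ {p = σ} x∈σ) (sym sd≡))) (sym ∣η′∣≡d)))
      in x , x∈σ , x∉η′ ∘ η⊆η′ , subst (Cov acc) η′≡ (Anyₚ.reverse⁻ c′)

Shelled-++ : ∀ (xs : List (Subset n)) {ys} → Shelled (xs ++ ys) → Shelled ys
Shelled-++ [] s = s
Shelled-++ (_ ∷ xs) (add _ _ s) = Shelled-++ xs s

Shelled-unique : ∀ (acc rest : List (Subset n)) → Shelled acc → Unique rest →
  (∀ {σ} → σ ∈ₗ acc → σ ∉ₗ rest) → Unique (acc Data.List.ʳ++ rest)
Shelled-unique [] rest s u d = u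
Shelled-unique (σ ∷ acc) rest (add fresh _ s) u d =
  Shelled-unique acc (σ ∷ rest) s (All.tabulate (λ {x} h e → d (here refl) (subst (_∈ₗ rest) (sym e) h)) ∷ u)
    λ { i (here refl) → fresh (∈⇒Cov i id) ; i (there j) → d (there i) j }

shelledBy⇒shellable : ∀ {F : Fam n} {l} → ShelledBy F l → Shellable F
shelledBy⇒shellable {n} {F} {l} (s , facets , complete) =
  reverse l , All.tabulate (λ h → All.lookup facets (Anyₚ.reverse⁻ h)) , Shelled-unique l [] s [] (λ _ ()) , (λ σ h → Anyₚ.reverse⁺ (complete σ h)) , pure
  where
  pure : ∀ pre σ post → reverse l ≡ pre ++ σ ∷ post → pre ≢ [] →
       ∃[ d ] (suc d ≡ ∣ σ ∣ × PureOfSize (Inter pre σ) d)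
  pure pre σ post e pre≢[] with split
    where
    l≡ : l ≡ reverse post ++ σ ∷ reverse pre
    l≡ = begin
      l ≡⟨ sym (Listₚ.reverse-involutive l) ⟩
      reverse (reverse l) ≡⟨ cong reverse e ⟩
      reverse (pre ++ σ ∷ post) ≡⟨ Listₚ.reverse-++ pre (σ ∷ post) ⟩
      reverse (σ ∷ post) ++ reverse pre ≡⟨ cong (_++ reverse pre) (Listₚ.unfold-reverse σ post) ⟩
      (reverse post ++ σ ∷ []) ++ reverse pre ≡⟨ Listₚ.++-assoc (reverse post) _ _ ⟩
      reverse post ++ σ ∷ reverse pre ∎
      where open ≡-Reasoning
    split : Shelled (σ ∷ reverse pre)
    split = Shelled-++ (reverse post) (subst Shelled l≡ s)
  ... | add _ attach _ with pre
  ... | [] = ⊥-elim (pre≢[] refl)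
  -- The empty face is always covered by ρ, so `attach` yields a vertex x of σ; the required
  -- dimension is read off from σ - x.
  ... | ρ ∷ pre′ with attach ⊥ Subₚ.⊥⊆ (Anyₚ.reverse⁺ {xs = ρ ∷ pre′} (here Subₚ.⊥⊆))
  ... | x , x∈σ , _ = ∣ σ - x ∣ , ∣-del∣ {p = σ} x∈σ , λ η (η⊆σ , c) →
    let y , y∈σ , y∉η , c′ = attach η η⊆σ (Anyₚ.reverse⁺ c)
        size = ℕₚ.suc-injective (trans (∣-del∣ {p = σ} y∈σ) (sym (∣-del∣ {p = σ} x∈σ)))
    in subst (∣ η ∣ ≤_) size (∣⊆∣ η (σ - y) (⊆-del η⊆σ y∉η))
     , σ - y , ⊆-del η⊆σ y∉η , (∈-del⁻ , Anyₚ.reverse⁻ c′) , size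

minFace? : (pre : List (Subset n)) (σ : Subset n) → ∀ x → Dec (x ∈ σ × Cov pre (σ - x))
minFace? pre σ x = (x ∈? σ) ×-dec Cov? pre (σ - x)

-- The restriction of σ in the sense of Björner and Wachs: by `minFace-new` and `minFace-old` the
-- faces of σ not covered by `pre` are those between it and σ.
minFace : List (Subset n) → Subset n → Subset n
minFace pre σ = ⟪ minFace? pre σ ⟫

minFace-⊆ : ∀ (pre : List (Subset n)) σ → minFace pre σ ⊆ σ
minFace-⊆ pre σ h = proj₁ (∈-⟪⟫⁻ (minFace? pre σ) h)

minFace-new : ∀ {pre : List (Subset n)} {σ η} → Attach pre σ → η ⊆ σ → minFace pre σ ⊆ η → ¬ Cov pre η
minFace-new {pre = pre} {σ} {η} attach η⊆σ f c =
  let x , x∈σ , x∉η , c′ = attach η η⊆σ c in x∉η (f (∈-⟪⟫⁺ (minFace? pre σ) (x∈σ , c′)))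

minFace-old : ∀ {pre : List (Subset n)} {σ η} → η ⊆ σ → ¬ (minFace pre σ ⊆ η) → Cov pre η
minFace-old {pre = pre} {σ} η⊆σ ¬f =
  let x , x∈r , x∉η = ⊈⇒∃ ¬f in Cov-⊆ (⊆-del η⊆σ x∉η) (proj₂ (∈-⟪⟫⁻ (minFace? pre σ) x∈r))

restriction : List (Subset n) → Subset n → Subset n
restriction [] σ = ⊥
restriction (ρ ∷ pre) σ = if does (ρ ≟ₛ σ) then minFace pre σ else restriction pre σ

-- A face belongs to the interval of the earliest facet containing it. Later facets have only
-- uncovered faces in their intervals, so no second interval contains it.
shellable⇒partitionable : ∀ {F : Fam n} → (∀ η → F η → ∃[ σ ] (IsFacet F σ × η ⊆ σ)) → Shellable F → Partitionable F
shellable⇒partitionable {n} {F} inFacet (l₀ , sh) with shelling⇒shelledBy sh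
... | s₀ , facets , complete = restriction l
    , (λ σ h → res-⊆ l σ)
    , (λ η h → let σ , σ-facet , η⊆σ = inFacet η h
                   ρ , ρ∈l , f , g = cover s₀ (∈⇒Cov (complete σ σ-facet) η⊆σ)
               in ρ , All.lookup facets ρ∈l , f , g)
    , λ η σ σ′ h h′ f g f′ g′ → disjoint s₀ (complete σ h) (complete σ′ h′) f g f′ g′
  where
  l = reverse l₀
  res-⊆ : ∀ l σ → restriction l σ ⊆ σ
  res-⊆ [] σ h = ⊥-elim (Subₚ.∉⊥ h)
  res-⊆ (ρ ∷ pre) σ with does (ρ ≟ₛ σ)
  ... | true = minFace-⊆ pre σ
  ... | false = res-⊆ pre σ
  res-head : ∀ (pre : List (Subset n)) {σ} → restriction (σ ∷ pre) σ ≡ minFace pre σ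
  res-head pre {σ} with σ ≟ₛ σ
  ... | yes _ = refl
  ... | no σ≢σ = ⊥-elim (σ≢σ refl)
  res-tail : ∀ (pre : List (Subset n)) {ρ σ} → ρ ≢ σ → restriction (ρ ∷ pre) σ ≡ restriction pre σ
  res-tail pre {ρ} {σ} ρ≢σ with ρ ≟ₛ σ
  ... | yes e = ⊥-elim (ρ≢σ e)
  ... | no _ = refl
  tail≢ : ∀ {pre : List (Subset n)} {ρ σ} → ¬ Cov pre ρ → σ ∈ₗ pre → ρ ≢ σ
  tail≢ fresh i refl = fresh (∈⇒Cov i id)
  cover : ∀ {l η} → Shelled l → Cov l η → ∃[ σ ] (σ ∈ₗ l × restriction l σ ⊆ η × η ⊆ σ)
  cover {σ ∷ pre} {η} (add fresh attach s) c with Cov? pre η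
  ... | yes c′ = let ρ , i , f , g = cover s c′
                 in ρ , there i , subst (_⊆ η) (sym (res-tail pre (tail≢ fresh i))) f , g
  cover {σ ∷ pre} {η} (add fresh attach s) (there c) | no ¬c = ⊥-elim (¬c c)
  cover {σ ∷ pre} {η} (add fresh attach s) (here g) | no ¬c = σ , here refl ,
    subst (_⊆ η) (sym (res-head pre)) (decidable-stable (minFace pre σ ⊆? η) λ ¬f → ¬c (minFace-old g ¬f)) , g
  disjoint : ∀ {l η σ σ′} → Shelled l → σ ∈ₗ l → σ′ ∈ₗ l → restriction l σ ⊆ η → η ⊆ σ →
    restriction l σ′ ⊆ η → η ⊆ σ′ → σ ≡ σ′
  disjoint s (here refl) (here refl) f g f′ g′ = refl
  disjoint {σ ∷ pre} {η} (add fresh attach s) (here refl) (there j) f g f′ g′ =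
    ⊥-elim (minFace-new attach g (subst (_⊆ η) (res-head pre) f) (∈⇒Cov j g′))
  disjoint {σ ∷ pre} {η} (add fresh attach s) (there i) (here refl) f g f′ g′ =
    ⊥-elim (minFace-new attach g′ (subst (_⊆ η) (res-head pre) f′) (∈⇒Cov i g))
  disjoint {σ ∷ pre} {η} (add fresh attach s) (there i) (there j) f g f′ g′ =
    disjoint s i j (subst (_⊆ η) (res-tail pre (tail≢ fresh i)) f) g (subst (_⊆ η) (res-tail pre (tail≢ fresh j)) f′) g′

-- Simplicial chains

-- `k` is the ambient vertex number that `ℤsum` carries implicitly. It is independent of the number
-- `m` of summands and cannot be inferred, so it is passed explicitly throughout.
sum-cong : ∀ {k m} {f g : Fin m → ℤ} → (∀ i → f i ≡ g i) → ℤsum {k} f ≡ ℤsum {k} g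
sum-cong {m = zero} e = refl
sum-cong {k} {suc m} e = cong₂ ℤ._+_ (e zero) (sum-cong {k} (e ∘ suc))

sum-0 : ∀ {k m} {f : Fin m → ℤ} → (∀ i → f i ≡ 0ℤ) → ℤsum {k} f ≡ 0ℤ
sum-0 {m = zero} e = refl
sum-0 {k} {suc m} e = cong₂ ℤ._+_ (e zero) (sum-0 {k} (e ∘ suc))

sum-+ : ∀ {k m} (f g : Fin m → ℤ) → ℤsum {k} (λ i → f i ℤ.+ g i) ≡ ℤsum {k} f ℤ.+ ℤsum {k} g
sum-+ {m = zero} f g = refl
sum-+ {k} {suc m} f g = trans (cong (ℤ._+_ (f zero ℤ.+ g zero)) (sum-+ {k} (f ∘ suc) (g ∘ suc)))
  (solve 4 (λ a b c d → (a :+ b) :+ (c :+ d) := (a :+ c) :+ (b :+ d)) refl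
    (f zero) (g zero) (ℤsum {k} (f ∘ suc)) (ℤsum {k} (g ∘ suc)))
  where open ℤsolver.+-*-Solver

sum-neg : ∀ {k m} (f : Fin m → ℤ) → ℤsum {k} (λ i → ℤ.- f i) ≡ ℤ.- ℤsum {k} f
sum-neg {m = zero} f = refl
sum-neg {k} {suc m} f = trans (cong (ℤ._+_ (ℤ.- f zero)) (sum-neg {k} (f ∘ suc)))
  (sym (ℤₚ.neg-distrib-+ (f zero) (ℤsum {k} (f ∘ suc))))

sum-* : ∀ {k m} a (f : Fin m → ℤ) → ℤsum {k} (λ i → a ℤ.* f i) ≡ a ℤ.* ℤsum {k} f
sum-* {m = zero} a f = sym (ℤₚ.*-zeroʳ a)
sum-* {k} {suc m} a f = trans (cong (ℤ._+_ (a ℤ.* f zero)) (sum-* {k} a (f ∘ suc)))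
  (sym (ℤₚ.*-distribˡ-+ a (f zero) (ℤsum {k} (f ∘ suc))))

sum-single : ∀ {k m} {f : Fin m → ℤ} i → (∀ j → j ≢ i → f j ≡ 0ℤ) → ℤsum {k} f ≡ f i
sum-single {k} {f = f} zero e = trans (cong (ℤ._+_ (f zero)) (sum-0 {k} λ j → e (suc j) λ ())) (ℤₚ.+-identityʳ (f zero))
sum-single {k} {f = f} (suc i) e = trans
  (cong₂ ℤ._+_ (e zero λ ()) (sum-single {k} i λ j j≢i → e (suc j) (j≢i ∘ Finₚ.suc-injective)))
  (ℤₚ.+-identityˡ (f (suc i)))

sum-swap : ∀ {k m l} (f : Fin m → Fin l → ℤ) →
  ℤsum {k} (λ i → ℤsum {k} (f i)) ≡ ℤsum {k} (λ j → ℤsum {k} (λ i → f i j))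
sum-swap {k} {zero} {l} f = sym (sum-0 {k} {l} λ _ → refl)
sum-swap {k} {suc m} f = trans (cong (ℤ._+_ (ℤsum {k} (f zero))) (sum-swap {k} (f ∘ suc)))
  (sym (sum-+ {k} (f zero) λ j → ℤsum {k} (λ i → f (suc i) j)))

i≡-i⇒i≡0 : ∀ {i} → i ≡ ℤ.- i → i ≡ 0ℤ
i≡-i⇒i≡0 {ℤ.+ zero} e = refl
i≡-i⇒i≡0 {ℤ.+ suc _} ()
i≡-i⇒i≡0 {ℤ.-[1+ _ ]} ()

-- Exchanging the two summations gives S = -S, and the integers have no 2-torsion. Both `∂∂≡0` and
-- `colouring-kills-∂` rest on this.
sum-antisym : ∀ {k m} (f : Fin m → Fin m → ℤ) → (∀ i j → f i j ≡ ℤ.- f j i) →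
  ℤsum {k} (λ i → ℤsum {k} (f i)) ≡ 0ℤ
sum-antisym {k} {m} f e = i≡-i⇒i≡0 (trans (sum-swap {k} f) (trans
  (sum-cong {k} {m} λ j → trans (sum-cong {k} {m} λ i → e i j) (sum-neg {k} (f j)))
  (sum-neg {k} λ j → ℤsum {k} (f j))))

sgn : ℕ → ℤ
sgn k = -1ℤ ℤ.^ k

sgn-+ : ∀ a b → sgn (a ℕ.+ b) ≡ sgn a ℤ.* sgn b
sgn-+ a b = ℤₚ.^-distribˡ-+-* -1ℤ a b

sgn-sq : ∀ a → sgn a ℤ.* sgn a ≡ 1ℤ
sgn-sq zero = refl
sgn-sq (suc a) = trans (solve 1 (λ s → (con -1ℤ :* s) :* (con -1ℤ :* s) := s :* s) refl (sgn a)) (sgn-sq a)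
  where open ℤsolver.+-*-Solver

sgn-cancel : ∀ a {x} → sgn a ℤ.* x ≡ 0ℤ → x ≡ 0ℤ
sgn-cancel a {x} e = begin
  x ≡⟨ sym (ℤₚ.*-identityˡ x) ⟩
  1ℤ ℤ.* x ≡⟨ cong (ℤ._* x) (sym (sgn-sq a)) ⟩
  sgn a ℤ.* sgn a ℤ.* x ≡⟨ ℤₚ.*-assoc (sgn a) (sgn a) x ⟩
  sgn a ℤ.* (sgn a ℤ.* x) ≡⟨ cong (sgn a ℤ.*_) e ⟩
  sgn a ℤ.* 0ℤ ≡⟨ ℤₚ.*-zeroʳ (sgn a) ⟩
  0ℤ ∎
  where open ≡-Reasoning

ℕsum-cong : ∀ {k m} {f g : Fin m → ℕ} → (∀ i → f i ≡ g i) → ℕsum {k} f ≡ ℕsum {k} g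
ℕsum-cong {m = zero} e = refl
ℕsum-cong {k} {suc m} e = cong₂ ℕ._+_ (e zero) (ℕsum-cong {k} (e ∘ suc))

ℕsum-update : ∀ {k m} {f g : Fin m → ℕ} {c} i → (∀ j → j ≢ i → f j ≡ g j) → f i ≡ g i ℕ.+ c →
  ℕsum {k} f ≡ ℕsum {k} g ℕ.+ c
ℕsum-update {k} {f = f} {g} {c} zero e e₀ = trans (cong₂ ℕ._+_ e₀ (ℕsum-cong {k} {f = f ∘ suc} {g ∘ suc} λ j → e (suc j) λ ()))
  (trans (ℕₚ.+-assoc (g zero) c G) (trans (cong (g zero ℕ.+_) (ℕₚ.+-comm c G)) (sym (ℕₚ.+-assoc (g zero) G c))))
  where G = ℕsum {k} (g ∘ suc)
ℕsum-update {k} {g = g} {c} (suc i) e eᵢ = trans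
  (cong₂ ℕ._+_ (e zero λ ()) (ℕsum-update {k} i (λ j j≢i → e (suc j) (j≢i ∘ Finₚ.suc-injective)) eᵢ))
  (sym (ℕₚ.+-assoc (g zero) _ c))

infix 8 _≺_
_≺_ : Fin n → Fin n → ℕ
u ≺ v = if does (u Fin.<? v) then 1 else 0

≺-yes : ∀ {u v : Fin n} → u Fin.< v → u ≺ v ≡ 1
≺-yes {u = u} {v} p = cong (λ b → if b then 1 else 0) (dec-true (u Fin.<? v) p)

≺-no : ∀ {u v : Fin n} → ¬ (u Fin.< v) → u ≺ v ≡ 0
≺-no {u = u} {v} p = cong (λ b → if b then 1 else 0) (dec-false (u Fin.<? v) p)

-- For distinct u and v exactly one of the two indicators is 1. Every cancellation of signs below
-- comes down to this.
sgn-≺ : ∀ {u v : Fin n} → u ≢ v → sgn (u ≺ v) ≡ ℤ.- sgn (v ≺ u)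
sgn-≺ {u = u} {v} u≢v with u Fin.<? v | v Fin.<? u
... | yes p | yes q = ⊥-elim (ℕₚ.<-asym p q)
... | yes p | no q = trans (cong sgn (≺-yes p)) (sym (cong (λ k → ℤ.- sgn k) (≺-no q)))
... | no p | yes q = trans (cong sgn (≺-no p)) (sym (cong (λ k → ℤ.- sgn k) (≺-yes q)))
... | no p | no q = ⊥-elim (u≢v (Finₚ.toℕ-injective (ℕₚ.≤-antisym (ℕₚ.≮⇒≥ q) (ℕₚ.≮⇒≥ p))))

does-cong : ∀ {A B : Set} (a? : Dec A) (b? : Dec B) → (A → B) → (B → A) → does a? ≡ does b?
does-cong (yes a) b? f g = sym (dec-true b? (f a))
does-cong (no ¬a) b? f g = sym (dec-false b? (¬a ∘ g))

below-add : ∀ (η : Subset n) {v} w → v ∉ η → below (η ∪ ⁅ v ⁆) w ≡ below η w ℕ.+ (v ≺ w)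
below-add {n} η {v} w v∉η = ℕsum-update {n} v
  (λ u u≢v → cong (λ b → if b then (u ≺ w) else 0)
     (does-cong (u ∈? (η ∪ ⁅ v ⁆)) (u ∈? η)
       (λ h → [ id , (λ i → ⊥-elim (u≢v (x∈⁅y⁆⇒x≡y v i))) ]′ (∈-split h)) ∈-left))
  (trans (cong (λ b → if b then (v ≺ w) else 0) (dec-true (v ∈? (η ∪ ⁅ v ⁆)) (∈-right (x∈⁅x⁆ v))))
         (cong (λ b → (if b then (v ≺ w) else 0) ℕ.+ (v ≺ w)) (sym (dec-false (v ∈? η) v∉η))))

below-⊥ : ∀ (w : Fin n) → below ⊥ w ≡ 0
below-⊥ {n} w = go n (λ u → cong (λ b → if b then (u ≺ w) else 0) (dec-false (u ∈? ⊥) Subₚ.∉⊥))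
  where
  go : ∀ m {f : Fin m → ℕ} → (∀ u → f u ≡ 0) → ℕsum {n} f ≡ 0
  go zero e = refl
  go (suc m) e = cong₂ ℕ._+_ (e zero) (go m (e ∘ suc))

Chain : ℕ → Set
Chain n = Subset n → ℤ

∂-term : Chain n → Subset n → Fin n → ℤ
∂-term c η v = if does (v ∈? η) then 0ℤ else (sgn (below η v) ℤ.* c (η ∪ ⁅ v ⁆))

∂-term-∈ : ∀ {c : Chain n} {η v} → v ∈ η → ∂-term c η v ≡ 0ℤ
∂-term-∈ {c = c} {η} {v} h rewrite dec-true (v ∈? η) h = refl

∂-term-∉ : ∀ {c : Chain n} {η v} → v ∉ η → ∂-term c η v ≡ sgn (below η v) ℤ.* c (η ∪ ⁅ v ⁆)
∂-term-∉ {c = c} {η} {v} h rewrite dec-false (v ∈? η) h = refl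

∂-term-0 : ∀ {c : Chain n} {η v} → (v ∉ η → c (η ∪ ⁅ v ⁆) ≡ 0ℤ) → ∂-term c η v ≡ 0ℤ
∂-term-0 {c = c} {η} {v} e with v ∈? η
... | yes _ = refl
... | no v∉η = trans (cong (sgn (below η v) ℤ.*_) (e v∉η)) (ℤₚ.*-zeroʳ (sgn (below η v)))

∂-0 : ∀ {c : Chain n} {η} → (∀ v → v ∉ η → c (η ∪ ⁅ v ⁆) ≡ 0ℤ) → ∂ c η ≡ 0ℤ
∂-0 {n} {c} {η} e = sum-0 {n} {n} λ v → ∂-term-0 {c = c} {η} (e v)

∂-single : ∀ (c : Chain n) η x → x ∉ η → (∀ v → v ≢ x → v ∉ η → c (η ∪ ⁅ v ⁆) ≡ 0ℤ) →
  ∂ c η ≡ sgn (below η x) ℤ.* c (η ∪ ⁅ x ⁆)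
∂-single {n} c η x x∉η e = trans (sum-single {n} {n} x λ v v≢x → ∂-term-0 {c = c} {η} (e v v≢x)) (∂-term-∉ {c = c} x∉η)

infixl 6 _⊞_
_⊞_ : Chain n → Chain n → Chain n
(c ⊞ d) η = c η ℤ.+ d η

neg : Chain n → Chain n
neg c η = ℤ.- c η

∂-⊞ : ∀ (c d : Chain n) η → ∂ (c ⊞ d) η ≡ ∂ c η ℤ.+ ∂ d η
∂-⊞ {n} c d η = trans (sum-cong {n} {n} λ v → term v) (sum-+ {n} (∂-term c η) (∂-term d η))
  where
  term : ∀ v → ∂-term (c ⊞ d) η v ≡ ∂-term c η v ℤ.+ ∂-term d η v
  term v with does (v ∈? η)
  ... | true = refl
  ... | false = ℤₚ.*-distribˡ-+ (sgn (below η v)) (c (η ∪ ⁅ v ⁆)) (d (η ∪ ⁅ v ⁆))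

∂-neg : ∀ (c : Chain n) η → ∂ (neg c) η ≡ ℤ.- ∂ c η
∂-neg {n} c η = trans (sum-cong {n} {n} λ v → term v) (sum-neg {n} (∂-term c η))
  where
  term : ∀ v → ∂-term (neg c) η v ≡ ℤ.- ∂-term c η v
  term v with does (v ∈? η)
  ... | true = refl
  ... | false = sym (ℤₚ.neg-distribʳ-* (sgn (below η v)) (c (η ∪ ⁅ v ⁆)))

∪-swap : ∀ (η α β : Subset n) → (η ∪ α) ∪ β ≡ (η ∪ β) ∪ α
∪-swap {n} η α β = trans (Subₚ.∪-assoc η α β) (trans (cong (η ∪_) (Subₚ.∪-comm α β)) (sym (Subₚ.∪-assoc η β α)))

-- `f v w` is the contribution of adding v and then w. Exchanging them leaves the product of the two
-- `below` signs alone and changes only the sign of `v ≺ w`.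
∂∂≡0 : ∀ (c : Chain n) η → ∂ (∂ c) η ≡ 0ℤ
∂∂≡0 {n} c η = trans (sum-cong {n} {n} expand) (sum-antisym {n} f antisym)
  where
  f : Fin n → Fin n → ℤ
  f v w = if does (v ∈? η) then 0ℤ else (sgn (below η v) ℤ.* ∂-term c (η ∪ ⁅ v ⁆) w)
  expand : ∀ v → ∂-term (∂ c) η v ≡ ℤsum {n} (f v)
  expand v with does (v ∈? η)
  ... | true = sym (sum-0 {n} {n} λ _ → refl)
  ... | false = sym (sum-* {n} (sgn (below η v)) (∂-term c (η ∪ ⁅ v ⁆)))
  f-∈ : ∀ {v w} → v ∈ η → f v w ≡ 0ℤ
  f-∈ {v} h rewrite dec-true (v ∈? η) h = refl
  f-∉ : ∀ {v w} → v ∉ η → f v w ≡ sgn (below η v) ℤ.* ∂-term c (η ∪ ⁅ v ⁆) w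
  f-∉ {v} h rewrite dec-false (v ∈? η) h = refl
  f-∈′ : ∀ {v w} → w ∈ η ∪ ⁅ v ⁆ → f v w ≡ 0ℤ
  f-∈′ {v} {w} h with v ∈? η
  ... | yes _ = refl
  ... | no _ = trans (cong (sgn (below η v) ℤ.*_) (∂-term-∈ {c = c} h)) (ℤₚ.*-zeroʳ (sgn (below η v)))
  f-∉∉ : ∀ {v w} → v ∉ η → w ∉ η → v ≢ w →
    f v w ≡ sgn (below η v) ℤ.* sgn (below η w) ℤ.* (sgn (v ≺ w) ℤ.* c ((η ∪ ⁅ v ⁆) ∪ ⁅ w ⁆))
  f-∉∉ {v} {w} v∉ w∉ v≢w = begin
    f v w ≡⟨ f-∉ v∉ ⟩
    sgn (below η v) ℤ.* ∂-term c (η ∪ ⁅ v ⁆) w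
      ≡⟨ cong (sgn (below η v) ℤ.*_) (∂-term-∉ {c = c} λ h → [ w∉ , (λ i → v≢w (sym (x∈⁅y⁆⇒x≡y v i))) ]′ (∈-split h)) ⟩
    sgn (below η v) ℤ.* (sgn (below (η ∪ ⁅ v ⁆) w) ℤ.* X)
      ≡⟨ cong (λ k → sgn (below η v) ℤ.* (sgn k ℤ.* X)) (below-add η w v∉) ⟩
    sgn (below η v) ℤ.* (sgn (below η w ℕ.+ (v ≺ w)) ℤ.* X)
      ≡⟨ cong (λ s → sgn (below η v) ℤ.* (s ℤ.* X)) (sgn-+ (below η w) (v ≺ w)) ⟩
    sgn (below η v) ℤ.* (sgn (below η w) ℤ.* sgn (v ≺ w) ℤ.* X)
      ≡⟨ solve 4 (λ a b s x → a :* (b :* s :* x) := a :* b :* (s :* x)) refl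
           (sgn (below η v)) (sgn (below η w)) (sgn (v ≺ w)) X ⟩
    sgn (below η v) ℤ.* sgn (below η w) ℤ.* (sgn (v ≺ w) ℤ.* X) ∎
    where
    open ≡-Reasoning
    open ℤsolver.+-*-Solver
    X = c ((η ∪ ⁅ v ⁆) ∪ ⁅ w ⁆)
  zeros : ∀ {a b} → a ≡ 0ℤ → b ≡ 0ℤ → a ≡ ℤ.- b
  zeros refl refl = refl
  antisym : ∀ v w → f v w ≡ ℤ.- f w v
  antisym v w = go (v ∈? η) (w ∈? η) (v Fin.≟ w)
   where
   go : ∀ {v w} → Dec (v ∈ η) → Dec (w ∈ η) → Dec (v ≡ w) → f v w ≡ ℤ.- f w v
   go {v} {w} (yes v∈) _ _ = zeros (f-∈ {v} {w} v∈) (f-∈′ {w} {v} (∈-left v∈))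
   go {v} {w} (no _) (yes w∈) _ = zeros (f-∈′ {v} {w} (∈-left w∈)) (f-∈ {w} {v} w∈)
   go {v} {w} (no _) (no _) (yes refl) = zeros (f-∈′ {v} {v} v∈) (f-∈′ {v} {v} v∈)
     where v∈ = ∈-right (x∈⁅x⁆ v)
   go {v} {w} (no v∉) (no w∉) (no v≢w) = begin
     f v w ≡⟨ f-∉∉ v∉ w∉ v≢w ⟩
     A ℤ.* B ℤ.* (sgn (v ≺ w) ℤ.* c ((η ∪ ⁅ v ⁆) ∪ ⁅ w ⁆))
       ≡⟨ cong₂ (λ s θ → A ℤ.* B ℤ.* (s ℤ.* c θ)) (sgn-≺ v≢w) (∪-swap η ⁅ v ⁆ ⁅ w ⁆) ⟩
     A ℤ.* B ℤ.* (ℤ.- sgn (w ≺ v) ℤ.* X)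
       ≡⟨ solve 4 (λ a b s x → a :* b :* (:- s :* x) := :- (b :* a :* (s :* x))) refl A B (sgn (w ≺ v)) X ⟩
     ℤ.- (B ℤ.* A ℤ.* (sgn (w ≺ v) ℤ.* X)) ≡⟨ cong ℤ.-_ (sym (f-∉∉ w∉ v∉ (v≢w ∘ sym))) ⟩
     ℤ.- f w v ∎
     where
     open ≡-Reasoning
     open ℤsolver.+-*-Solver
     A = sgn (below η v)
     B = sgn (below η w)
     X = c ((η ∪ ⁅ w ⁆) ∪ ⁅ v ⁆)

-- The chain homotopy h contracts the interval N of new faces along x, so c - ∂ h lives on K.
acyclic-step : ∀ {K N K′ : Fam n} (N? : ∀ η → Dec (N η)) (x : Fin n) (m : ℕ) →
  (∀ η → K′ η → K η ⊎ N η) → (∀ η → K η → K′ η) → (∀ η → N η → K′ η) →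
  (∀ η → N η → x ∉ η → ∣ η ∣ ≡ m → N (η ∪ ⁅ x ⁆)) →
  (∀ η → N η → x ∈ η → N (η - x)) →
  (∀ η v → N η → K′ (η ∪ ⁅ v ⁆) → N (η ∪ ⁅ v ⁆)) →
  (∀ η θ → η ⊆ θ → K′ θ → K′ η) →
  Acyclic K m → Acyclic K′ m
acyclic-step {n} {K} {N} {K′} N? x m split K⊆ N⊆ up closed over down acyclic c c-chain ∂c≡0 =
  h ⊞ d , (λ σ ¬σ → cong₂ ℤ._+_ (h-chain σ ¬σ) (d-chain σ λ (k , s) → ¬σ (K⊆ σ k , s)))
        , λ η → trans (∂-⊞ h d η) (trans (cong (ℤ._+_ (∂ h η)) (∂d≡ η))
            (solve 2 (λ a b → a :+ (b :- a) := b) refl (∂ h η) (c η)))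
  where
  open ℤsolver.+-*-Solver
  -- The cone with apex x over the part of c on new faces without x. Its sign is the one with which
  -- ∂ returns to ζ - x, so the two signs square to 1 and ∂ h = c there.
  h : Chain n
  h ζ with x ∈? ζ | N? (ζ - x)
  ... | yes _ | yes _ = sgn (below (ζ - x) x) ℤ.* c (ζ - x)
  ... | yes _ | no _  = 0ℤ
  ... | no _  | _     = 0ℤ
  h-∉ : ∀ ζ → x ∉ ζ → h ζ ≡ 0ℤ
  h-∉ ζ x∉ with x ∈? ζ | N? (ζ - x)
  ... | yes x∈ | _ = ⊥-elim (x∉ x∈)
  ... | no _ | _ = refl
  h-new : ∀ η → x ∉ η → N η → h (η ∪ ⁅ x ⁆) ≡ sgn (below η x) ℤ.* c η
  h-new η x∉ Nη with x ∈? (η ∪ ⁅ x ⁆) | N? ((η ∪ ⁅ x ⁆) - x)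
  ... | no ¬x∈ | _ = ⊥-elim (¬x∈ (∈-right (x∈⁅x⁆ x)))
  ... | yes _ | no ¬N = ⊥-elim (¬N (subst N (sym (del-add x∉)) Nη))
  ... | yes _ | yes _ = cong (λ θ → sgn (below θ x) ℤ.* c θ) (del-add x∉)
  h-chain : IsChain K′ (suc m) h
  h-chain ζ ¬ζ with x ∈? ζ | N? (ζ - x)
  ... | no _ | _ = refl
  ... | yes _ | no _ = refl
  ... | yes x∈ | yes Nζ = trans (cong (sgn (below (ζ - x) x) ℤ.*_) (c-chain (ζ - x) absent)) (ℤₚ.*-zeroʳ (sgn (below (ζ - x) x)))
    where
    absent : ¬ (K′ (ζ - x) × ∣ ζ - x ∣ ≡ m)
    absent (_ , s) = ¬ζ (N⊆ ζ (subst N (add-del x∈) (up (ζ - x) Nζ (∉-del x) s))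
                     , trans (sym (∣-del∣ {p = ζ} x∈)) (cong suc s))
  ∂h-new : ∀ η → x ∉ η → N η → ∂ h η ≡ c η
  ∂h-new η x∉ Nη = begin
    ∂ h η ≡⟨ ∂-single h η x x∉ (λ v v≢x v∉ → h-∉ (η ∪ ⁅ v ⁆)
               λ i → [ x∉ , (λ j → v≢x (sym (x∈⁅y⁆⇒x≡y v j))) ]′ (∈-split i)) ⟩
    s ℤ.* h (η ∪ ⁅ x ⁆) ≡⟨ cong (s ℤ.*_) (h-new η x∉ Nη) ⟩
    s ℤ.* (s ℤ.* c η) ≡⟨ sym (ℤₚ.*-assoc s s (c η)) ⟩
    s ℤ.* s ℤ.* c η ≡⟨ cong (ℤ._* c η) (sgn-sq (below η x)) ⟩
    1ℤ ℤ.* c η ≡⟨ ℤₚ.*-identityˡ (c η) ⟩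
    c η ∎
    where
    open ≡-Reasoning
    s = sgn (below η x)
  c′ : Chain n
  c′ = c ⊞ neg (∂ h)
  c′-chain′ : IsChain K′ m c′
  c′-chain′ η ¬η = cong₂ (λ a b → a ℤ.+ ℤ.- b) (c-chain η ¬η)
    (∂-0 {c = h} {η} λ v v∉ → h-chain (η ∪ ⁅ v ⁆) λ (k , s) →
      ¬η (down η (η ∪ ⁅ v ⁆) ∈-left k , ℕₚ.suc-injective (trans (sym (∣-add∣ v∉)) s)))
  c′-new-∉ : ∀ η → N η → x ∉ η → c′ η ≡ 0ℤ
  c′-new-∉ η Nη x∉ = trans (cong (λ a → c η ℤ.+ ℤ.- a) (∂h-new η x∉ Nη)) (ℤₚ.+-inverseʳ (c η))
  ∂c′ : ∀ η → ∂ c′ η ≡ 0ℤ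
  ∂c′ η = trans (∂-⊞ c (neg (∂ h)) η)
    (cong₂ ℤ._+_ (∂c≡0 η) (trans (∂-neg (∂ h) η) (cong ℤ.-_ (∂∂≡0 h η))))
  -- Evaluate ∂ c′ = 0 at η - x. Its cofaces other than η are new faces without x, where c′ is
  -- already 0, or no faces at all, so only the term of η is left.
  c′-new-∈ : ∀ η → N η → x ∈ η → c′ η ≡ 0ℤ
  c′-new-∈ η Nη x∈ = subst (λ θ → c′ θ ≡ 0ℤ) (add-del x∈) (sgn-cancel (below (η - x) x)
    (trans (sym (∂-single c′ (η - x) x (∉-del x) others)) (∂c′ (η - x))))
    where
    others : ∀ v → v ≢ x → v ∉ η - x → c′ ((η - x) ∪ ⁅ v ⁆) ≡ 0ℤ
    others v v≢x v∉ with N? ((η - x) ∪ ⁅ v ⁆)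
    ... | yes Nζ = c′-new-∉ _ Nζ λ i → [ ∉-del x , (λ j → v≢x (sym (x∈⁅y⁆⇒x≡y v j))) ]′ (∈-split i)
    ... | no ¬N = c′-chain′ _ λ (k , _) → ¬N (over (η - x) v (closed η Nη x∈) k)
  c′-chain : IsChain K m c′
  c′-chain η ¬η with N? η | x ∈? η
  ... | yes Nη | yes x∈ = c′-new-∈ η Nη x∈
  ... | yes Nη | no x∉ = c′-new-∉ η Nη x∉
  ... | no ¬N | _ = c′-chain′ η λ (k , s) → [ (λ k′ → ¬η (k′ , s)) , ¬N ]′ (split η k)
  filled = acyclic c′ c′-chain ∂c′
  d = proj₁ filled
  d-chain = proj₁ (proj₂ filled)
  ∂d≡ : ∀ η → ∂ d η ≡ c η ℤ.- ∂ h η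
  ∂d≡ = proj₂ (proj₂ filled)

-- Acyclicity of links along a shelling

acyclic-⇔ : ∀ (F G : Fam n) {m} → (∀ η → F η → G η) → (∀ η → G η → ∣ η ∣ ≡ m → F η) → Acyclic F m → Acyclic G m
acyclic-⇔ F G f g acyclic c c-chain ∂c =
  let d , d-chain , ∂d = acyclic c (λ σ ¬σ → c-chain σ λ (Gσ , s) → ¬σ (g σ Gσ s , s)) ∂c
  in d , (λ σ ¬σ → d-chain σ λ (Fσ , s) → ¬σ (f σ Fσ , s)) , ∂d

acyclic-absent : ∀ (F : Fam n) {m} → (∀ η → F η → ∣ η ∣ ≢ m) → Acyclic F m
acyclic-absent F absent c c-chain _ =
  (λ _ → 0ℤ) , (λ _ _ → refl) , λ σ → trans (∂-0 {c = λ _ → 0ℤ} {σ} λ _ _ → refl) (sym (c-chain σ λ (Fσ , s) → absent σ Fσ s))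

-- The link of τ in the complex of faces of dimension at most i of the facets in pre of dimension at least i.
TruncLink : ℕ → Subset n → List (Subset n) → Fam n
TruncLink i τ pre η = Disjoint η τ × ∣ η ∪ τ ∣ ≤ suc i × Any (λ ρ → η ∪ τ ⊆ ρ × suc i ≤ ∣ ρ ∣) pre

module _ {n} {F : Fam n} (i : ℕ) (τ : Subset n) (m : ℕ) (m+τ≤i : suc (m ℕ.+ ∣ τ ∣) ≤ suc i) where

  large⇒Cov : ∀ {pre : List (Subset n)} {η} → Any (λ ρ → η ⊆ ρ × suc i ≤ ∣ ρ ∣) pre → Cov pre η
  large⇒Cov (here (f , _)) = here f
  large⇒Cov (there c) = there (large⇒Cov c)

  -- σ - x is not a facet, so an earlier facet containing it is at least as large as σ.
  Cov⇒large : ∀ {pre : List (Subset n)} {σ x η} → F σ → All (IsFacet F) pre → ¬ Cov pre σ → suc i ≤ ∣ σ ∣ → x ∈ σ →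
    η ⊆ σ - x → Cov pre (σ - x) → Any (λ ρ → η ⊆ ρ × suc i ≤ ∣ ρ ∣) pre
  Cov⇒large {ρ ∷ pre} {σ} {x} {η} Fσ (fac ∷ _) fresh le x∈σ g (here f) = here (f ∘ g , ℕₚ.≤-trans le (ℕₚ.≮⇒≥ smaller))
    where
    smaller : ¬ (∣ ρ ∣ < ∣ σ ∣)
    smaller lt = fresh (here λ {y} y∈ → subst (y ∈_) (proj₂ fac σ Fσ ρ⊆σ) y∈)
      where
      σ-x≡ρ : σ - x ≡ ρ
      σ-x≡ρ = ⊆∧∣≤∣⇒≡ (σ - x) ρ f (ℕₚ.≤-pred (subst (∣ ρ ∣ <_) (sym (∣-del∣ {p = σ} x∈σ)) lt))
      ρ⊆σ : ρ ⊆ σ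
      ρ⊆σ y∈ = ∈-del⁻ (subst (_ ∈_) (sym σ-x≡ρ) y∈)
  Cov⇒large Fσ (_ ∷ facs) fresh le x∈σ g (there c) = there (Cov⇒large Fσ facs (fresh ∘ there) le x∈σ g c)

  -- If σ has a vertex outside τ and outside its restriction `r`, that vertex can be added to and
  -- removed from the new faces, and `acyclic-step` applies; `m+τ≤i` keeps the enlarged faces within
  -- the truncation. If it has none, every new face together with τ contains all of σ, so it has
  -- more than m vertices and degree m does not change.
  truncLink-acyclic : ∀ l → Shelled l → All (IsFacet F) l → Acyclic (TruncLink i τ l) m
  truncLink-acyclic [] [] [] = acyclic-absent (TruncLink i τ []) λ { η (_ , _ , ()) }
  truncLink-acyclic (σ ∷ pre) (add fresh attach s) (fac ∷ facs) with suc i ℕ.≤? ∣ σ ∣ | τ ⊆? σ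
  ... | no ¬le | _ = acyclic-⇔ (TruncLink i τ pre) (TruncLink i τ (σ ∷ pre)) (λ { _ (d , s , a) → d , s , there a })
    (λ { _ (d , s , here (_ , le)) _ → ⊥-elim (¬le le) ; _ (d , s , there a) _ → d , s , a })
    (truncLink-acyclic pre s facs)
  ... | yes _ | no τ⊈σ = acyclic-⇔ (TruncLink i τ pre) (TruncLink i τ (σ ∷ pre)) (λ { _ (d , s , a) → d , s , there a })
    (λ { η (d , s , here (f , _)) _ → ⊥-elim (τ⊈σ (f ∘ ∈-right)) ; _ (d , s , there a) _ → d , s , a })
    (truncLink-acyclic pre s facs)
  ... | yes le | yes τ⊆σ = choose (any? λ x → (x ∈? σ) ×-dec ¬? (x ∈? τ) ×-dec ¬? (x ∈? r))
    where
    r = minFace pre σ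
    New : Fam n
    New η = Disjoint η τ × ∣ η ∪ τ ∣ ≤ suc i × r ⊆ η ∪ τ × η ∪ τ ⊆ σ
    disjoint? : ∀ (η θ : Subset n) → Dec (Disjoint η θ)
    disjoint? η θ = map′ ∩≡⊥⇒disjoint disjoint⇒∩≡⊥ ((η ∩ θ) ≟ₛ ⊥)
    New? : ∀ η → Dec (New η)
    New? η = disjoint? η τ ×-dec (∣ η ∪ τ ∣ ℕ.≤? suc i) ×-dec (r ⊆? (η ∪ τ)) ×-dec ((η ∪ τ) ⊆? σ)
    split : ∀ η → TruncLink i τ (σ ∷ pre) η → TruncLink i τ pre η ⊎ New η
    split η (d , s , there a) = inj₁ (d , s , a)
    split η (d , s , here (f , _)) with r ⊆? (η ∪ τ)
    ... | yes g = inj₂ (d , s , (λ {_} → g) , λ {_} → f)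
    ... | no ¬g = let x , x∈r , x∉ = ⊈⇒∃ ¬g
                      x∈σ , c = ∈-⟪⟫⁻ (minFace? pre σ) x∈r
                  in inj₁ (d , s , Cov⇒large (proj₁ fac) facs fresh le x∈σ (⊆-del f x∉) c)
    old⊆ : ∀ η → TruncLink i τ pre η → TruncLink i τ (σ ∷ pre) η
    old⊆ η (d , s , a) = d , s , there a
    ∪τ-mono : ∀ {η θ : Subset n} → η ⊆ θ → η ∪ τ ⊆ θ ∪ τ
    ∪τ-mono {θ = θ} f = ∪-lub (∈-left ∘ f) ∈-right
    down : ∀ η θ → η ⊆ θ → TruncLink i τ (σ ∷ pre) θ → TruncLink i τ (σ ∷ pre) η
    down η θ f (d , s , a) = (λ x → d x ∘ f) , ℕₚ.≤-trans (∣⊆∣ (η ∪ τ) (θ ∪ τ) (∪τ-mono f)) s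
      , Any.map (λ (g , le) → (λ {x} h → g (∪τ-mono {η} {θ} f h)) , le) a
    choose : Dec (∃[ x ] (x ∈ σ × x ∉ τ × x ∉ r)) → Acyclic (TruncLink i τ (σ ∷ pre)) m
    choose (yes (x , x∈σ , x∉τ , x∉r)) = acyclic-step {K = TruncLink i τ pre} {New} {TruncLink i τ (σ ∷ pre)} New? x m split old⊆
      (λ η (d , s , _ , f) → d , s , here (f , le)) up
      (λ η (d , s , g , f) x∈ → (λ y → d y ∘ ∈-del⁻) , ℕₚ.≤-trans (∣⊆∣ ((η - x) ∪ τ) (η ∪ τ) (∪τ-mono ∈-del⁻)) s
        , (λ {y} y∈r → [ (λ y∈η → ∈-left (∈-del⁺ y∈η λ { refl → x∉r y∈r })) , ∈-right ]′ (∈-split (g y∈r)))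
        , λ {_} → f ∘ ∪τ-mono ∈-del⁻)
      over down (truncLink-acyclic pre s facs)
      where
      up : ∀ η → New η → x ∉ η → ∣ η ∣ ≡ m → New (η ∪ ⁅ x ⁆)
      up η (d , s , g , f) x∉η refl = dis
        , subst (_≤ suc i) (sym (trans (∣∪∣-disjoint dis) (cong (ℕ._+ ∣ τ ∣) (∣-add∣ x∉η)))) m+τ≤i
        , (λ {_} → ∪τ-mono ∈-left ∘ g)
        , λ {_} → ∪-lub (∪-lub (f ∘ ∈-left) (⁅⁆⊆ x∈σ)) τ⊆σ
        where
        dis : Disjoint (η ∪ ⁅ x ⁆) τ
        dis y h = [ d y , (λ j → subst (_∉ τ) (sym (x∈⁅y⁆⇒x≡y x j)) x∉τ) ]′ (∈-split h)
      over : ∀ η v → New η → TruncLink i τ (σ ∷ pre) (η ∪ ⁅ v ⁆) → New (η ∪ ⁅ v ⁆)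
      over η v (d , s , g , f) (d′ , s′ , here (f′ , _)) = d′ , s′ , (λ {_} → ∪τ-mono ∈-left ∘ g) , λ {_} → f′
      over η v (d , s , g , f) (d′ , s′ , there a) =
        ⊥-elim (minFace-new attach f g (Cov-⊆ (∪τ-mono ∈-left) (large⇒Cov a)))
    choose (no ¬x) = acyclic-⇔ (TruncLink i τ pre) (TruncLink i τ (σ ∷ pre)) old⊆
      (λ η t size → [ id , (λ new → ⊥-elim (big η new size)) ]′ (split η t))
      (truncLink-acyclic pre s facs)
      where
      big : ∀ η → New η → ∣ η ∣ ≢ m
      big η (d , _ , g , f) refl = ℕₚ.<⇒≱ (s≤s (subst (_≤ i) (sym (∣∪∣-disjoint d)) (ℕₚ.≤-pred m+τ≤i)))
        (ℕₚ.≤-trans le (∣⊆∣ σ (η ∪ τ) σ⊆))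
        where
        σ⊆ : σ ⊆ η ∪ τ
        σ⊆ {x} x∈σ with x ∈? τ | x ∈? r
        ... | yes x∈τ | _ = ∈-right x∈τ
        ... | no _ | yes x∈r = g x∈r
        ... | no x∉τ | no x∉r = ⊥-elim (¬x (x , x∈σ , x∉τ , x∉r))

-- `TruncLink` of a complete shelling is the link in the pure skeleton. Degrees above the top
-- contain no faces; those below are `truncLink-acyclic`.
shellable⇒scm : ∀ {F : Fam n} → (∀ σ η → η ⊆ σ → F σ → F η) → (∀ η → F η → ∃[ σ ] (IsFacet F σ × η ⊆ σ)) →
  Shellable F → SeqCohenMacaulay F
shellable⇒scm {n} {F} closed inFacet (l₀ , sh) _ _ i _ =
  (suc i , λ { η (σ , Fσ , f , s) → subst (∣ η ∣ ≤_) s (∣⊆∣ η σ f) , σ , f , (σ , Fσ , id , s) , s })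
  , λ τ _ d top m m≢d → acyclic τ d top m m≢d (ℕₚ.<-cmp m d)
  where
  l = reverse l₀
  by = shelling⇒shelledBy sh
  facets = proj₁ (proj₂ by)
  complete = proj₂ (proj₂ by)
  acyclic : ∀ τ d → HasTopSize (Link (PureSkel F i) τ) d → ∀ m → m ≢ d → Tri (m < d) (m ≡ d) (d < m) →
    Acyclic (Link (PureSkel F i) τ) m
  acyclic τ d top m m≢d (tri≈ _ m≡d _) = ⊥-elim (m≢d m≡d)
  acyclic τ d (_ , max) m m≢d (tri> _ _ d<m) = acyclic-absent (Link (PureSkel F i) τ) λ { η Lη refl → ℕₚ.<⇒≱ d<m (max η Lη) }
  acyclic τ d ((θ , (θ∩τ , σ , Fσ , f , s) , refl) , _) m m≢d (tri< m<d _ _) =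
    acyclic-⇔ (TruncLink i τ l) (Link (PureSkel F i) τ) to (λ η h _ → from η h) (truncLink-acyclic i τ m bound l (proj₁ by) facets)
    where
    -- A top face θ of the link lies with τ in a face of size i + 1, so d and the size of τ add up
    -- to at most i + 1, and m < d.
    bound : suc (m ℕ.+ ∣ τ ∣) ≤ suc i
    bound = ℕₚ.≤-trans (ℕₚ.+-monoˡ-≤ ∣ τ ∣ m<d) (subst₂ _≤_ (∣∪∣-disjoint (∩≡⊥⇒disjoint θ∩τ)) s (∣⊆∣ (θ ∪ τ) σ f))
    to : ∀ η → TruncLink i τ l η → Link (PureSkel F i) τ η
    to η (d , s , a) = disjoint⇒∩≡⊥ d ,
      let ρ , ρ∈l , g , le = LM.find a
          υ , f , h , s′ = intermediate {p = η ∪ τ} {ρ} g s le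
      in υ , closed ρ υ h (proj₁ (All.lookup facets ρ∈l)) , f , s′
    from : ∀ η → Link (PureSkel F i) τ η → TruncLink i τ l η
    from η (e , σ , Fσ , f , s) = ∩≡⊥⇒disjoint e , subst (∣ η ∪ τ ∣ ≤_) s (∣⊆∣ (η ∪ τ) σ f) ,
      let ρ , fac , g = inFacet σ Fσ
      in LM.lose (complete ρ fac) ((λ {_} → g ∘ f) , subst (_≤ ∣ ρ ∣) s (∣⊆∣ σ ρ g))

-- Disconnected links

Closed : Fam n → Set
Closed F = ∀ σ η → η ⊆ σ → F σ → F η

-- The link of τ among the top-dimensional faces consists of the two disjoint simplices α and β.
record Disconnection {n} (F : Fam n) : Set where
  field
    {i} : ℕ
    {τ α β} : Subset n
    τα : Disjoint τ α
    τβ : Disjoint τ β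
    αβ : Disjoint α β
    ∣β∣ : ∣ β ∣ ≡ ∣ α ∣
    2≤∣α∣ : 2 ≤ ∣ α ∣
    face-α : F (τ ∪ α)
    face-β : F (τ ∪ β)
    size : ∣ τ ∪ α ∣ ≡ suc i
    top : ∀ ρ → F ρ → ∣ ρ ∣ ≤ suc i
    only : ∀ ρ → F ρ → ∣ ρ ∣ ≡ suc i → τ ⊆ ρ → (ρ ≡ τ ∪ α) ⊎ (ρ ≡ τ ∪ β)

  size′ : ∣ τ ∪ β ∣ ≡ suc i
  size′ = trans (∣∪∣-disjoint τβ) (trans (cong (∣ τ ∣ ℕ.+_) ∣β∣) (trans (sym (∣∪∣-disjoint τα)) size))

another : ∀ {p : Subset n} → 2 ≤ ∣ p ∣ → ∀ x → ∃[ y ] (y ∈ p × y ≢ x)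
another {n} {p} le x with x ∈? p
... | yes x∈p = let y , y∈ , y≢ = ⊈⇒∃ {p = p} {⁅ x ⁆} λ f → ℕₚ.<⇒≱ (subst (_< ∣ p ∣) (sym (Subₚ.∣⁅x⁆∣≡1 x)) le) (∣⊆∣ p (⁅ x ⁆) f)
                in y , y∈ , λ e → y≢ (subst (_∈ ⁅ x ⁆) (sym e) (x∈⁅x⁆ x))
... | no x∉p with ∣ p ∣ in e | le
...   | suc _ | _ = let y , y∈ = nonempty {p = p} e in y , y∈ , λ e′ → x∉p (subst (_∈ p) e′ y∈)

top-face⇒facet : ∀ {F : Fam n} {σ} {k} → (∀ ρ → F ρ → ∣ ρ ∣ ≤ k) → F σ → ∣ σ ∣ ≡ k → IsFacet F σ
top-face⇒facet {σ = σ} top Fσ refl = Fσ , λ ρ Fρ f → sym (⊆∧∣≤∣⇒≡ σ ρ f (top ρ Fρ))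

module _ {n} {F : Fam n} (closed : Closed F) where

  swap-disconnection : Disconnection F → Disconnection F
  swap-disconnection D = record
    { τα = τβ ; τβ = τα ; αβ = λ x h h′ → αβ x h′ h ; ∣β∣ = sym ∣β∣ ; 2≤∣α∣ = subst (2 ≤_) (sym ∣β∣) 2≤∣α∣
    ; face-α = face-β ; face-β = face-α ; size = size′ ; top = top
    ; only = λ ρ Fρ s f → [ inj₂ , inj₁ ]′ (only ρ Fρ s f) }
    where open Disconnection D

  facet-over-ridge : ∀ {k σ ρ y} → (∀ ρ → F ρ → ∣ ρ ∣ ≤ suc k) → F σ → ∣ σ ∣ ≡ suc k → y ∈ σ →
    IsFacet F ρ → σ - y ⊆ ρ → ∣ ρ ∣ ≡ suc k
  facet-over-ridge {k} {σ} {ρ} {y} top Fσ s y∈σ (Fρ , max) f = ℕₚ.≤-antisym (top ρ Fρ) (ℕₚ.≰⇒> small)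
    where
    small : ¬ (∣ ρ ∣ ≤ k)
    small le = ∉-del y (subst (y ∈_) (trans (max σ Fσ (λ h → ∈-del⁻ (subst (_ ∈_) (sym e) h))) (sym e)) y∈σ)
      where
      e : σ - y ≡ ρ
      e = ⊆∧∣≤∣⇒≡ (σ - y) ρ f (ℕₚ.≤-trans le (ℕₚ.≤-reflexive (sym (ℕₚ.suc-injective (trans (∣-del∣ {p = σ} y∈σ) s)))))

  -- Suppose y in the minimal face of σ lies outside τ. The facet whose interval contains σ - y has
  -- top size and contains τ, so it is one of the two. It is not σ, whose interval requires y, and
  -- not the other one, which misses a second vertex of α.
  r⊆τ : (D : Disconnection F) (P : Partitionable F) → let open Disconnection D in proj₁ P (τ ∪ α) ⊆ τ
  r⊆τ D (r , r⊆ , cover , _) {y} y∈r = decidable-stable (y ∈? τ) λ y∉τ → contra y∉τ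
    where
    open Disconnection D
    σ = τ ∪ α
    σ-facet = top-face⇒facet top face-α size
    y∈σ = r⊆ σ σ-facet y∈r
    contra : ¬ (y ∉ τ)
    contra y∉τ with cover (σ - y) (closed σ (σ - y) ∈-del⁻ face-α)
    ... | ρ , ρ-facet , rρ⊆ , f with only ρ (proj₁ ρ-facet) (facet-over-ridge top face-α size y∈σ ρ-facet f)
                                       (λ h → f (∈-del⁺ (∈-left h) λ { refl → y∉τ h }))
    ... | inj₁ refl = ∉-del y (rρ⊆ y∈r)
    ... | inj₂ refl = let z , z∈α , z≢y = another 2≤∣α∣ y in
      [ (λ z∈τ → τα z z∈τ z∈α) , αβ z z∈α ]′ (∈-split (f (∈-del⁺ (∈-right z∈α) z≢y)))

  -- By `r⊆τ` on both sides, τ lies in the intervals of two different facets.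
  disconnection⇒¬partitionable : Disconnection F → ¬ Partitionable F
  disconnection⇒¬partitionable D P@(r , r⊆ , cover , disjoint) =
    let z , z∈α = nonempty-α
    in [ (λ z∈τ → τα z z∈τ z∈α) , αβ z z∈α ]′ (∈-split (subst (z ∈_) same (∈-right z∈α)))
    where
    open Disconnection D
    same : τ ∪ α ≡ τ ∪ β
    same = disjoint τ (τ ∪ α) (τ ∪ β) (top-face⇒facet top face-α size) (top-face⇒facet top face-β size′)
      (r⊆τ D P) ∈-left (r⊆τ (swap-disconnection D) P) ∈-left
    nonempty-α : ∃[ z ] z ∈ α
    nonempty-α with ∣ α ∣ in e | 2≤∣α∣
    ... | suc _ | _ = nonempty {p = α} e

-- Vertices as chains, and colourings

δ : Subset n → Chain n
δ θ η = if does (η ≟ₛ θ) then 1ℤ else 0ℤ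

δ-≡ : ∀ (θ : Subset n) → δ θ θ ≡ 1ℤ
δ-≡ θ = cong (λ b → if b then 1ℤ else 0ℤ) (dec-true (θ ≟ₛ θ) refl)

δ-≢ : ∀ {θ η : Subset n} → η ≢ θ → δ θ η ≡ 0ℤ
δ-≢ {θ = θ} {η} h = cong (λ b → if b then 1ℤ else 0ℤ) (dec-false (η ≟ₛ θ) h)

⁅⁆-injective : ∀ {x y : Fin n} → ⁅ x ⁆ ≡ ⁅ y ⁆ → x ≡ y
⁅⁆-injective {x = x} {y} e = x∈⁅y⁆⇒x≡y y (subst (x ∈_) e (x∈⁅x⁆ x))

⊥∪ : ∀ (p : Subset n) → ⊥ ∪ p ≡ p
⊥∪ p = ⊆-antisym (∪-lub Subₚ.⊥⊆ id) ∈-right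

∂-vertex : ∀ (a : Fin n) η → ∂ (δ ⁅ a ⁆) η ≡ δ ⊥ η
∂-vertex {n} a η with η ≟ₛ ⊥
... | yes refl = trans (∂-single (δ ⁅ a ⁆) ⊥ a Subₚ.∉⊥ λ v v≢a _ → δ-≢ λ e → v≢a (⁅⁆-injective (trans (sym (⊥∪ ⁅ v ⁆)) e)))
    (cong₂ (λ k x → sgn k ℤ.* x) (below-⊥ a) (trans (cong (δ ⁅ a ⁆) (⊥∪ ⁅ a ⁆)) (δ-≡ ⁅ a ⁆)))
... | no η≢⊥ = ∂-0 {c = δ ⁅ a ⁆} {η} λ v v∉ → δ-≢ λ e → η≢⊥ (Subₚ.Empty-unique λ (y , y∈) →
    v∉ (subst (_∈ η) (trans (x∈⁅y⁆⇒x≡y a (subst (y ∈_) e (∈-left y∈)))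
                            (sym (x∈⁅y⁆⇒x≡y a (subst (v ∈_) e (∈-right (x∈⁅x⁆ v)))))) y∈))

below-⁅⁆ : ∀ (x v : Fin n) → below ⁅ x ⁆ v ≡ x ≺ v
below-⁅⁆ x v = trans (cong (λ θ → below θ v) (sym (⊥∪ ⁅ x ⁆)))
  (trans (below-add ⊥ v Subₚ.∉⊥) (cong (ℕ._+ x ≺ v) (below-⊥ v)))

-- A colouring constant along edges is a 0-cocycle: each edge contributes to the sum once at either
-- end, with opposite signs.
colouring-kills-∂ : ∀ {F : Fam n} (χ : Fin n → ℤ) d → IsChain F 2 d →
  (∀ x y → x ≢ y → F (⁅ x ⁆ ∪ ⁅ y ⁆) → χ x ≡ χ y) → ℤsum {n} (λ x → χ x ℤ.* ∂ d ⁅ x ⁆) ≡ 0ℤ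
colouring-kills-∂ {n} {F} χ d d-chain const =
  trans (sum-cong {n} {n} λ x → sym (sum-* {n} (χ x) (∂-term d ⁅ x ⁆))) (sum-antisym {n} f λ x y → antisym x y (x Fin.≟ y))
  where
  f : Fin n → Fin n → ℤ
  f x y = χ x ℤ.* ∂-term d ⁅ x ⁆ y
  f-≢ : ∀ x y → x ≢ y → f x y ≡ χ x ℤ.* (sgn (x ≺ y) ℤ.* d (⁅ x ⁆ ∪ ⁅ y ⁆))
  f-≢ x y x≢y = cong (χ x ℤ.*_) (trans (∂-term-∉ {c = d} {⁅ x ⁆} λ h → x≢y (sym (x∈⁅y⁆⇒x≡y x h)))
    (cong (λ k → sgn k ℤ.* d (⁅ x ⁆ ∪ ⁅ y ⁆)) (below-⁅⁆ x y)))
  f-≡ : ∀ x → f x x ≡ 0ℤ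
  f-≡ x = trans (cong (χ x ℤ.*_) (∂-term-∈ {c = d} (x∈⁅x⁆ x))) (ℤₚ.*-zeroʳ (χ x))
  d-0 : ∀ {x y} → x ≢ y → χ x ≢ χ y → d (⁅ x ⁆ ∪ ⁅ y ⁆) ≡ 0ℤ
  d-0 x≢y χ≢ = d-chain _ λ (h , _) → χ≢ (const _ _ x≢y h)
  antisym : ∀ x y → Dec (x ≡ y) → f x y ≡ ℤ.- f y x
  antisym x y (yes refl) = trans (f-≡ x) (cong ℤ.-_ (sym (f-≡ x)))
  antisym x y (no x≢y) = trans (f-≢ x y x≢y) (trans (core (χ x ℤ.≟ χ y)) (cong ℤ.-_ (sym (f-≢ y x (x≢y ∘ sym)))))
    where
    open ℤsolver.+-*-Solver
    X = d (⁅ y ⁆ ∪ ⁅ x ⁆)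
    core : Dec (χ x ≡ χ y) → χ x ℤ.* (sgn (x ≺ y) ℤ.* d (⁅ x ⁆ ∪ ⁅ y ⁆)) ≡ ℤ.- (χ y ℤ.* (sgn (y ≺ x) ℤ.* X))
    core (yes e) = trans (cong₂ (λ c θ → c ℤ.* (sgn (x ≺ y) ℤ.* d θ)) e (Subₚ.∪-comm ⁅ x ⁆ ⁅ y ⁆))
      (trans (cong (λ s → χ y ℤ.* (s ℤ.* X)) (sgn-≺ x≢y))
        (solve 3 (λ c s x → c :* (:- s :* x) := :- (c :* (s :* x))) refl (χ y) (sgn (y ≺ x)) X))
    core (no ne) = trans (cong (λ z → χ x ℤ.* (sgn (x ≺ y) ℤ.* z)) (d-0 x≢y ne))
      (trans (solve 4 (λ a b c d → a :* (b :* con 0ℤ) := :- (c :* (d :* con 0ℤ))) refl (χ x) (sgn (x ≺ y)) (χ y) (sgn (y ≺ x)))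
        (cong (λ z → ℤ.- (χ y ℤ.* (sgn (y ≺ x) ℤ.* z))) (sym (d-0 (x≢y ∘ sym) (ne ∘ sym)))))

-- For a in α and b in β the chain a - b is a reduced cycle of the link of τ. The indicator of α is
-- constant along edges of that link and takes the value 1 on a - b, so a - b is no boundary.
disconnection⇒¬scm : ∀ {F : Fam n} → Disconnection F → ¬ SeqCohenMacaulay F
disconnection⇒¬scm {n} {F} D scm = contra (nonempty-of 2≤∣α∣) (nonempty-of (subst (2 ≤_) (sym ∣β∣) 2≤∣α∣))
  where
  open Disconnection D
  L : Fam n
  L = Link (PureSkel F i) τ
  nonempty-of : ∀ {p : Subset n} → 2 ≤ ∣ p ∣ → ∃[ z ] z ∈ p
  nonempty-of {p} le with ∣ p ∣ in e | le
  ... | suc _ | _ = nonempty {p = p} e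
  L-intro : ∀ {η γ} → Disjoint τ γ → F (τ ∪ γ) → ∣ τ ∪ γ ∣ ≡ suc i → η ⊆ γ → L η
  L-intro {η} {γ} τγ face s f = disjoint⇒∩≡⊥ (λ x h h′ → τγ x h′ (f h)) , τ ∪ γ , face , ∪-lub (∈-right ∘ f) ∈-left , s
  L-elim : ∀ {η} → L η → η ⊆ α ⊎ η ⊆ β
  L-elim {η} (e , ρ , Fρ , f , s) with only ρ Fρ s (f ∘ ∈-right)
  ... | inj₁ refl = inj₁ λ {x} h → [ ⊥-elim ∘ ∩≡⊥⇒disjoint e x h , id ]′ (∈-split (f (∈-left h)))
  ... | inj₂ refl = inj₂ λ {x} h → [ ⊥-elim ∘ ∩≡⊥⇒disjoint e x h , id ]′ (∈-split (f (∈-left h)))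
  L-top : HasTopSize L ∣ α ∣
  L-top = (α , L-intro τα face-α size id , refl) , λ η h → bound (L-elim h)
    where
    bound : ∀ {η} → η ⊆ α ⊎ η ⊆ β → ∣ η ∣ ≤ ∣ α ∣
    bound {η} (inj₁ f) = ∣⊆∣ η α f
    bound {η} (inj₂ f) = subst (∣ η ∣ ≤_) ∣β∣ (∣⊆∣ η β f)
  -- Size 1 means reduced homology in dimension 0, which is below the top because α has at least two
  -- vertices.
  acyclic : Acyclic L 1
  acyclic = proj₂ (scm (suc i) ((τ ∪ α , face-α , size) , top) i ℕₚ.≤-refl) τ
    (τ ∪ α , face-α , ∈-left , size) ∣ α ∣ L-top 1 (λ e → ℕₚ.<⇒≱ 2≤∣α∣ (ℕₚ.≤-reflexive (sym e)))
  contra : ∃[ a ] a ∈ α → ¬ (∃[ b ] b ∈ β)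
  contra (a , a∈α) (b , b∈β) = 0≢1 (trans (sym killed) pairing)
    where
    0≢1 : 0ℤ ≢ 1ℤ
    0≢1 ()
    c : Chain n
    c = δ ⁅ a ⁆ ⊞ neg (δ ⁅ b ⁆)
    c-chain : IsChain L 1 c
    c-chain σ ¬σ = cong₂ (λ x y → x ℤ.+ ℤ.- y)
      (δ-≢ {θ = ⁅ a ⁆} {σ} λ { refl → ¬σ (L-intro τα face-α size (⁅⁆⊆ a∈α) , Subₚ.∣⁅x⁆∣≡1 a) })
      (δ-≢ {θ = ⁅ b ⁆} {σ} λ { refl → ¬σ (L-intro τβ face-β size′ (⁅⁆⊆ b∈β) , Subₚ.∣⁅x⁆∣≡1 b) })
    ∂c : ∀ η → ∂ c η ≡ 0ℤ
    ∂c η = trans (∂-⊞ (δ ⁅ a ⁆) (neg (δ ⁅ b ⁆)) η) (trans (cong₂ ℤ._+_ (∂-vertex a η) (trans (∂-neg (δ ⁅ b ⁆) η) (cong ℤ.-_ (∂-vertex b η))))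
      (ℤₚ.+-inverseʳ (δ ⊥ η)))
    d = proj₁ (acyclic c c-chain ∂c)
    χ : Fin n → ℤ
    χ x = if does (x ∈? α) then 1ℤ else 0ℤ
    χ-∈ : ∀ {x} → x ∈ α → χ x ≡ 1ℤ
    χ-∈ {x} h = cong (λ b → if b then 1ℤ else 0ℤ) (dec-true (x ∈? α) h)
    χ-∉ : ∀ {x} → x ∉ α → χ x ≡ 0ℤ
    χ-∉ {x} h = cong (λ b → if b then 1ℤ else 0ℤ) (dec-false (x ∈? α) h)
    constant : ∀ x y → x ≢ y → L (⁅ x ⁆ ∪ ⁅ y ⁆) → χ x ≡ χ y
    constant x y _ h with L-elim h
    ... | inj₁ f = trans (χ-∈ (f (∈-left (x∈⁅x⁆ x)))) (sym (χ-∈ (f (∈-right (x∈⁅x⁆ y)))))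
    ... | inj₂ f = trans (χ-∉ λ i → αβ x i (f (∈-left (x∈⁅x⁆ x)))) (sym (χ-∉ λ i → αβ y i (f (∈-right (x∈⁅x⁆ y)))))
    killed = colouring-kills-∂ {F = L} χ d (proj₁ (proj₂ (acyclic c c-chain ∂c))) constant
    b≢a : b ≢ a
    b≢a refl = αβ b a∈α b∈β
    others : ∀ x → x ≢ a → χ x ℤ.* ∂ d ⁅ x ⁆ ≡ 0ℤ
    others x x≢a with x Fin.≟ b
    ... | yes refl = cong (ℤ._* ∂ d ⁅ x ⁆) (χ-∉ λ i → αβ x i b∈β)
    ... | no x≢b = trans (cong (χ x ℤ.*_) (trans (proj₂ (proj₂ (acyclic c c-chain ∂c)) ⁅ x ⁆)
        (cong₂ (λ s t → s ℤ.+ ℤ.- t) (δ-≢ (x≢a ∘ ⁅⁆-injective)) (δ-≢ (x≢b ∘ ⁅⁆-injective))))) (ℤₚ.*-zeroʳ (χ x))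
    pairing : ℤsum {n} (λ x → χ x ℤ.* ∂ d ⁅ x ⁆) ≡ 1ℤ
    pairing = trans (sum-single {n} a others) (cong₂ ℤ._*_ (χ-∈ a∈α) (trans (proj₂ (proj₂ (acyclic c c-chain ∂c)) ⁅ a ⁆)
      (cong₂ (λ s t → s ℤ.+ ℤ.- t) (δ-≡ ⁅ a ⁆) (δ-≢ (b≢a ∘ sym ∘ ⁅⁆-injective)))))

-- Bands

pair : Fin n → Fin n → Subset n
pair x y = ⁅ x ⁆ ∪ ⁅ y ⁆

triple : Fin n → Fin n → Fin n → Subset n
triple x y z = pair x y ∪ ⁅ z ⁆

∈-pair⁻ : ∀ {x y v : Fin n} → v ∈ pair x y → v ≡ x ⊎ v ≡ y
∈-pair⁻ {x = x} {y} h = [ inj₁ ∘ x∈⁅y⁆⇒x≡y x , inj₂ ∘ x∈⁅y⁆⇒x≡y y ]′ (∈-split h)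

∈-pairˡ : ∀ {x y : Fin n} → x ∈ pair x y
∈-pairˡ {x = x} = ∈-left (x∈⁅x⁆ x)

∈-pairʳ : ∀ {x y : Fin n} → y ∈ pair x y
∈-pairʳ {x = x} {y} = ∈-right (x∈⁅x⁆ y)

∈-triple⁻ : ∀ {x y z v : Fin n} → v ∈ triple x y z → v ≡ x ⊎ v ≡ y ⊎ v ≡ z
∈-triple⁻ {z = z} h with ∈-split h
... | inj₁ i = [ inj₁ , inj₂ ∘ inj₁ ]′ (∈-pair⁻ i)
... | inj₂ i = inj₂ (inj₂ (x∈⁅y⁆⇒x≡y z i))

∈-triple₁ : ∀ {x y z : Fin n} → x ∈ triple x y z
∈-triple₁ = ∈-left ∈-pairˡ

∈-triple₂ : ∀ {x y z : Fin n} → y ∈ triple x y z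
∈-triple₂ {x = x} = ∈-left ∈-pairʳ

∈-triple₃ : ∀ {x y z : Fin n} → z ∈ triple x y z
∈-triple₃ {x = x} {y} {z} = ∈-right (x∈⁅x⁆ z)

pair-⊆ : ∀ {x y : Fin n} {p} → x ∈ p → y ∈ p → pair x y ⊆ p
pair-⊆ hx hy = ∪-lub (⁅⁆⊆ hx) (⁅⁆⊆ hy)

triple-⊆ : ∀ {x y z : Fin n} {p} → x ∈ p → y ∈ p → z ∈ p → triple x y z ⊆ p
triple-⊆ hx hy hz = ∪-lub (pair-⊆ hx hy) (⁅⁆⊆ hz)

pair-comm : ∀ (x y : Fin n) → pair x y ≡ pair y x
pair-comm x y = Subₚ.∪-comm ⁅ x ⁆ ⁅ y ⁆

triple-swap : ∀ (x y z : Fin n) → triple x y z ≡ triple y x z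
triple-swap x y z = cong (_∪ ⁅ z ⁆) (pair-comm x y)

triple-rotate : ∀ (x y z : Fin n) → triple x y z ≡ triple y z x
triple-rotate x y z = trans (triple-swap x y z) (∪-swap ⁅ y ⁆ ⁅ x ⁆ ⁅ z ⁆)

∣pair∣ : ∀ {x y : Fin n} → x ≢ y → ∣ pair x y ∣ ≡ 2
∣pair∣ {x = x} {y} x≢y = trans (∣-add∣ λ h → x≢y (sym (x∈⁅y⁆⇒x≡y x h))) (cong suc (Subₚ.∣⁅x⁆∣≡1 x))

∣triple∣ : ∀ {x y z : Fin n} → x ≢ y → x ≢ z → y ≢ z → ∣ triple x y z ∣ ≡ 3
∣triple∣ x≢y x≢z y≢z = trans (∣-add∣ λ h → [ x≢z ∘ sym , y≢z ∘ sym ]′ (∈-pair⁻ h)) (cong suc (∣pair∣ x≢y))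

Within : ∀ {k} → (Fin k → Fin k) → Fin k → Fin k → Set
Within next a i = a ≡ i ⊎ a ≡ next i ⊎ a ≡ next (next i)

-- The arithmetic modulo k behind both refutations of bands, kept abstract so that 5, 6 and 7 are
-- treated alike. By `free` the edge from i to i+2 lies in a single window, which already fails for
-- k = 4; by `edge` the one from i+1 to i+2 lies in no windows but i and i+1.
record Cycle (k : ℕ) : Set where
  field
    next prev : Fin k → Fin k
    next-prev : ∀ i → next (prev i) ≡ i
    next≢ : ∀ i → i ≢ next i
    next²≢ : ∀ i → i ≢ next (next i)
    free : ∀ i j → Within next i j → Within next (next (next i)) j → j ≡ i
    edge : ∀ i j → Within next (next i) j → Within next (next (next i)) j → j ≡ i ⊎ j ≡ next i
    reach : ∀ i j → ∃[ m ] (fold i next m ≡ j)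
    rotate : ∀ {n} (g : Fin k → ℤ) → ℤsum {n} (g ∘ next) ≡ ℤsum {n} g
    total : ∀ {n} → ℤsum {n} {k} (λ _ → 1ℤ ℤ.+ 1ℤ) ≢ 0ℤ
    -- The signed number of steps from i to j when it is at most two, and 0 otherwise.
    step : Fin k → Fin k → ℤ
    step-antisym : ∀ i j → step i j ≡ ℤ.- step j i
    step-next : ∀ i → step i (next i) ≡ 1ℤ
    step-cocycle : ∀ i a b c → Within next a i → Within next b i → Within next c i →
      step a b ℤ.+ step b c ℤ.+ step c a ≡ 0ℤ

  origin : Fin k
  origin = some k (total {0})
    where
    some : ∀ k → ℤsum {0} {k} (λ _ → 1ℤ ℤ.+ 1ℤ) ≢ 0ℤ → Fin k
    some zero nonzero = ⊥-elim (nonzero refl)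
    some (suc k) _ = zero

-- The 2-dimensional faces are the consecutive triples of a cyclic sequence of vertices: a Möbius band
-- when the length is odd, an annulus when it is even.
record Band {n} (F : Fam n) : Set where
  field
    {k} : ℕ
    cycle : Cycle k
  open Cycle cycle public
  field
    u : Fin k → Fin n
    u-injective : ∀ {i j} → u i ≡ u j → i ≡ j

  tri : Fin k → Subset n
  tri i = triple (u i) (u (next i)) (u (next (next i)))

  field
    face-tri : ∀ i → F (tri i)
    top : ∀ ρ → F ρ → ∣ ρ ∣ ≤ 3
    only : ∀ ρ → F ρ → ∣ ρ ∣ ≡ 3 → ∃[ i ] ρ ≡ tri i
    vertex : ∀ v → F ⁅ v ⁆ → ∃[ i ] v ≡ u i

  u-≢ : ∀ {i j} → i ≢ j → u i ≢ u j
  u-≢ i≢j e = i≢j (u-injective e)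

  within : ∀ {a i} → u a ∈ tri i → Within next a i
  within h with ∈-triple⁻ h
  ... | inj₁ e = inj₁ (u-injective e)
  ... | inj₂ (inj₁ e) = inj₂ (inj₁ (u-injective e))
  ... | inj₂ (inj₂ e) = inj₂ (inj₂ (u-injective e))

  ∣tri∣ : ∀ i → ∣ tri i ∣ ≡ 3
  ∣tri∣ i = ∣triple∣ (u-≢ (next≢ i)) (u-≢ (next²≢ i)) (u-≢ (next≢ (next i)))

  tri-injective : ∀ {i j} → tri i ≡ tri j → i ≡ j
  tri-injective {i} {j} e = sym (free i j (within (subst (u i ∈_) e ∈-triple₁))
    (within (subst (u (next (next i)) ∈_) e ∈-triple₃)))

module _ {n} {F : Fam n} (closed : Closed F) (B : Band F) (P : Partitionable F) where
  open Band B

  private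
    r = proj₁ P
    cover = proj₁ (proj₂ (proj₂ P))
    unique = proj₂ (proj₂ (proj₂ P))

    facet : ∀ i → IsFacet F (tri i)
    facet i = top-face⇒facet top (face-tri i) (∣tri∣ i)

    r⊆tri : ∀ i → r (tri i) ⊆ tri i
    r⊆tri i = proj₁ (proj₂ P) (tri i) (facet i)

    cover-ridge : ∀ i {y} → y ∈ tri i → ∃[ j ] (r (tri j) ⊆ tri i - y × tri i - y ⊆ tri j)
    cover-ridge i {y} y∈ with cover (tri i - y) (closed (tri i) (tri i - y) ∈-del⁻ (face-tri i))
    ... | ρ , ρ-facet , f , g with only ρ (proj₁ ρ-facet) (facet-over-ridge closed top (face-tri i) (∣tri∣ i) y∈ ρ-facet g)
    ... | j , refl = j , f , g

    First Last : Fin k → Set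
    First i = u i ∈ r (tri i)
    Last i = u (next (next i)) ∈ r (tri i)

    -- The edge opposite the middle vertex is free: only `tri i` can have it in its interval, so the
    -- minimal face must avoid the middle vertex.
    middle : ∀ i → u (next i) ∉ r (tri i)
    middle i h with cover-ridge i ∈-triple₂
    ... | j , f , g = ∉-del (u (next i)) (subst (λ j → u (next i) ∈ tri i - u (next i)) j≡i (f (subst (λ j → u (next i) ∈ r (tri j)) (sym j≡i) h)))
      where
      j≡i : j ≡ i
      j≡i = free i j (within (g (∈-del⁺ ∈-triple₁ (u-≢ (next≢ i)))))
                     (within (g (∈-del⁺ ∈-triple₃ (u-≢ (next≢ (next i) ∘ sym)))))

    r⊆ : ∀ i η → (First i → u i ∈ η) → (Last i → u (next (next i)) ∈ η) → r (tri i) ⊆ η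
    r⊆ i η f l {x} h with ∈-triple⁻ (r⊆tri i h)
    ... | inj₁ refl = f h
    ... | inj₂ (inj₁ refl) = ⊥-elim (middle i h)
    ... | inj₂ (inj₂ refl) = l h

    same : ∀ i j η → r (tri i) ⊆ η → η ⊆ tri i → r (tri j) ⊆ η → η ⊆ tri j → i ≡ j
    same i j η f g f′ g′ = tri-injective (unique η (tri i) (tri j) (facet i) (facet j) f g f′ g′)

    -- The inner edge from u (i+1) to u (i+2) lies in just two triangles, and one of them must take
    -- it. Together with `edge-once`, exactly one of `First i` and `Last (next i)` holds.
    edge-covered : ∀ i → ¬ First i ⊎ ¬ Last (next i)
    edge-covered i with cover-ridge i ∈-triple₁
    ... | j , f , g with edge i j (within (g (∈-del⁺ ∈-triple₂ (u-≢ (next≢ i ∘ sym)))))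
                                  (within (g (∈-del⁺ ∈-triple₃ (u-≢ (next²≢ i ∘ sym)))))
    ... | inj₁ refl = inj₁ λ h → ∉-del (u i) (f h)
    ... | inj₂ refl = inj₂ λ h → last∉ (∈-triple⁻ (∈-del⁻ (f h)))
      where
      last∉ : ¬ (u (next (next (next i))) ≡ u i ⊎ u (next (next (next i))) ≡ u (next i) ⊎ u (next (next (next i))) ≡ u (next (next i)))
      last∉ (inj₁ e) = next≢ i (sym (free i (next i) (inj₂ (inj₂ (sym (u-injective e)))) (inj₂ (inj₁ refl))))
      last∉ (inj₂ (inj₁ e)) = next²≢ (next i) (sym (u-injective e))
      last∉ (inj₂ (inj₂ e)) = next≢ (next (next i)) (sym (u-injective e))

    edge-once : ∀ i → ¬ First i → ¬ Last (next i) → i ≡ next i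
    edge-once i ¬f ¬l = same i (next i) (pair (u (next i)) (u (next (next i))))
      (r⊆ i _ (⊥-elim ∘ ¬f) (λ _ → ∈-pairʳ)) (pair-⊆ ∈-triple₂ ∈-triple₃)
      (r⊆ (next i) _ (λ _ → ∈-pairˡ) (⊥-elim ∘ ¬l)) (pair-⊆ ∈-triple₁ ∈-triple₂)

    -- If `First i` failed, the minimal face of `tri i` would lie in the vertex u (i+2).
    -- `First (next i)` excludes `Last` at i+2, so the same holds for the minimal face of `tri` at
    -- i+2, and that vertex would lie in two intervals. Going round the cycle, `First` holds
    -- everywhere or nowhere.
    first-back : ∀ i → First (next i) → First i
    first-back i h = decidable-stable (u i ∈? r (tri i)) λ ¬f → distinct (same i (next (next i)) ⁅ u (next (next i)) ⁆
      (r⊆ i _ (⊥-elim ∘ ¬f) (λ _ → x∈⁅x⁆ _)) (⁅⁆⊆ ∈-triple₃)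
      (r⊆ (next (next i)) _ (λ _ → x∈⁅x⁆ _) (λ l → ⊥-elim ([ (λ ¬f′ → ¬f′ h) , (λ ¬l → ¬l l) ]′ (edge-covered (next i))))) (⁅⁆⊆ ∈-triple₁))
      where
      distinct : i ≢ next (next i)
      distinct = next²≢ i

    first-all : ∀ i j → First j → First i
    first-all i j h with reach i j
    ... | m , refl = go m h
      where
      go : ∀ m → First (fold i next m) → First i
      go zero h = h
      go (suc m) h = go m (first-back _ h)

  -- Every vertex is the whole minimal face of one of the two triangles that can start or end there,
  -- so the interval containing ∅ has nowhere to go.
  band⇒¬partition : Empty.⊥
  band⇒¬partition with cover ⊥ (closed (tri origin) ⊥ Subₚ.⊥⊆ (face-tri origin))
  ... | ρ , ρ-facet , rρ⊆⊥ , _ = contra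
    where
    inhabited : ∃[ v ] v ∈ ρ
    inhabited with Subₚ.nonempty? ρ
    ... | yes w = w
    ... | no ¬w = ⊥-elim (Subₚ.∉⊥ (subst (u origin ∈_) (trans (proj₂ ρ-facet (tri origin) (face-tri origin)
        (λ h → ⊥-elim (¬w (_ , h)))) (Subₚ.Empty-unique ¬w)) ∈-triple₁))
    j = proj₁ (vertex _ (closed ρ _ (⁅⁆⊆ (proj₂ inhabited)) (proj₁ ρ-facet)))
    uj∈ρ : u j ∈ ρ
    uj∈ρ = subst (_∈ ρ) (proj₂ (vertex _ (closed ρ _ (⁅⁆⊆ (proj₂ inhabited)) (proj₁ ρ-facet)))) (proj₂ inhabited)
    -- The interval of ρ starts at ∅ and so contains the vertex u j of ρ. If `tri i` also takes u j,
    -- it equals ρ, but its minimal face is not empty.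
    clash : ∀ i {x} → r (tri i) ⊆ ⁅ u j ⁆ → u j ∈ tri i → ¬ (x ∈ r (tri i))
    clash i f h x∈ = Subₚ.∉⊥ (rρ⊆⊥ (subst (λ σ → _ ∈ r σ) (unique ⁅ u j ⁆ (tri i) ρ (facet i) ρ-facet f (⁅⁆⊆ h)
      (λ h → ⊥-elim (Subₚ.∉⊥ (rρ⊆⊥ h))) (⁅⁆⊆ uj∈ρ)) x∈))
    -- Either all triangles are `First` and none is `Last`, or none is `First` and all are `Last`.
    -- The triangle that starts, respectively ends, at u j then has the vertex u j as its whole
    -- minimal face.
    contra : Empty.⊥
    contra with u j ∈? r (tri j)
    ... | yes first = clash j (r⊆ j _ (λ _ → x∈⁅x⁆ _) (λ l → ⊥-elim
        ([ (λ ¬f → ¬f (first-all (prev j) j first))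
         , (λ ¬l → ¬l (subst Last (sym (next-prev j)) l)) ]′ (edge-covered (prev j))))) ∈-triple₁ first
    ... | no ¬first = clash i (r⊆ i _ (⊥-elim ∘ ¬f) (λ _ → subst (λ z → u (next (next i)) ∈ ⁅ u z ⁆) nni (x∈⁅x⁆ _)))
        (subst (λ z → u z ∈ tri i) nni ∈-triple₃)
        (decidable-stable (u (next (next i)) ∈? r (tri i)) λ ¬l →
          next≢ p (edge-once p (¬first ∘ first-all j p) (subst (¬_ ∘ Last) (sym (next-prev i)) ¬l)))
      where
      i = prev (prev j)
      p = prev i
      nni : next (next i) ≡ j
      nni = trans (cong next (next-prev (prev j))) (next-prev j)
      ¬f : ¬ First i
      ¬f h = ¬first (first-all j i h)

-- The cyclic orders of length 5, 6 and 7

module _ (k : ℕ) .{{_ : ℕ.NonZero k}} where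

  successor predecessor : Fin k → Fin k
  successor i = suc (Fin.toℕ i) DivMod.mod k
  predecessor i = (Fin.toℕ i ℕ.+ (k ℕ.∸ 1)) DivMod.mod k

  -- The representative of a residue d between -2 and 2, if there is one. Positions in one window
  -- differ by at most two, so there the displacements add up as integers.
  signed : ℕ → ℤ
  signed d =
    if does (d ℕ.≟ 1) then 1ℤ else
    if does (d ℕ.≟ 2) then ℤ.+ 2 else
    if does (suc d ℕ.≟ k) then -1ℤ else
    if does (suc (suc d) ℕ.≟ k) then ℤ.- ℤ.+ 2 else 0ℤ

  displacement : Fin k → Fin k → ℤ
  displacement i j = signed ((Fin.toℕ j ℕ.+ (k ℕ.∸ Fin.toℕ i)) DivMod.% k)

  private
    S : Fin k → Fin k
    S = successor

  within? : ∀ a i → Dec (Within S a i)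
  within? a i = (a Fin.≟ i) ⊎-dec (a Fin.≟ S i) ⊎-dec (a Fin.≟ S (S i))
  next-prev? = all? λ i → S (predecessor i) Fin.≟ i
  next≢? = all? λ i → ¬? (i Fin.≟ S i)
  next²≢? = all? λ i → ¬? (i Fin.≟ S (S i))
  free? = all? λ i → all? λ j → within? i j →-dec (within? (S (S i)) j →-dec (j Fin.≟ i))
  edge? = all? λ i → all? λ j → within? (S i) j →-dec (within? (S (S i)) j →-dec ((j Fin.≟ i) ⊎-dec (j Fin.≟ S i)))
  reach? = all? λ i → all? λ j → any? λ m → fold i S (Fin.toℕ {k} m) Fin.≟ j
  step-antisym? = all? λ i → all? λ j → displacement i j ℤ.≟ (ℤ.- displacement j i)
  step-next? = all? λ i → displacement i (S i) ℤ.≟ 1ℤ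

  nth : Fin k → Fin 3 → Fin k
  nth i zero = i
  nth i (suc zero) = S i
  nth i (suc (suc zero)) = S (S i)

  cocycle? = all? λ i → all? λ p → all? λ q → all? λ r →
    (displacement (nth i p) (nth i q) ℤ.+ displacement (nth i q) (nth i r) ℤ.+ displacement (nth i r) (nth i p)) ℤ.≟ 0ℤ

  within⇒nth : ∀ {a i} → Within S a i → ∃[ p ] a ≡ nth i p
  within⇒nth (inj₁ e) = zero , e
  within⇒nth (inj₂ (inj₁ e)) = suc zero , e
  within⇒nth (inj₂ (inj₂ e)) = suc (suc zero) , e

  mkCycle : True next-prev? → True next≢? → True next²≢? → True free? → True edge? → True reach? →
    True step-antisym? → True step-next? → True cocycle? →
    (∀ {n} (g : Fin k → ℤ) → ℤsum {n} (g ∘ S) ≡ ℤsum {n} g) →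
    (∀ {n} → ℤsum {n} {k} (λ _ → 1ℤ ℤ.+ 1ℤ) ≢ 0ℤ) → Cycle k
  mkCycle a b c d e f g h l rotate total = record
    { next = S ; prev = predecessor
    ; next-prev = toWitness a ; next≢ = toWitness b ; next²≢ = toWitness c ; free = toWitness d ; edge = toWitness e
    ; reach = λ i j → let m , eq = toWitness f i j in Fin.toℕ m , eq
    ; rotate = λ {n} → rotate {n} ; total = λ {n} → total {n}
    ; step = displacement ; step-antisym = toWitness g ; step-next = toWitness h
    ; step-cocycle = cocycle }
    where
    cocycle : ∀ i x y z → Within S x i → Within S y i → Within S z i →
      displacement x y ℤ.+ displacement y z ℤ.+ displacement z x ≡ 0ℤ
    cocycle i x y z hx hy hz with within⇒nth hx | within⇒nth hy | within⇒nth hz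
    ... | p , refl | q , refl | r , refl = toWitness l i p q r

cycle₅ : Cycle 5
cycle₅ = mkCycle 5 tt tt tt tt tt tt tt tt tt
  (λ g → solve 5 (λ a b c d e → b :+ (c :+ (d :+ (e :+ (a :+ con 0ℤ)))) := a :+ (b :+ (c :+ (d :+ (e :+ con 0ℤ)))))
    refl (g (# 0)) (g (# 1)) (g (# 2)) (g (# 3)) (g (# 4)))
  λ ()
  where
  open ℤsolver.+-*-Solver

cycle₆ : Cycle 6
cycle₆ = mkCycle 6 tt tt tt tt tt tt tt tt tt
  (λ g → solve 6 (λ a b c d e f → b :+ (c :+ (d :+ (e :+ (f :+ (a :+ con 0ℤ))))) := a :+ (b :+ (c :+ (d :+ (e :+ (f :+ con 0ℤ))))))
    refl (g (# 0)) (g (# 1)) (g (# 2)) (g (# 3)) (g (# 4)) (g (# 5)))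
  λ ()
  where
  open ℤsolver.+-*-Solver

cycle₇ : Cycle 7
cycle₇ = mkCycle 7 tt tt tt tt tt tt tt tt tt
  (λ g → solve 7 (λ a b c d e f h → b :+ (c :+ (d :+ (e :+ (f :+ (h :+ (a :+ con 0ℤ)))))) := a :+ (b :+ (c :+ (d :+ (e :+ (f :+ (h :+ con 0ℤ)))))))
    refl (g (# 0)) (g (# 1)) (g (# 2)) (g (# 3)) (g (# 4)) (g (# 5)) (g (# 6)))
  λ ()
  where
  open ℤsolver.+-*-Solver

-- Oriented edges and the pairing with 1-cochains

sum-two : ∀ {k m} {f : Fin m → ℤ} i j → i ≢ j → (∀ l → l ≢ i → l ≢ j → f l ≡ 0ℤ) → ℤsum {k} f ≡ f i ℤ.+ f j
sum-two {k} {m} {f} i j i≢j e = begin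
  ℤsum {k} f ≡⟨ sum-cong {k} {m} split ⟩
  ℤsum {k} (λ l → g l ℤ.+ h l) ≡⟨ sum-+ {k} g h ⟩
  ℤsum {k} g ℤ.+ ℤsum {k} h ≡⟨ cong₂ ℤ._+_ (sum-single {k} i g-off) (sum-single {k} j h-off) ⟩
  g i ℤ.+ h j ≡⟨ cong₂ (λ a b → (if a then f i else 0ℤ) ℤ.+ (if b then 0ℤ else f j)) (dec-true (i Fin.≟ i) refl) (dec-false (j Fin.≟ i) (i≢j ∘ sym)) ⟩
  f i ℤ.+ f j ∎
  where
  open ≡-Reasoning
  g h : Fin m → ℤ
  g l = if does (l Fin.≟ i) then f l else 0ℤ
  h l = if does (l Fin.≟ i) then 0ℤ else f l
  split : ∀ l → f l ≡ g l ℤ.+ h l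
  split l with does (l Fin.≟ i)
  ... | true = sym (ℤₚ.+-identityʳ (f l))
  ... | false = sym (ℤₚ.+-identityˡ (f l))
  g-off : ∀ l → l ≢ i → g l ≡ 0ℤ
  g-off l l≢i = cong (λ b → if b then f l else 0ℤ) (dec-false (l Fin.≟ i) l≢i)
  h-off : ∀ l → l ≢ j → h l ≡ 0ℤ
  h-off l l≢j with l Fin.≟ i
  ... | yes _ = refl
  ... | no l≢i = e l l≢i l≢j

-- The oriented edge with boundary x - y. The sign makes it antisymmetric in x and y although `pair`
-- is symmetric.
edgeChain : Fin n → Fin n → Chain n
edgeChain x y η = sgn (x ≺ y) ℤ.* δ (pair x y) η

edgeChain-≡ : ∀ (x y : Fin n) → edgeChain x y (pair x y) ≡ sgn (x ≺ y)
edgeChain-≡ x y = trans (cong (sgn (x ≺ y) ℤ.*_) (δ-≡ (pair x y))) (ℤₚ.*-identityʳ (sgn (x ≺ y)))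

edgeChain-≢ : ∀ {x y : Fin n} {η} → η ≢ pair x y → edgeChain x y η ≡ 0ℤ
edgeChain-≢ {x = x} {y} h = trans (cong (sgn (x ≺ y) ℤ.*_) (δ-≢ h)) (ℤₚ.*-zeroʳ (sgn (x ≺ y)))

pair-cancel : ∀ {x y z : Fin n} → y ≢ x → pair x z ≡ pair x y → z ≡ y
pair-cancel {x = x} y≢x e = [ ⊥-elim ∘ y≢x , sym ]′ (∈-pair⁻ (subst (_ ∈_) (sym e) ∈-pairʳ))

∂-edgeChain : ∀ {x y : Fin n} → x ≢ y → ∀ η → ∂ (edgeChain x y) η ≡ δ ⁅ x ⁆ η ℤ.- δ ⁅ y ⁆ η
∂-edgeChain {n} {x} {y} x≢y η = go (η ≟ₛ ⁅ x ⁆) (η ≟ₛ ⁅ y ⁆)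
  where
  go : ∀ {η} → Dec (η ≡ ⁅ x ⁆) → Dec (η ≡ ⁅ y ⁆) → ∂ (edgeChain x y) η ≡ δ ⁅ x ⁆ η ℤ.- δ ⁅ y ⁆ η
  go (yes refl) _ = trans
    (∂-single (edgeChain x y) ⁅ x ⁆ y (λ h → x≢y (sym (x∈⁅y⁆⇒x≡y x h))) λ v v≢y _ → edgeChain-≢ (v≢y ∘ pair-cancel (x≢y ∘ sym)))
    (trans (cong₂ (λ k z → sgn k ℤ.* z) (below-⁅⁆ x y) (edgeChain-≡ x y))
      (trans (sgn-sq (x ≺ y)) (sym (cong₂ (λ a b → a ℤ.- b) (δ-≡ ⁅ x ⁆) (δ-≢ (x≢y ∘ ⁅⁆-injective))))))
  go (no _) (yes refl) = trans
    (∂-single (edgeChain x y) ⁅ y ⁆ x (λ h → x≢y (x∈⁅y⁆⇒x≡y y h)) λ v v≢x _ → edgeChain-≢ λ e → v≢x (pair-cancel x≢y (trans e (pair-comm x y))))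
    (trans (cong₂ (λ k z → sgn k ℤ.* z) (below-⁅⁆ y x) (trans (cong (edgeChain x y) (pair-comm y x)) (trans (edgeChain-≡ x y) (sgn-≺ x≢y))))
      (trans (sym (ℤₚ.neg-distribʳ-* (sgn (y ≺ x)) (sgn (y ≺ x)))) (trans (cong ℤ.-_ (sgn-sq (y ≺ x)))
        (sym (cong₂ (λ a b → a ℤ.- b) (δ-≢ (x≢y ∘ sym ∘ ⁅⁆-injective)) (δ-≡ ⁅ y ⁆))))))
  go {η} (no η≢x) (no η≢y) = trans (∂-0 {c = edgeChain x y} {η} λ v v∉ → edgeChain-≢ {x = x} {y} λ e →
      [ (λ { refl → η≢y (rest e v∉ y ∈-pairʳ (x≢y ∘ sym) λ h h≢ → [ ⊥-elim ∘ h≢ , id ]′ (∈-pair⁻ h)) })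
      , (λ { refl → η≢x (rest e v∉ x ∈-pairˡ x≢y λ h h≢ → [ id , ⊥-elim ∘ h≢ ]′ (∈-pair⁻ h)) }) ]′
      (∈-pair⁻ (subst (v ∈_) e (∈-right (x∈⁅x⁆ v)))))
    (sym (cong₂ (λ a b → a ℤ.- b) (δ-≢ η≢x) (δ-≢ η≢y)))
    where
    rest : ∀ {v} → η ∪ ⁅ v ⁆ ≡ pair x y → v ∉ η → ∀ w → w ∈ pair x y → w ≢ v → (∀ {z} → z ∈ pair x y → z ≢ v → z ≡ w) → η ≡ ⁅ w ⁆
    rest {v} e v∉ w w∈ w≢v f = ⊆-antisym
      (λ {z} h → subst (_∈ ⁅ w ⁆) (sym (f (subst (z ∈_) e (∈-left h)) λ { refl → v∉ h })) (x∈⁅x⁆ w))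
      (⁅⁆⊆ ([ id , (λ h → ⊥-elim (w≢v (x∈⁅y⁆⇒x≡y v h))) ]′ (∈-split (subst (w ∈_) (sym e) w∈))))

⨁ : ∀ {m} → (Fin m → Chain n) → Chain n
⨁ {n} f η = ℤsum {n} λ i → f i η

∂-⨁ : ∀ {m} (f : Fin m → Chain n) η → ∂ (⨁ f) η ≡ ℤsum {n} λ i → ∂ (f i) η
∂-⨁ {m = zero} f η = ∂-0 {c = ⨁ f} {η} λ _ _ → refl
∂-⨁ {m = suc m} f η = trans (∂-⊞ (f zero) (⨁ (f ∘ suc)) η) (cong (ℤ._+_ (∂ (f zero) η)) (∂-⨁ (f ∘ suc) η))

-- The value of a 1-cochain φ on c, with each edge counted in both orientations; for antisymmetric φ
-- this is twice the usual value.
pairing : (Fin n → Fin n → ℤ) → Chain n → ℤ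
pairing {n} φ c = ℤsum {n} λ x → ℤsum {n} λ y → φ x y ℤ.* (sgn (x ≺ y) ℤ.* c (pair x y))

pairing-⊞ : ∀ (φ : Fin n → Fin n → ℤ) c d → pairing φ (c ⊞ d) ≡ pairing φ c ℤ.+ pairing φ d
pairing-⊞ {n} φ c d = trans (sum-cong {n} {n} λ x → trans (sum-cong {n} {n} λ y →
      solve 4 (λ p s a b → p :* (s :* (a :+ b)) := p :* (s :* a) :+ p :* (s :* b)) refl (φ x y) (sgn (x ≺ y)) (c (pair x y)) (d (pair x y)))
    (sum-+ {n} (term c x) (term d x)))
  (sum-+ {n} (λ x → ℤsum {n} (term c x)) (λ x → ℤsum {n} (term d x)))
  where
  open ℤsolver.+-*-Solver
  term : Chain n → Fin n → Fin n → ℤ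
  term c x y = φ x y ℤ.* (sgn (x ≺ y) ℤ.* c (pair x y))

pairing-⨁ : ∀ (φ : Fin n → Fin n → ℤ) {m} (f : Fin m → Chain n) → pairing φ (⨁ f) ≡ ℤsum {n} λ i → pairing φ (f i)
pairing-⨁ {n} φ {zero} f = sum-0 {n} {n} λ x → sum-0 {n} {n} λ y →
  trans (cong (φ x y ℤ.*_) (ℤₚ.*-zeroʳ (sgn (x ≺ y)))) (ℤₚ.*-zeroʳ (φ x y))
pairing-⨁ φ {suc m} f = trans (pairing-⊞ φ (f zero) (⨁ (f ∘ suc))) (cong (ℤ._+_ (pairing φ (f zero))) (pairing-⨁ φ (f ∘ suc)))

pairing-cong : ∀ (φ : Fin n → Fin n → ℤ) {c d} → (∀ η → c η ≡ d η) → pairing φ c ≡ pairing φ d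
pairing-cong {n} φ e = sum-cong {n} {n} λ x → sum-cong {n} {n} λ y → cong (λ z → φ x y ℤ.* (sgn (x ≺ y) ℤ.* z)) (e (pair x y))

module _ {n} (φ : Fin n → Fin n → ℤ) (antisym : ∀ x y → φ x y ≡ ℤ.- φ y x) where
  open ℤsolver.+-*-Solver

  pairing-edgeChain : ∀ {x y} → x ≢ y → pairing φ (edgeChain x y) ≡ φ x y ℤ.+ φ x y
  pairing-edgeChain {x} {y} x≢y = trans (sum-two {n} x y x≢y off) (cong₂ ℤ._+_
      (trans (sum-single {n} y λ b b≢y → vanish x b (b≢y ∘ pair-cancel (x≢y ∘ sym))) xy)
      (trans (sum-single {n} x λ b b≢x → vanish y b λ e → b≢x (pair-cancel x≢y (trans e (pair-comm x y)))) yx))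
    where
    vanish : ∀ a b → pair a b ≢ pair x y → φ a b ℤ.* (sgn (a ≺ b) ℤ.* edgeChain x y (pair a b)) ≡ 0ℤ
    vanish a b ne = trans (cong (λ z → φ a b ℤ.* (sgn (a ≺ b) ℤ.* z)) (edgeChain-≢ ne))
      (solve 2 (λ p s → p :* (s :* con 0ℤ) := con 0ℤ) refl (φ a b) (sgn (a ≺ b)))
    off : ∀ a → a ≢ x → a ≢ y → ℤsum {n} (λ b → φ a b ℤ.* (sgn (a ≺ b) ℤ.* edgeChain x y (pair a b))) ≡ 0ℤ
    off a a≢x a≢y = sum-0 {n} {n} λ b → vanish a b λ e → [ a≢x , a≢y ]′ (∈-pair⁻ (subst (a ∈_) e ∈-pairˡ))
    xy : φ x y ℤ.* (sgn (x ≺ y) ℤ.* edgeChain x y (pair x y)) ≡ φ x y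
    xy = trans (cong (φ x y ℤ.*_) (trans (cong (sgn (x ≺ y) ℤ.*_) (edgeChain-≡ x y)) (sgn-sq (x ≺ y)))) (ℤₚ.*-identityʳ (φ x y))
    yx : φ y x ℤ.* (sgn (y ≺ x) ℤ.* edgeChain x y (pair y x)) ≡ φ x y
    yx = begin
      φ y x ℤ.* (sgn (y ≺ x) ℤ.* edgeChain x y (pair y x))
        ≡⟨ cong (λ z → φ y x ℤ.* (sgn (y ≺ x) ℤ.* z)) (trans (cong (edgeChain x y) (pair-comm y x)) (trans (edgeChain-≡ x y) (sgn-≺ x≢y))) ⟩
      φ y x ℤ.* (sgn (y ≺ x) ℤ.* ℤ.- sgn (y ≺ x))
        ≡⟨ cong (φ y x ℤ.*_) (trans (sym (ℤₚ.neg-distribʳ-* (sgn (y ≺ x)) _)) (cong ℤ.-_ (sgn-sq (y ≺ x)))) ⟩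
      φ y x ℤ.* -1ℤ ≡⟨ solve 1 (λ p → p :* con -1ℤ := :- p) refl (φ y x) ⟩
      ℤ.- φ y x ≡⟨ sym (antisym x y) ⟩
      φ x y ∎
      where open ≡-Reasoning

  sum³ : (Fin n → Fin n → Fin n → ℤ) → ℤ
  sum³ g = ℤsum {n} λ x → ℤsum {n} λ y → ℤsum {n} λ z → g x y z

  sum³-rotate : ∀ g → sum³ (λ x y z → g y z x) ≡ sum³ g
  sum³-rotate g = trans (sum-swap {n} {n} {n} λ x y → ℤsum {n} λ z → g y z x)
    (sum-cong {n} {n} λ y → sum-swap {n} {n} {n} λ x z → g y z x)

  sum³-+ : ∀ g h → sum³ (λ x y z → g x y z ℤ.+ h x y z) ≡ sum³ g ℤ.+ sum³ h
  sum³-+ g h = trans (sum-cong {n} {n} λ x → trans (sum-cong {n} {n} λ y → sum-+ {n} (g x y) (h x y))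
      (sum-+ {n} (λ y → ℤsum {n} (g x y)) (λ y → ℤsum {n} (h x y))))
    (sum-+ {n} (λ x → ℤsum {n} λ y → ℤsum {n} (g x y)) (λ x → ℤsum {n} λ y → ℤsum {n} (h x y)))

  φ-diag : ∀ x → φ x x ≡ 0ℤ
  φ-diag x = i≡-i⇒i≡0 (antisym x x)

  -- Summing over the three cyclic rotations of (x, y, z) exhibits the cocycle condition.
  pairing-∂ : ∀ {F : Fam n} d → IsChain F 3 d →
    (∀ x y z → x ≢ y → y ≢ z → x ≢ z → F (triple x y z) → φ x y ℤ.+ φ y z ℤ.+ φ z x ≡ 0ℤ) → pairing φ (∂ d) ≡ 0ℤ
  pairing-∂ {F} d d-chain cocycle = trans (sum-cong {n} {n} λ x → sum-cong {n} {n} λ y → expand x y)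
      ([ (λ ()) , id ]′ (ℤₚ.i*j≡0⇒i≡0∨j≡0 (ℤ.+ 3) triple-sum))
    where
    D g : Fin n → Fin n → Fin n → ℤ
    D x y z = sgn (x ≺ y) ℤ.* ∂-term d (pair x y) z
    g x y z = φ x y ℤ.* D x y z
    expand : ∀ x y → φ x y ℤ.* (sgn (x ≺ y) ℤ.* ∂ d (pair x y)) ≡ ℤsum {n} (g x y)
    expand x y = trans (cong (φ x y ℤ.*_) (sym (sum-* {n} (sgn (x ≺ y)) (∂-term d (pair x y))))) (sym (sum-* {n} (φ x y) (D x y)))
    g-diag : ∀ {x y z} → x ≡ y → g x y z ≡ 0ℤ
    g-diag {x} {z = z} refl = cong (ℤ._* D x x z) (φ-diag x)
    g-in : ∀ {x y z} → z ∈ pair x y → g x y z ≡ 0ℤ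
    g-in {x} {y} {z} h = trans (cong (λ t → φ x y ℤ.* (sgn (x ≺ y) ℤ.* t)) (∂-term-∈ {c = d} h))
      (solve 2 (λ p s → p :* (s :* con 0ℤ) := con 0ℤ) refl (φ x y) (sgn (x ≺ y)))
    D-≢ : ∀ {x y z} → x ≢ y → y ≢ z → x ≢ z → D x y z ≡ sgn (x ≺ y) ℤ.* (sgn (x ≺ z) ℤ.* sgn (y ≺ z) ℤ.* d (triple x y z))
    D-≢ {x} {y} {z} x≢y y≢z x≢z = cong (sgn (x ≺ y) ℤ.*_) (trans (∂-term-∉ {c = d} λ h → [ x≢z ∘ sym , y≢z ∘ sym ]′ (∈-pair⁻ h))
      (cong (ℤ._* d (triple x y z)) (trans (cong sgn (trans (below-add ⁅ x ⁆ z λ h → x≢y (sym (x∈⁅y⁆⇒x≡y x h)))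
        (cong (ℕ._+ y ≺ z) (below-⁅⁆ x z)))) (sgn-+ (x ≺ z) (y ≺ z)))))
    D-rotate : ∀ {x y z} → x ≢ y → y ≢ z → x ≢ z → D y z x ≡ D x y z
    D-rotate {x} {y} {z} x≢y y≢z x≢z = begin
      D y z x ≡⟨ D-≢ y≢z (x≢z ∘ sym) (x≢y ∘ sym) ⟩
      sgn (y ≺ z) ℤ.* (sgn (y ≺ x) ℤ.* sgn (z ≺ x) ℤ.* d (triple y z x))
        ≡⟨ cong₂ (λ a b → sgn (y ≺ z) ℤ.* (a ℤ.* b ℤ.* d (triple y z x))) (sgn-≺ (x≢y ∘ sym)) (sgn-≺ (x≢z ∘ sym)) ⟩
      sgn (y ≺ z) ℤ.* (ℤ.- sgn (x ≺ y) ℤ.* ℤ.- sgn (x ≺ z) ℤ.* d (triple y z x))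
        ≡⟨ cong (λ θ → sgn (y ≺ z) ℤ.* (ℤ.- sgn (x ≺ y) ℤ.* ℤ.- sgn (x ≺ z) ℤ.* d θ)) (sym (triple-rotate x y z)) ⟩
      sgn (y ≺ z) ℤ.* (ℤ.- sgn (x ≺ y) ℤ.* ℤ.- sgn (x ≺ z) ℤ.* d (triple x y z))
        ≡⟨ solve 4 (λ a b c t → c :* (:- a :* :- b :* t) := a :* (b :* c :* t)) refl (sgn (x ≺ y)) (sgn (x ≺ z)) (sgn (y ≺ z)) (d (triple x y z)) ⟩
      sgn (x ≺ y) ℤ.* (sgn (x ≺ z) ℤ.* sgn (y ≺ z) ℤ.* d (triple x y z)) ≡⟨ sym (D-≢ x≢y y≢z x≢z) ⟩
      D x y z ∎
      where open ≡-Reasoning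
    zeros : ∀ {a b c} → a ≡ 0ℤ → b ≡ 0ℤ → c ≡ 0ℤ → a ℤ.+ b ℤ.+ c ≡ 0ℤ
    zeros refl refl refl = refl
    cyclic : ∀ x y z → Dec (x ≡ y) → Dec (y ≡ z) → Dec (x ≡ z) → g x y z ℤ.+ g y z x ℤ.+ g z x y ≡ 0ℤ
    cyclic x y z (yes refl) _ _ = zeros (g-diag {x} {x} {z} refl) (g-in {x} {z} {x} ∈-pairˡ) (g-in {z} {x} {x} ∈-pairʳ)
    cyclic x y z (no _) (yes refl) _ = zeros (g-in {x} {y} {y} ∈-pairʳ) (g-diag {y} {y} {x} refl) (g-in {y} {x} {y} ∈-pairˡ)
    cyclic x y z (no _) (no _) (yes refl) = zeros (g-in {x} {y} {x} ∈-pairˡ) (g-in {y} {x} {x} ∈-pairʳ) (g-diag {x} {x} {y} refl)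
    cyclic x y z (no x≢y) (no y≢z) (no x≢z) = begin
      g x y z ℤ.+ g y z x ℤ.+ g z x y
        ≡⟨ cong₂ (λ s t → g x y z ℤ.+ φ y z ℤ.* s ℤ.+ φ z x ℤ.* t) (D-rotate x≢y y≢z x≢z)
             (trans (D-rotate y≢z (x≢z ∘ sym) (x≢y ∘ sym)) (D-rotate x≢y y≢z x≢z)) ⟩
      φ x y ℤ.* X ℤ.+ φ y z ℤ.* X ℤ.+ φ z x ℤ.* X
        ≡⟨ solve 4 (λ a b c t → a :* t :+ b :* t :+ c :* t := (a :+ b :+ c) :* t) refl (φ x y) (φ y z) (φ z x) X ⟩
      (φ x y ℤ.+ φ y z ℤ.+ φ z x) ℤ.* X
        -- If xyz is a face, the cocycle condition gives s = 0; if not, d and hence X vanish.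
        -- Membership in F need not be decidable, so the case distinction is made under a double
        -- negation.
        ≡⟨ decidable-stable (s ℤ.* X ℤ.≟ 0ℤ) (λ ≢0 → ≢0 (trans (cong (s ℤ.*_) (X-0 λ Fxyz → ≢0 (cong (ℤ._* X) (cocycle x y z x≢y y≢z x≢z Fxyz))))
             (ℤₚ.*-zeroʳ s))) ⟩
      0ℤ ∎
      where
      open ≡-Reasoning
      X = D x y z
      s = φ x y ℤ.+ φ y z ℤ.+ φ z x
      X-0 : ¬ F (triple x y z) → X ≡ 0ℤ
      X-0 ¬F = trans (D-≢ x≢y y≢z x≢z)
        (trans (cong (λ t → sgn (x ≺ y) ℤ.* (sgn (x ≺ z) ℤ.* sgn (y ≺ z) ℤ.* t)) (d-chain (triple x y z) λ (h , _) → ¬F h))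
          (solve 3 (λ a b c → a :* (b :* c :* con 0ℤ) := con 0ℤ) refl (sgn (x ≺ y)) (sgn (x ≺ z)) (sgn (y ≺ z))))
    triple-sum : ℤ.+ 3 ℤ.* sum³ g ≡ 0ℤ
    triple-sum = begin
      ℤ.+ 3 ℤ.* sum³ g ≡⟨ solve 1 (λ s → con (ℤ.+ 3) :* s := s :+ s :+ s) refl (sum³ g) ⟩
      sum³ g ℤ.+ sum³ g ℤ.+ sum³ g
        ≡⟨ sym (cong₂ (λ s t → sum³ g ℤ.+ s ℤ.+ t) (sum³-rotate g) (trans (sum³-rotate λ x y z → g y z x) (sum³-rotate g))) ⟩
      sum³ g ℤ.+ sum³ (λ x y z → g y z x) ℤ.+ sum³ (λ x y z → g z x y)
        ≡⟨ cong (ℤ._+ sum³ (λ x y z → g z x y)) (sym (sum³-+ g λ x y z → g y z x)) ⟩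
      sum³ (λ x y z → g x y z ℤ.+ g y z x) ℤ.+ sum³ (λ x y z → g z x y)
        ≡⟨ sym (sum³-+ (λ x y z → g x y z ℤ.+ g y z x) (λ x y z → g z x y)) ⟩
      sum³ (λ x y z → g x y z ℤ.+ g y z x ℤ.+ g z x y)
        ≡⟨ (sum-0 {n} {n} λ x → sum-0 {n} {n} λ y → sum-0 {n} {n} λ z → cyclic x y z (x Fin.≟ y) (y Fin.≟ z) (x Fin.≟ z)) ⟩
      0ℤ ∎
      where open ≡-Reasoning

-- The link of ∅ in the pure 2-skeleton is the band itself, and its homology in dimension 1 would
-- have to vanish. `φ` is `step` read on vertices, a cocycle on every triangle, so it annihilates
-- boundaries. On the circle it yields 2 for each edge, hence 2k.
band⇒¬scm : ∀ {F : Fam n} → Band F → ¬ SeqCohenMacaulay F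
band⇒¬scm {n} {F} B scm = total {n} (trans (sym value) killed)
  where
  open Band B
  L : Fam n
  L = Link (PureSkel F 2) ⊥
  L-intro : ∀ {η} i → η ⊆ tri i → L η
  L-intro {η} i f = disjoint⇒∩≡⊥ (λ x _ → Subₚ.∉⊥) , tri i , face-tri i , ∪-lub f Subₚ.⊥⊆ , ∣tri∣ i
  L-top : HasTopSize L 3
  L-top = (tri origin , L-intro origin id , ∣tri∣ origin) , λ { η (_ , ρ , _ , f , s) → subst (∣ η ∣ ≤_) s (∣⊆∣ η ρ (f ∘ ∈-left)) }
  acyclic : Acyclic L 2
  acyclic = proj₂ (scm 3 ((tri origin , face-tri origin , ∣tri∣ origin) , top) 2 ℕₚ.≤-refl) ⊥
    (tri origin , face-tri origin , Subₚ.⊥⊆ , ∣tri∣ origin) 3 L-top 2 λ ()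
  c : Chain n
  c = ⨁ λ i → edgeChain (u i) (u (next i))
  c-chain : IsChain L 2 c
  c-chain σ ¬σ = sum-0 {n} {k} λ i → edgeChain-≢ {x = u i} {u (next i)} {σ} λ { refl → ¬σ (L-intro i (pair-⊆ ∈-triple₁ ∈-triple₂) , ∣pair∣ (u-≢ (next≢ i))) }
  ∂c : ∀ η → ∂ c η ≡ 0ℤ
  ∂c η = begin
    ∂ c η ≡⟨ ∂-⨁ (λ i → edgeChain (u i) (u (next i))) η ⟩
    ℤsum {n} (λ i → ∂ (edgeChain (u i) (u (next i))) η) ≡⟨ sum-cong {n} {k} (λ i → ∂-edgeChain (u-≢ (next≢ i)) η) ⟩
    ℤsum {n} (λ i → g i ℤ.- g (next i)) ≡⟨ sum-+ {n} g (λ i → ℤ.- g (next i)) ⟩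
    ℤsum {n} g ℤ.+ ℤsum {n} (λ i → ℤ.- g (next i)) ≡⟨ cong (ℤ._+_ (ℤsum {n} g)) (trans (sum-neg {n} (g ∘ next)) (cong ℤ.-_ (rotate {n} g))) ⟩
    ℤsum {n} g ℤ.- ℤsum {n} g ≡⟨ ℤₚ.+-inverseʳ (ℤsum {n} g) ⟩
    0ℤ ∎
    where
    open ≡-Reasoning
    g : Fin k → ℤ
    g i = δ ⁅ u i ⁆ η
  filled = acyclic c c-chain ∂c
  d = proj₁ filled
  position? : ∀ x → Dec (∃[ i ] u i ≡ x)
  position? x = any? λ i → u i Fin.≟ x
  φ : Fin n → Fin n → ℤ
  φ x y with position? x | position? y
  ... | yes (i , _) | yes (j , _) = step i j
  ... | yes _ | no _ = 0ℤ
  ... | no _ | _ = 0ℤ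
  φ-antisym : ∀ x y → φ x y ≡ ℤ.- φ y x
  φ-antisym x y with position? x | position? y
  ... | yes (i , _) | yes (j , _) = step-antisym i j
  ... | yes _ | no _ = refl
  ... | no _ | yes _ = refl
  ... | no _ | no _ = refl
  φ-u : ∀ i j → φ (u i) (u j) ≡ step i j
  φ-u i j with position? (u i) | position? (u j)
  ... | yes (i′ , e) | yes (j′ , e′) = cong₂ step (u-injective e) (u-injective e′)
  ... | yes _ | no ¬j = ⊥-elim (¬j (j , refl))
  ... | no ¬i | _ = ⊥-elim (¬i (i , refl))
  in-tri : ∀ {x i} → x ∈ tri i → ∃[ a ] (x ≡ u a × Within next a i)
  in-tri {i = i} h with ∈-triple⁻ h
  ... | inj₁ e = _ , e , inj₁ refl
  ... | inj₂ (inj₁ e) = _ , e , inj₂ (inj₁ refl)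
  ... | inj₂ (inj₂ e) = _ , e , inj₂ (inj₂ refl)
  cocycle : ∀ x y z → x ≢ y → y ≢ z → x ≢ z → L (triple x y z) → φ x y ℤ.+ φ y z ℤ.+ φ z x ≡ 0ℤ
  cocycle x y z x≢y y≢z x≢z (_ , ρ , Fρ , f , s) with only ρ Fρ s
  ... | i , refl with in-tri (f (∈-left ∈-triple₁)) | in-tri (f (∈-left ∈-triple₂)) | in-tri (f (∈-left ∈-triple₃))
  ... | a , refl , ha | b , refl , hb | c , refl , hc =
    trans (cong₂ ℤ._+_ (cong₂ ℤ._+_ (φ-u a b) (φ-u b c)) (φ-u c a)) (step-cocycle i a b c ha hb hc)
  killed : pairing φ c ≡ 0ℤ
  killed = trans (pairing-cong φ (λ η → sym (proj₂ (proj₂ filled) η))) (pairing-∂ φ φ-antisym {L} d (proj₁ (proj₂ filled)) cocycle)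
  value : pairing φ c ≡ ℤsum {n} {k} (λ _ → 1ℤ ℤ.+ 1ℤ)
  value = trans (pairing-⨁ φ λ i → edgeChain (u i) (u (next i))) (sum-cong {n} {k} λ i →
    trans (pairing-edgeChain φ φ-antisym (u-≢ (next≢ i))) (cong (λ t → t ℤ.+ t) (trans (φ-u i (next i)) (step-next i))))

-- Triples of vertices with connected links

bool-third : ∀ {a b c : Bool} → a ≢ b → c ≢ b → a ≡ c
bool-third {true} {true} h _ = ⊥-elim (h refl)
bool-third {true} {false} {true} _ _ = refl
bool-third {true} {false} {false} _ k = ⊥-elim (k refl)
bool-third {false} {true} {true} _ k = ⊥-elim (k refl)
bool-third {false} {true} {false} _ _ = refl
bool-third {false} {false} h _ = ⊥-elim (h refl)

case₄ : ∀ {A B C D E : Set} → (A → E) → (B → E) → (C → E) → (D → E) → A ⊎ B ⊎ C ⊎ D → E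
case₄ f g h k = [ f , [ g , [ h , k ]′ ]′ ]′

-- The triangles as a symmetric relation. `links` says that triangles sharing only x never form an
-- obstacle: two disjoint edges in the link of x are joined by a third.
module Hypergraph {n} (T : Fin n → Fin n → Fin n → Set) (T? : ∀ x y z → Dec (T x y z))
  (t231 : ∀ {x y z} → T x y z → T y z x) (t213 : ∀ {x y z} → T x y z → T y x z)
  (irr : ∀ {x y z} → T x y z → x ≢ y)
  (links : ∀ {x a b c d} → T x a b → T x c d → a ≢ c → a ≢ d → b ≢ c → b ≢ d →
    T x a c ⊎ T x a d ⊎ T x b c ⊎ T x b d) where

  private
    variable
      a b p q r s : Fin n

  t312 : ∀ {x y z} → T x y z → T z x y
  t312 = t231 ∘ t231

  t132 : ∀ {x y z} → T x y z → T x z y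
  t132 = t213 ∘ t312

  t321 : ∀ {x y z} → T x y z → T z y x
  t321 = t213 ∘ t231

  irr₂₃ : ∀ {x y z} → T x y z → y ≢ z
  irr₂₃ = irr ∘ t231

  irr₁₃ : ∀ {x y z} → T x y z → x ≢ z
  irr₁₃ = irr ∘ t132

  record HyperBand : Set where
    field
      {k} : ℕ
      cycle : Cycle k
    open Cycle cycle
    field
      u : Fin k → Fin n
      u-injective : ∀ {i j} → u i ≡ u j → i ≡ j
      consecutive : ∀ i → T (u i) (u (next i)) (u (next (next i)))
      only : ∀ i j l → T (u i) (u j) (u l) → ∃[ m ] (Within next i m × Within next j m × Within next l m)

  module _ {k} .{{_ : ℕ.NonZero k}} where

    InWindow : Fin k → Fin k → Fin k → Set
    InWindow i j l = ∃[ m ] (Within (successor k) i m × Within (successor k) j m × Within (successor k) l m)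

    inWindow? : ∀ i j l → Dec (InWindow i j l)
    inWindow? i j l = any? λ m → within? k i m ×-dec within? k j m ×-dec within? k l m

    OffWindow : Fin k × Fin k × Fin k → Set
    OffWindow (i , j , l) = i Fin.< j × j Fin.< l × ¬ InWindow i j l

    offWindow? : ∀ t → Dec (OffWindow t)
    offWindow? (i , j , l) = (i Fin.<? j) ×-dec (j Fin.<? l) ×-dec ¬? (inWindow? i j l)

    allTriples : List (Fin k × Fin k × Fin k)
    allTriples = Data.List.concatMap (λ i → Data.List.concatMap (λ j → map (λ l → i , j , l) (Data.List.allFin k)) (Data.List.allFin k)) (Data.List.allFin k)

    offWindow : List (Fin k × Fin k × Fin k)
    offWindow = filter offWindow? allTriples

    ∈-allTriples : ∀ i j l → (i , j , l) ∈ₗ allTriples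
    ∈-allTriples i j l = LMₚ.∈-concatMap⁺ _ (LM.lose (LMₚ.∈-allFin i) (LMₚ.∈-concatMap⁺ _ (LM.lose (LMₚ.∈-allFin j) (LMₚ.∈-map⁺ _ (LMₚ.∈-allFin l)))))

    -- By symmetry of T increasing triples suffice. For k = 5, 6, 7 `offWindow` evaluates to 5, 14
    -- and 28 triples in lexicographic order, the order of the exclusions in `band₅-from`, `band₆`
    -- and `band₇`.
    windows-only : ∀ (u : Fin k → Fin n) → All (λ (i , j , l) → ¬ T (u i) (u j) (u l)) offWindow →
      ∀ i j l → T (u i) (u j) (u l) → InWindow i j l
    windows-only u absent i j l t = order i j l t (Finₚ.<-cmp i j) (Finₚ.<-cmp j l) (Finₚ.<-cmp i l)
      where
      sorted : ∀ i j l → T (u i) (u j) (u l) → i Fin.< j → j Fin.< l → InWindow i j l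
      sorted i j l t i<j j<l = decidable-stable (inWindow? i j l) λ off →
        All.lookup absent (LMₚ.∈-filter⁺ offWindow? (∈-allTriples i j l) (i<j , j<l , off)) t
      order : ∀ i j l → T (u i) (u j) (u l) → Tri (i Fin.< j) (i ≡ j) (j Fin.< i) →
        Tri (j Fin.< l) (j ≡ l) (l Fin.< j) → Tri (i Fin.< l) (i ≡ l) (l Fin.< i) → InWindow i j l
      order i j l t (tri≈ _ refl _) _ _ = ⊥-elim (irr t refl)
      order i j l t _ (tri≈ _ refl _) _ = ⊥-elim (irr₂₃ t refl)
      order i j l t _ _ (tri≈ _ refl _) = ⊥-elim (irr₁₃ t refl)
      order i j l t (tri< a _ _) (tri< b _ _) _ = sorted i j l t a b
      order i j l t (tri< a _ _) (tri> _ _ b) (tri< c _ _) = let m , x , y , z = sorted i l j (t132 t) c b in m , x , z , y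
      order i j l t (tri< a _ _) (tri> _ _ b) (tri> _ _ c) = let m , x , y , z = sorted l i j (t312 t) c a in m , y , z , x
      order i j l t (tri> _ _ a) (tri< b _ _) (tri< c _ _) = let m , x , y , z = sorted j i l (t213 t) a c in m , y , x , z
      order i j l t (tri> _ _ a) (tri< b _ _) (tri> _ _ c) = let m , x , y , z = sorted j l i (t231 t) b c in m , z , x , y
      order i j l t (tri> _ _ a) (tri> _ _ b) _ = let m , x , y , z = sorted l j i (t321 t) b a in m , z , y , x

    lookup-injective : ∀ (xs : Vec.Vec (Fin n) k) →
      All (λ (i , j) → lookup xs i ≢ lookup xs j) (filter (λ (i , j) → i Fin.<? j) (Data.List.cartesianProduct (Data.List.allFin k) (Data.List.allFin k))) →
      ∀ {i j} → lookup xs i ≡ lookup xs j → i ≡ j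
    lookup-injective xs distinct {i} {j} e with Finₚ.<-cmp i j
    ... | tri≈ _ i≡j _ = i≡j
    ... | tri< i<j _ _ = ⊥-elim (All.lookup distinct (LMₚ.∈-filter⁺ (λ (i , j) → i Fin.<? j)
      (LMₚ.∈-cartesianProduct⁺ (LMₚ.∈-allFin i) (LMₚ.∈-allFin j)) i<j) e)
    ... | tri> _ _ j<i = ⊥-elim (All.lookup distinct (LMₚ.∈-filter⁺ (λ (i , j) → i Fin.<? j)
      (LMₚ.∈-cartesianProduct⁺ (LMₚ.∈-allFin j) (LMₚ.∈-allFin i)) j<i) (sym e))

  -- Two disjoint triangles never form an obstacle: their six vertices span a further triangle,
  -- arranged so that x is on the first, z on the second and y on either.
  Mixing : Set
  Mixing = ∀ {a p q b r s} → T a p q → T b r s →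
    (∀ {x} → x ≡ a ⊎ x ≡ p ⊎ x ≡ q → ¬ (x ≡ b ⊎ x ≡ r ⊎ x ≡ s)) →
    ∃[ x ] ∃[ y ] ∃[ z ] (T x y z × (x ≡ a ⊎ x ≡ p ⊎ x ≡ q) × (z ≡ b ⊎ z ≡ r ⊎ z ≡ s)
      × ((y ≡ a ⊎ y ≡ p ⊎ y ≡ q) ⊎ (y ≡ b ⊎ y ≡ r ⊎ y ≡ s)))

  module _ (v : Fin n) (χ : Fin n → Bool) (colour : ∀ {x y z} → T v x y → T x y z → z ≢ v → χ x ≡ χ y) where

    -- By colour, such an edge xy lies in no triangle besides vxy.
    Crossing : Fin n → Fin n → Set
    Crossing x y = T v x y × χ x ≢ χ y

    flip : ∀ {x y} → Crossing x y → Crossing y x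
    flip (t , h) = t132 t , h ∘ sym

    crossing-free : ∀ {x y z} → Crossing x y → z ≢ v → ¬ T x y z
    crossing-free (t , h) z≢v s = h (colour t s z≢v)

    -- Strips of triangles from a to b that avoid v. The cone from v over the crossing ab closes each of them
    -- up to a band, and all other triples are excluded by the colouring, by connected links and by the absence
    -- of shorter strips.
    record Strip₅ (a b p q : Fin n) : Set where
      constructor strip₅
      field
        ab : Crossing a b
        apq : T a p q
        bpq : T b p q
        p≢v : p ≢ v
        q≢v : q ≢ v

    -- The cyclic order is v, a, p, q, b. `links` at b, comparing va with pq, must give vbq: the
    -- alternative vbp would give b the colour of p, which is that of a.
    band₅-from : Strip₅ a b p q → T v a p → HyperBand
    band₅-from {a} {b} {p} {q} S vap = record
      { cycle = cycle₅ ; u = u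
      ; u-injective = lookup-injective (v ∷ a ∷ p ∷ q ∷ b ∷ [])
          (v≢a ∷ (p≢v ∘ sym) ∷ (q≢v ∘ sym) ∷ v≢b ∷ irr apq ∷ irr₁₃ apq ∷ a≢b ∷ irr₂₃ apq ∷ (irr bpq ∘ sym) ∷ (irr₁₃ bpq ∘ sym) ∷ [])
      ; consecutive = λ { zero → vap ; (suc zero) → apq ; (suc (suc zero)) → t231 bpq
                        ; (suc (suc (suc zero))) → t321 vbq ; (suc (suc (suc (suc zero)))) → t312 vab }
      ; only = windows-only u (¬vaq ∷ ¬vpq ∷ ¬vpb ∷ ¬apb ∷ ¬aqb ∷ []) }
      where
      open Strip₅ S
      vab = proj₁ ab
      u = lookup (v ∷ a ∷ p ∷ q ∷ b ∷ [])
      v≢a = irr vab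
      v≢b = irr₁₃ vab
      a≢b = irr₂₃ vab
      χp : χ a ≡ χ p
      χp = colour vap apq q≢v
      vbq : T v b q
      vbq with links (t312 vab) bpq (p≢v ∘ sym) (q≢v ∘ sym) (irr apq) (irr₁₃ apq)
      ... | inj₁ bvp = ⊥-elim (proj₂ ab (trans χp (sym (colour (t213 bvp) bpq q≢v))))
      ... | inj₂ (inj₁ bvq) = t213 bvq
      ... | inj₂ (inj₂ (inj₁ bap)) = ⊥-elim (crossing-free ab p≢v (t213 bap))
      ... | inj₂ (inj₂ (inj₂ baq)) = ⊥-elim (crossing-free ab q≢v (t213 baq))
      χq : χ b ≡ χ q
      χq = colour vbq (t132 bpq) p≢v
      ¬vaq : ¬ T v a q
      ¬vaq t = proj₂ ab (trans (colour t (t132 apq) p≢v) (sym χq))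
      ¬vpq : ¬ T v p q
      ¬vpq t = proj₂ ab (trans χp (trans (colour t (t231 apq) (v≢a ∘ sym)) (sym χq)))
      ¬vpb : ¬ T v p b
      ¬vpb t = proj₂ ab (trans χp (colour t (t213 bpq) q≢v))
      ¬apb : ¬ T a p b
      ¬apb = crossing-free ab p≢v ∘ t132
      ¬aqb : ¬ T a q b
      ¬aqb = crossing-free ab q≢v ∘ t132

    band₅ : Strip₅ a b p q → HyperBand
    band₅ {a} {b} {p} {q} S with links (t213 (proj₁ ab)) apq (p≢v ∘ sym) (q≢v ∘ sym) (irr bpq) (irr₁₃ bpq)
      where open Strip₅ S
    ... | inj₁ avp = band₅-from S (t213 avp)
    ... | inj₂ (inj₁ avq) = band₅-from (strip₅ ab (t132 apq) (t132 bpq) q≢v p≢v) (t213 avq)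
      where open Strip₅ S
    ... | inj₂ (inj₂ (inj₁ abp)) = ⊥-elim (crossing-free (Strip₅.ab S) (Strip₅.p≢v S) abp)
    ... | inj₂ (inj₂ (inj₂ abq)) = ⊥-elim (crossing-free (Strip₅.ab S) (Strip₅.q≢v S) abq)

    record Strip₆ (a b p q r : Fin n) : Set where
      constructor strip₆
      field
        ab : Crossing a b
        apq : T a p q
        pqr : T p q r
        bqr : T b q r
        p≢v : p ≢ v
        q≢v : q ≢ v
        r≢v : r ≢ v
      v≢a = irr (proj₁ ab)
      v≢b = irr₁₃ (proj₁ ab)
      a≢b = irr₂₃ (proj₁ ab)
      ¬ab : ∀ {z} → z ≢ v → ¬ T a b z
      ¬ab = crossing-free ab
      a≢r : a ≢ r
      a≢r refl = ¬ab q≢v (t312 bqr)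
      b≢p : b ≢ p
      b≢p refl = ¬ab q≢v apq

    mirror₆ : Strip₆ a b p q r → Strip₆ b a r q p
    mirror₆ S = strip₆ (flip ab) (t132 bqr) (t321 pqr) (t132 apq) r≢v q≢v p≢v
      where open Strip₆ S

    module Without₅ (no₅ : ∀ {a b p q} → ¬ Strip₅ a b p q) where

      -- If vbq were a triangle, q would have the colour of b. `links` at q, comparing ap with vb,
      -- leaves only vpq, which passes this colour to p; `links` at a then passes it on to a.
      ¬vbq₆ : Strip₆ a b p q r → ¬ T v b q
      ¬vbq₆ {a} {b} {p} {q} {r} S vbq = case₄ no-vaq (λ t → ¬ab q≢v (t231 t)) no-qpv (λ t → ¬bpq (t321 t))
          (links (t312 apq) (t312 vbq) (v≢a ∘ sym) a≢b p≢v (b≢p ∘ sym))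
        where
        open Strip₆ S
        ¬bpq : ¬ T b p q
        ¬bpq t = no₅ (strip₅ ab apq t p≢v q≢v)
        χq : χ b ≡ χ q
        χq = colour vbq bqr r≢v
        no-vaq : ¬ T q a v
        no-vaq t = proj₂ ab (trans (colour (t321 t) (t132 apq) p≢v) (sym χq))
        no-qpv : ¬ T q p v
        no-qpv t = case₄ (λ s → proj₂ ab (trans (colour (t213 s) apq q≢v) (sym χp)))
            (λ s → proj₂ ab (trans (colour (t213 s) (t132 apq) p≢v) (sym χq)))
            (¬ab p≢v)
            (¬ab q≢v)
                   (links (t213 (proj₁ ab)) apq (p≢v ∘ sym) (q≢v ∘ sym) b≢p (irr bqr))
          where
          χp : χ b ≡ χ p
          χp = trans χq (colour (t312 t) (t321 apq) (v≢a ∘ sym))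

      vap : Strip₆ a b p q r → T v a p
      vap S = case₄ t213 (⊥-elim ∘ ¬vbq₆ (mirror₆ S) ∘ t213) (⊥-elim ∘ ¬ab p≢v) (⊥-elim ∘ ¬ab q≢v)
          (links (t213 (proj₁ ab)) apq (p≢v ∘ sym) (q≢v ∘ sym) b≢p (irr bqr))
        where open Strip₆ S

      χp₆ : Strip₆ a b p q r → χ a ≡ χ p
      χp₆ S = colour (vap S) (Strip₆.apq S) (Strip₆.q≢v S)

      -- By the mirror image of `χp₆`, r has the colour of b. So ar would be a crossing with the
      -- shorter strip apq, pqr.
      ¬var₆ : Strip₆ a b p q r → ¬ T v a r
      ¬var₆ S t = no₅ (strip₅ (t , λ e → proj₂ ab (trans e (sym (χp₆ (mirror₆ S))))) apq (t312 pqr) p≢v q≢v)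
        where open Strip₆ S

      ¬vpr₆ : Strip₆ a b p q r → ¬ T v p r
      ¬vpr₆ S t = proj₂ ab (trans (χp₆ S) (trans (colour t (t132 pqr) q≢v) (sym (χp₆ (mirror₆ S)))))
        where open Strip₆ S

      ¬apr₆ : Strip₆ a b p q r → ¬ T a p r
      ¬apr₆ S apr = case₄ (¬var₆ S ∘ t231) (¬vpr₆ S ∘ t231) (¬ab r≢v ∘ t321) (λ t → no₅ (strip₅ ab apr (t231 t) p≢v r≢v))
          (links (t312 (vap (mirror₆ S))) (t312 apr) v≢a (p≢v ∘ sym) (a≢b ∘ sym) b≢p)
        where open Strip₆ S

      ¬vpq₆ : Strip₆ a b p q r → ¬ T v p q
      ¬vpq₆ {a} {b} {p} {q} {r} S t = case₄ (¬var₆ (mirror₆ S) ∘ t132) (¬vpr₆ S) (¬vbq₆ S ∘ t132) same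
          (links t (vap (mirror₆ S)) (b≢p ∘ sym) (irr₁₃ pqr) (irr bqr ∘ sym) (irr₂₃ pqr))
        where
        open Strip₆ S
        same : ¬ T v q r
        same s = proj₂ ab (trans (χp₆ S) (trans (colour t (t231 apq) (v≢a ∘ sym)) (trans (colour s (t231 bqr) (v≢b ∘ sym)) (sym (χp₆ (mirror₆ S))))))

      band₆ : Strip₆ a b p q r → HyperBand
      band₆ {a} {b} {p} {q} {r} S = record
        { cycle = cycle₆ ; u = lookup us
        ; u-injective = lookup-injective us
            (v≢a ∷ (p≢v ∘ sym) ∷ (q≢v ∘ sym) ∷ (r≢v ∘ sym) ∷ v≢b ∷ irr apq ∷ irr₁₃ apq ∷ a≢r ∷ a≢b
              ∷ irr pqr ∷ irr₁₃ pqr ∷ (b≢p ∘ sym) ∷ irr₂₃ pqr ∷ (irr bqr ∘ sym) ∷ (irr₁₃ bqr ∘ sym) ∷ [])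
        ; consecutive = λ { zero → vap S ; (suc zero) → apq ; (suc (suc zero)) → pqr ; (suc (suc (suc zero))) → t231 bqr
                          ; (suc (suc (suc (suc zero)))) → t321 (vap M) ; (suc (suc (suc (suc (suc zero))))) → t312 (proj₁ ab) }
        ; only = windows-only (lookup us)
            ( ¬vbq₆ M ∷ ¬var₆ S ∷ ¬vpq₆ S ∷ ¬vpr₆ S ∷ ¬var₆ M ∘ t132 ∷ ¬vpq₆ M ∘ t132 ∷ ¬vbq₆ S ∘ t132
            ∷ ¬apr₆ S ∷ ¬ab p≢v ∘ t132 ∷ (λ t → no₅ (strip₅ ab t bqr q≢v r≢v)) ∷ ¬ab q≢v ∘ t132 ∷ ¬ab r≢v ∘ t132
            ∷ (λ t → no₅ (strip₅ ab apq (t312 t) p≢v q≢v)) ∷ ¬apr₆ M ∘ t321 ∷ []) }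
        where
        open Strip₆ S
        M = mirror₆ S
        us = v ∷ a ∷ p ∷ q ∷ r ∷ b ∷ []

      module Without₆ (no₆ : ∀ {a b p q r} → ¬ Strip₆ a b p q r) where

        -- If the end triangles share q, `links` at q connects them within at most three triangles.
        -- Without such strips the two ends are disjoint.
        no-shared : ∀ {a b p q r} → Crossing a b → T a p q → T b q r → p ≢ v → q ≢ v → r ≢ v → Empty.⊥
        no-shared {a} {b} {p} {q} {r} ab apq bqr p≢v q≢v r≢v with p Fin.≟ r
        ... | yes refl = no₅ (strip₅ ab apq (t132 bqr) p≢v q≢v)
        ... | no p≢r = case₄ (crossing-free ab q≢v ∘ t231)
            (λ t → no₅ (strip₅ ab (t231 t) (t132 bqr) r≢v q≢v))
            (λ t → no₅ (strip₅ ab apq (t321 t) p≢v q≢v))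
            (λ t → no₆ (strip₆ ab apq (t213 t) bqr p≢v q≢v r≢v))
            (links (t312 apq) (t213 bqr) (irr₂₃ (proj₁ ab)) (λ { refl → crossing-free ab q≢v (t312 bqr) }) (λ { refl → crossing-free ab q≢v apq }) p≢r)

        record Strip₇ (a b p q r s : Fin n) : Set where
          constructor strip₇
          field
            ab : Crossing a b
            apq : T a p q
            pqr : T p q r
            qrs : T q r s
            brs : T b r s
            p≢v : p ≢ v
            q≢v : q ≢ v
            r≢v : r ≢ v
            s≢v : s ≢ v
          v≢a = irr (proj₁ ab)
          v≢b = irr₁₃ (proj₁ ab)
          a≢b = irr₂₃ (proj₁ ab)
          ¬ab : ∀ {z} → z ≢ v → ¬ T a b z
          ¬ab = crossing-free ab
          ¬ar : ∀ {x} → x ≢ v → ¬ T a x r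
          ¬ar x≢v t = no-shared ab t brs x≢v r≢v s≢v
          ¬as : ∀ {x} → x ≢ v → ¬ T a x s
          ¬as x≢v t = no-shared ab t (t132 brs) x≢v s≢v r≢v
          ¬bp : ∀ {x} → x ≢ v → ¬ T b x p
          ¬bp x≢v t = no-shared (flip ab) t apq x≢v p≢v q≢v
          ¬bq : ∀ {x} → x ≢ v → ¬ T b x q
          ¬bq x≢v t = no-shared (flip ab) t (t132 apq) x≢v q≢v p≢v
          a≢r : a ≢ r
          a≢r refl = ¬ab s≢v (t213 brs)
          a≢s : a ≢ s
          a≢s refl = ¬ab r≢v (t312 brs)
          b≢p : b ≢ p
          b≢p refl = ¬ab q≢v apq
          b≢q : b ≢ q
          b≢q refl = ¬ab p≢v (t132 apq)
          p≢s : p ≢ s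
          p≢s refl = ¬as q≢v (t132 apq)

        mirror₇ : Strip₇ a b p q r s → Strip₇ b a s r q p
        mirror₇ S = strip₇ (flip ab) (t132 brs) (t321 qrs) (t321 pqr) (t132 apq) s≢v r≢v q≢v p≢v
          where open Strip₇ S

        b-end : Strip₇ a b p q r s → T v b r ⊎ T v b s
        b-end S = case₄ (inj₁ ∘ t213) (inj₂ ∘ t213) (⊥-elim ∘ ¬ab r≢v ∘ t213) (⊥-elim ∘ ¬ab s≢v ∘ t213)
            (links (t312 (proj₁ ab)) brs (r≢v ∘ sym) (s≢v ∘ sym) a≢r a≢s)
          where open Strip₇ S

        -- `b-end` leaves open which of r and s is adjacent to b in the link of v, but through brs
        -- that vertex gets the colour of b.
        χ-end : Strip₇ a b p q r s → ¬ (χ r ≡ χ a × χ s ≡ χ a)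
        χ-end S (er , es) = [ (λ t → proj₂ ab (sym (trans (colour t brs s≢v) er)))
                            , (λ t → proj₂ ab (sym (trans (colour t (t132 brs) r≢v) es))) ]′ (b-end S)
          where open Strip₇ S

        -- If a and r differ in colour, ar is a crossing with the strip apq, pqr. Otherwise `links`
        -- at r, comparing va with bs, spreads the colour of a to b or to both r and s. The same
        -- argument serves for `¬vas₇`.
        ¬var₇ : Strip₇ a b p q r s → ¬ T v a r
        ¬var₇ {a} {b} {p} {q} {r} {s} S var with χ a Data.Bool.≟ χ r
          where open Strip₇ S
        ... | no a≁r = no₅ (strip₅ (var , a≁r) apq (t312 pqr) p≢v q≢v)
          where open Strip₇ S
        ... | yes a~r = case₄ (b≁r ∘ t321 ∘ t132) r-s (¬ab r≢v ∘ t231) (¬as r≢v ∘ t213)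
            (links (t312 var) (t213 brs) v≢b (s≢v ∘ sym) a≢b a≢s)
          where
          open Strip₇ S
          b≁r : ¬ T v b r
          b≁r t = proj₂ ab (trans a~r (sym (colour t brs s≢v)))
          r-s : ¬ T r v s
          r-s t = χ-end S (sym a~r , trans (sym (colour (t213 t) (t231 brs) (v≢b ∘ sym))) (sym a~r))

        ¬vas₇ : Strip₇ a b p q r s → ¬ T v a s
        ¬vas₇ {a} {b} {p} {q} {r} {s} S vas with χ a Data.Bool.≟ χ s
        ... | no a≁s = no-shared (vas , a≁s) apq (t312 qrs) p≢v q≢v r≢v
          where open Strip₇ S
        ... | yes a~s = case₄ (λ t → proj₂ ab (trans a~s (sym (colour (t231 t) (t132 brs) r≢v))))
            s-r
            (¬ab s≢v ∘ t231)
            (¬ar s≢v ∘ t213)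
            (links (t312 vas) (t312 brs) v≢b (r≢v ∘ sym) a≢b a≢r)
          where
          open Strip₇ S
          s-r : ¬ T s v r
          s-r t = χ-end S (trans (sym (colour (t213 t) (t321 brs) (v≢b ∘ sym))) (sym a~s) , sym a~s)

        -- If vaq were a triangle, q would have the colour of a, and `links` at q would pass it to r
        -- or s. Then b is adjacent in the link of v to the other of these two, and `links` at v,
        -- comparing the two link edges, always yields a clash of colours or the excluded vbq.
        ¬vaq₇ : Strip₇ a b p q r s → ¬ T v a q
        ¬vaq₇ {a} {b} {p} {q} {r} {s} S vaq = case₄ (vqr ∘ t213) (vqs ∘ t213) (¬ar q≢v ∘ t213) (¬as q≢v ∘ t213)
            (links (t312 vaq) qrs (r≢v ∘ sym) (s≢v ∘ sym) a≢r a≢s)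
          where
          open Strip₇ S
          ¬vbq : ¬ T v b q
          ¬vbq = ¬var₇ (mirror₇ S)
          χq : χ a ≡ χ q
          χq = colour vaq (t132 apq) p≢v
          vqr : ¬ T v q r
          vqr t = case₄ (¬vbq ∘ t132)
              (λ t′ → χ-end S (er , trans (sym (colour t′ (t132 qrs) r≢v)) (sym χq)) )
              (λ t′ → proj₂ ab (trans (sym er) (colour t′ (t213 brs) s≢v)))
              (λ t′ → χ-end S (er , trans (sym (colour t′ (t231 brs) (v≢b ∘ sym))) er))
              (links t vbs (b≢q ∘ sym) (irr₁₃ qrs) (irr brs ∘ sym) (irr₂₃ brs))
            where
            er : χ r ≡ χ a
            er = sym (trans χq (colour t qrs s≢v))
            vbs : T v b s
            vbs = [ (λ t′ → ⊥-elim (proj₂ ab (trans (sym er) (sym (colour t′ brs s≢v))))) , id ]′ (b-end S)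
          vqs : ¬ T v q s
          vqs t = case₄ (¬vbq ∘ t132)
              (λ t′ → χ-end S (trans (sym (colour t′ qrs s≢v)) (sym χq) , es) )
              (λ t′ → proj₂ ab (trans (sym es) (colour t′ (t312 brs) r≢v)))
              (λ t′ → χ-end S (trans (sym (colour t′ (t321 brs) (v≢b ∘ sym))) es , es))
              (links t vbr (b≢q ∘ sym) (irr qrs) (irr₁₃ brs ∘ sym) (irr₂₃ brs ∘ sym))
            where
            es : χ s ≡ χ a
            es = sym (trans χq (colour t (t132 qrs) r≢v))
            vbr : T v b r
            vbr = [ id , (λ t′ → ⊥-elim (proj₂ ab (trans (sym es) (sym (colour t′ (t132 brs) r≢v))))) ]′ (b-end S)

        vbs₇ : Strip₇ a b p q r s → T v b s
        vbs₇ S = [ ⊥-elim ∘ ¬vaq₇ (mirror₇ S) , id ]′ (b-end S)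

        χs₇ : Strip₇ a b p q r s → χ b ≡ χ s
        χs₇ S = colour (vbs₇ S) (t132 (Strip₇.brs S)) (Strip₇.r≢v S)

        ¬vps₇ : Strip₇ a b p q r s → ¬ T v p s
        ¬vps₇ S t = no₅ (strip₅ (t , (λ e → proj₂ ab (trans (χs₇ (mirror₇ S)) (trans e (sym (χs₇ S)))))) pqr (t312 qrs) q≢v r≢v)
          where open Strip₇ S

        ¬vpr₇ : Strip₇ a b p q r s → ¬ T v p r
        ¬vpr₇ {a} {b} {p} {q} {r} {s} S t = case₄ (¬vas₇ (mirror₇ S) ∘ t132) (¬vps₇ S) (¬vaq₇ (mirror₇ S) ∘ t132) r-s
            (links t (vbs₇ S) (b≢p ∘ sym) p≢s (irr brs ∘ sym) (irr₂₃ brs))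
          where
          open Strip₇ S
          r-s : ¬ T v r s
          r-s t′ = proj₂ ab (trans (χs₇ (mirror₇ S)) (trans (colour t (t132 pqr) q≢v) (trans (colour t′ (t231 brs) (v≢b ∘ sym)) (sym (χs₇ S)))))

        ¬vpq₇ : Strip₇ a b p q r s → ¬ T v p q
        ¬vpq₇ S t = case₄ (¬vas₇ (mirror₇ S) ∘ t132) (¬vps₇ S) (¬var₇ (mirror₇ S) ∘ t132) (¬vpr₇ (mirror₇ S) ∘ t132)
            (links t (vbs₇ S) (b≢p ∘ sym) p≢s (b≢q ∘ sym) (irr₁₃ qrs))
          where open Strip₇ S

        ¬vqr₇ : Strip₇ a b p q r s → ¬ T v q r
        ¬vqr₇ S t = case₄ (¬vaq₇ S ∘ t132) (¬var₇ (mirror₇ S) ∘ t132) (¬var₇ S ∘ t132) (¬vaq₇ (mirror₇ S) ∘ t132)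
            (links t (proj₁ ab) (irr₁₃ apq ∘ sym) (b≢q ∘ sym) (a≢r ∘ sym) (irr brs ∘ sym))
          where open Strip₇ S

        ¬pqs₇ : Strip₇ a b p q r s → ¬ T p q s
        ¬pqs₇ S t = case₄ (¬vps₇ S ∘ t231) (¬vpr₇ (mirror₇ S) ∘ t213) (¬bp s≢v ∘ t213) (¬bq s≢v ∘ t213)
            (links (t312 (vbs₇ S)) (t312 t) (p≢v ∘ sym) (q≢v ∘ sym) b≢p b≢q)
          where open Strip₇ S

        band₇ : Strip₇ a b p q r s → HyperBand
        band₇ {a} {b} {p} {q} {r} {s} S = record
          { cycle = cycle₇ ; u = lookup us
          ; u-injective = lookup-injective us
              ( v≢a ∷ (p≢v ∘ sym) ∷ (q≢v ∘ sym) ∷ (r≢v ∘ sym) ∷ (s≢v ∘ sym) ∷ v≢b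
              ∷ irr apq ∷ irr₁₃ apq ∷ a≢r ∷ a≢s ∷ a≢b
              ∷ irr pqr ∷ irr₁₃ pqr ∷ p≢s ∷ (b≢p ∘ sym)
              ∷ irr qrs ∷ irr₁₃ qrs ∷ (b≢q ∘ sym)
              ∷ irr₂₃ brs ∷ (irr brs ∘ sym) ∷ (irr₁₃ brs ∘ sym) ∷ [])
          ; consecutive = λ { zero → vbs₇ M ; (suc zero) → apq ; (suc (suc zero)) → pqr ; (suc (suc (suc zero))) → qrs
                            ; (suc (suc (suc (suc zero)))) → t231 brs ; (suc (suc (suc (suc (suc zero))))) → t321 (vbs₇ S)
                            ; (suc (suc (suc (suc (suc (suc zero)))))) → t312 (proj₁ ab) }
          ; only = windows-only (lookup us)
              ( ¬vaq₇ S ∷ ¬var₇ S ∷ ¬vas₇ S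
              ∷ ¬vpq₇ S ∷ ¬vpr₇ S ∷ ¬vps₇ S ∷ ¬vas₇ M ∘ t132
              ∷ ¬vqr₇ S ∷ ¬vpr₇ M ∘ t132 ∷ ¬var₇ M ∘ t132
              ∷ ¬vpq₇ M ∘ t132 ∷ ¬vaq₇ M ∘ t132
              ∷ ¬ar p≢v ∷ ¬as p≢v ∷ ¬ab p≢v ∘ t132
              ∷ ¬ar q≢v ∷ ¬as q≢v ∷ ¬ab q≢v ∘ t132
              ∷ ¬as r≢v ∷ ¬ab r≢v ∘ t132 ∷ ¬ab s≢v ∘ t132
              ∷ ¬pqs₇ S ∷ ¬bq p≢v ∘ t321 ∘ t213
              ∷ ¬pqs₇ M ∘ t321 ∷ ¬bp r≢v ∘ t321 ∷ ¬bp s≢v ∘ t321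
              ∷ ¬bq r≢v ∘ t321 ∷ ¬bq s≢v ∘ t321 ∷ []) }
          where
          open Strip₇ S
          M = mirror₇ S
          us = v ∷ a ∷ p ∷ q ∷ r ∷ s ∷ b ∷ []

        -- Triangles at both ends of a crossing, not yet joined by a strip. With strips of two and
        -- three triangles excluded they are disjoint, so `Mixing` applies to them.
        record Ends (a b p q r s : Fin n) : Set where
          constructor ends
          field
            ab : Crossing a b
            apq : T a p q
            brs : T b r s
            p≢v : p ≢ v
            q≢v : q ≢ v
            r≢v : r ≢ v
            s≢v : s ≢ v

          none : ∀ {y z} → T a y z → y ≢ v → z ≡ b ⊎ z ≡ r ⊎ z ≡ s → Empty.⊥
          none t y≢v (inj₁ refl) = crossing-free ab y≢v (t132 t)
          none t y≢v (inj₂ (inj₁ refl)) = no-shared ab t brs y≢v r≢v s≢v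
          none t y≢v (inj₂ (inj₂ refl)) = no-shared ab t (t132 brs) y≢v s≢v r≢v

        swapEnds : Ends a b p q r s → Ends b a r s p q
        swapEnds E = ends (flip ab) brs apq r≢v s≢v p≢v q≢v
          where open Ends E

        swapRight : Ends a b p q r s → Ends a b p q s r
        swapRight E = ends ab apq (t132 brs) p≢v q≢v s≢v r≢v
          where open Ends E

        ends-disjoint : Ends a b p q r s → ∀ {x} → x ≡ a ⊎ x ≡ p ⊎ x ≡ q → ¬ (x ≡ b ⊎ x ≡ r ⊎ x ≡ s)
        ends-disjoint E (inj₁ refl) (inj₁ e) = irr₂₃ (proj₁ ab) e
          where open Ends E
        ends-disjoint E (inj₁ refl) (inj₂ (inj₁ refl)) = crossing-free ab s≢v (t213 brs)
          where open Ends E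
        ends-disjoint E (inj₁ refl) (inj₂ (inj₂ refl)) = crossing-free ab r≢v (t312 brs)
          where open Ends E
        ends-disjoint E (inj₂ (inj₁ refl)) h = Ends.none E (t132 apq) q≢v h
          where open Ends E
        ends-disjoint E (inj₂ (inj₂ refl)) h = Ends.none E apq p≢v h
          where open Ends E

        -- `links` at r, comparing pq with bs, supplies the missing fourth triangle, qrs or prs.
        bridge : Ends a b p q r s → T p q r → HyperBand
        bridge E pqr = case₄ (λ t → ⊥-elim (Ends.none (swapEnds E) (t312 t) r≢v (inj₂ (inj₁ refl))))
            (λ t → band₇ (strip₇ ab (t132 apq) (t213 pqr) (t213 t) brs q≢v p≢v r≢v s≢v))
            (λ t → ⊥-elim (Ends.none (swapEnds E) (t312 t) r≢v (inj₂ (inj₂ refl))))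
            (λ t → band₇ (strip₇ ab apq pqr (t213 t) brs p≢v q≢v r≢v s≢v))
            (links (t312 pqr) (t213 brs) (λ e → dis (inj₂ (inj₁ refl)) (inj₁ e)) (λ e → dis (inj₂ (inj₁ refl)) (inj₂ (inj₂ e)))
              (λ e → dis (inj₂ (inj₂ refl)) (inj₁ e)) (λ e → dis (inj₂ (inj₂ refl)) (inj₂ (inj₂ e))))
          where
          open Ends E
          dis = ends-disjoint E

        ridge : ∀ {a b p q r s z} → Ends a b p q r s → T p q z → z ≡ b ⊎ z ≡ r ⊎ z ≡ s → HyperBand
        ridge E t (inj₁ refl) = ⊥-elim (Ends.none (swapEnds E) (t312 t) (Ends.p≢v E) (inj₂ (inj₂ refl)))
        ridge E t (inj₂ (inj₁ refl)) = bridge E t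
        ridge E t (inj₂ (inj₂ refl)) = bridge (swapRight E) t

        both : ∀ {a b p q r s x y z} → Ends a b p q r s → T x y z →
          x ≡ a ⊎ x ≡ p ⊎ x ≡ q → y ≡ a ⊎ y ≡ p ⊎ y ≡ q → z ≡ b ⊎ z ≡ r ⊎ z ≡ s → HyperBand
        both E t (inj₁ refl) (inj₁ refl) _ = ⊥-elim (irr t refl)
        both E t (inj₁ refl) (inj₂ (inj₁ refl)) hz = ⊥-elim (Ends.none E t (Ends.p≢v E) hz)
        both E t (inj₁ refl) (inj₂ (inj₂ refl)) hz = ⊥-elim (Ends.none E t (Ends.q≢v E) hz)
        both E t (inj₂ (inj₁ refl)) (inj₁ refl) hz = ⊥-elim (Ends.none E (t213 t) (Ends.p≢v E) hz)
        both E t (inj₂ (inj₂ refl)) (inj₁ refl) hz = ⊥-elim (Ends.none E (t213 t) (Ends.q≢v E) hz)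
        both E t (inj₂ (inj₁ refl)) (inj₂ (inj₁ refl)) _ = ⊥-elim (irr t refl)
        both E t (inj₂ (inj₂ refl)) (inj₂ (inj₂ refl)) _ = ⊥-elim (irr t refl)
        both E t (inj₂ (inj₁ refl)) (inj₂ (inj₂ refl)) hz = ridge E t hz
        both E t (inj₂ (inj₂ refl)) (inj₂ (inj₁ refl)) hz = ridge E (t213 t) hz

    crossing? : ∀ a b → Dec (Crossing a b)
    crossing? a b = T? v a b ×-dec ¬? (χ a Data.Bool.≟ χ b)

    _≢?v : ∀ p → Dec (p ≢ v)
    p ≢?v = ¬? (p Fin.≟ v)

    strip₅? : ∀ a b p q → Dec (Strip₅ a b p q)
    strip₅? a b p q = map′ (λ (w , x , y , z , t) → strip₅ w x y z t)
      (λ S → let open Strip₅ S in ab , apq , bpq , p≢v , q≢v)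
      (crossing? a b ×-dec T? a p q ×-dec T? b p q ×-dec p ≢?v ×-dec q ≢?v)

    strip₆? : ∀ a b p q r → Dec (Strip₆ a b p q r)
    strip₆? a b p q r = map′ (λ (w , x , y , z , t , t′ , t″) → strip₆ w x y z t t′ t″)
      (λ S → let open Strip₆ S in ab , apq , pqr , bqr , p≢v , q≢v , r≢v)
      (crossing? a b ×-dec T? a p q ×-dec T? p q r ×-dec T? b q r ×-dec p ≢?v ×-dec q ≢?v ×-dec r ≢?v)

    -- The searches range over all crossings of v, so after a failure no crossing has a strip of
    -- that length. After two failures `Mixing` gives a triangle with two vertices in one end and
    -- one in the other, and `both` extends it to a strip of four or refutes it.
    crossing⇒band : Mixing → ∀ {a b p q r s} → Crossing a b → T a p q → p ≢ v → q ≢ v → T b r s → r ≢ v → s ≢ v → HyperBand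
    crossing⇒band mixing ab apq p≢v q≢v brs r≢v s≢v
      with any? (λ a → any? (λ b → any? (λ p → any? (λ q → strip₅? a b p q))))
    ... | yes (_ , _ , _ , _ , S) = band₅ S
    ... | no ¬S with any? (λ a → any? (λ b → any? (λ p → any? (λ q → any? (λ r → strip₆? a b p q r)))))
    ...   | yes (_ , _ , _ , _ , _ , S) = Without₅.band₆ (λ S → ¬S (_ , _ , _ , _ , S)) S
    ...   | no ¬S₆ = through (mixing apq brs (ends-disjoint E))
      where
      open Without₅ (λ S → ¬S (_ , _ , _ , _ , S))
      open Without₆ (λ S → ¬S₆ (_ , _ , _ , _ , _ , S))
      E : Ends _ _ _ _ _ _
      E = ends ab apq brs p≢v q≢v r≢v s≢v
      through : _ → HyperBand
      through (x , y , z , t , hx , hz , inj₁ hy) = both E t hx hy hz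
      through (x , y , z , t , hx , hz , inj₂ hy) = both (swapEnds E) (t321 t) hz hy hx

  -- Splitting vertices

  EdgeAvoiding : Fin n → Fin n → Fin n → Set
  EdgeAvoiding v x y = ∃[ z ] (z ≢ v × T x y z)

  VertexAvoiding : Fin n → Fin n → Set
  VertexAvoiding v x = ∃[ y ] ∃[ z ] (y ≢ v × z ≢ v × T x y z)

  LinkVertex : Fin n → Fin n → Set
  LinkVertex v x = (∃[ y ] T v x y) × VertexAvoiding v x

  -- χ disconnects the intersection of the link of v with the deletion of v.
  Split : Fin n → (Fin n → Bool) → Set
  Split v χ = (∀ x y → T v x y → EdgeAvoiding v x y → χ x ≡ χ y) ×
    ∃[ a ] ∃[ b ] (LinkVertex v a × LinkVertex v b × χ a ≢ χ b)

  edgeAvoiding? : ∀ v x y → Dec (EdgeAvoiding v x y)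
  edgeAvoiding? v x y = any? λ z → ¬? (z Fin.≟ v) ×-dec T? x y z

  vertexAvoiding? : ∀ v x → Dec (VertexAvoiding v x)
  vertexAvoiding? v x = any? λ y → any? λ z → ¬? (y Fin.≟ v) ×-dec ¬? (z Fin.≟ v) ×-dec T? x y z

  onTriangle? : ∀ v → Dec (∃[ x ] ∃[ y ] T v x y)
  onTriangle? v = any? λ x → any? λ y → T? v x y

  linkVertex? : ∀ v x → Dec (LinkVertex v x)
  linkVertex? v x = (any? λ y → T? v x y) ×-dec vertexAvoiding? v x

  split? : ∀ v χ → Dec (Split v χ)
  split? v χ = (all? λ x → all? λ y → T? v x y →-dec (edgeAvoiding? v x y →-dec (χ x Data.Bool.≟ χ y)))
    ×-dec (any? λ a → any? λ b → linkVertex? v a ×-dec linkVertex? v b ×-dec ¬? (χ a Data.Bool.≟ χ b))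

  -- Colourings are coded as subsets so that their existence can be decided by search.
  IsSplit : Fin n → Set
  IsSplit v = ∃[ s ] Split v (lookup s)

  -- If every triangle on y contains v, then all survivors in the link of y are joined to v.
  unsplit-neighbour : ∀ {v y} → (∃[ x ] T v y x) → ¬ VertexAvoiding v y → ¬ IsSplit y
  unsplit-neighbour {v} {y} _ ¬avoid (s , const , a , b , La , Lb , a≁b) = a≁b (trans (like-v La) (sym (like-v Lb)))
    where
    third : ∀ {p q} → T y p q → p ≢ v → q ≡ v
    third {p} {q} t p≢v = decidable-stable (q Fin.≟ v) λ q≢v → ¬avoid (p , q , p≢v , q≢v , t)
    like-v : ∀ {a} → LinkVertex y a → lookup s a ≡ lookup s v
    like-v {a} ((c , t) , p , q , p≢y , q≢y , t′) with a Fin.≟ v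
    ... | yes refl = refl
    ... | no a≢v with refl ← third t a≢v = const a v t (joined (p Fin.≟ v) (q Fin.≟ v))
      where
      joined : Dec (p ≡ v) → Dec (q ≡ v) → EdgeAvoiding y a v
      joined (yes refl) _ = q , q≢y , t′
      joined (no _) (yes refl) = p , p≢y , t132 t′
      joined (no p≢v) (no q≢v) = case₄ (λ r → p , p≢y , r) (λ r → q , q≢y , r) (escape p≢v) (escape q≢v)
        (links (t231 t) t′ (p≢v ∘ sym) (q≢v ∘ sym) (p≢y ∘ sym) (q≢y ∘ sym))
        where
        escape : ∀ {z} → z ≢ v → T a y z → EdgeAvoiding y a v
        escape z≢v r = ⊥-elim (z≢v (third (t213 r) a≢v))

  module _ (mixing : Mixing) where

    -- The differently coloured a and b need not be adjacent in the link of v. But `links` at v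
    -- joins an edge at a to an edge at b, so some link edge changes colour, and `survive` provides
    -- triangles avoiding v at its ends.
    split⇒band : ∀ {v} → (∀ y → (∃[ x ] T v y x) → VertexAvoiding v y) → IsSplit v → HyperBand
    split⇒band {v} survive (s , const , a , b , ((a′ , ta) , _) , ((b′ , tb) , _) , a≁b) =
      finish (lookup s a Data.Bool.≟ lookup s a′) (lookup s b Data.Bool.≟ lookup s b′)
      where
      colour : ∀ {x y z} → T v x y → T x y z → z ≢ v → lookup s x ≡ lookup s y
      colour t t′ z≢v = const _ _ t (_ , z≢v , t′)
      band : ∀ {x y} → T v x y → lookup s x ≢ lookup s y → HyperBand
      band {x} {y} t x≁y with survive x (y , t) | survive y (x , t132 t)
      ... | p , q , p≢v , q≢v , tx | r , w , r≢v , w≢v , ty =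
        crossing⇒band v (lookup s) colour mixing (t , x≁y) tx p≢v q≢v ty r≢v w≢v
      finish : Dec (lookup s a ≡ lookup s a′) → Dec (lookup s b ≡ lookup s b′) → HyperBand
      finish (no a≁a′) _ = band ta a≁a′
      finish (yes _) (no b≁b′) = band tb b≁b′
      finish (yes ea) (yes eb) = case₄ (λ t → band t a≁b) (λ t → band t a≁b′) (λ t → band t a′≁b) (λ t → band t a′≁b′)
        (links ta tb (λ { refl → a≁b refl }) (λ { refl → a≁b′ refl }) (λ { refl → a′≁b refl }) (λ { refl → a′≁b′ refl }))
        where
        a≁b′ : lookup s a ≢ lookup s b′
        a≁b′ e = a≁b (trans e (sym eb))
        a′≁b : lookup s a′ ≢ lookup s b
        a′≁b e = a≁b (trans ea e)
        a′≁b′ : lookup s a′ ≢ lookup s b′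
        a′≁b′ e = a≁b (trans ea (trans e (sym eb)))

    -- If every vertex on a triangle is split, then by `unsplit-neighbour` each neighbour of x keeps
    -- a triangle when x is deleted, which is the hypothesis of `split⇒band`.
    unsplit-or-band : ∀ {x y z} → T x y z → HyperBand ⊎ ∃[ v ] ((∃[ a ] ∃[ b ] T v a b) × ¬ IsSplit v)
    unsplit-or-band {x} {y} {z} t with any? (λ v → onTriangle? v ×-dec ¬? (anySubset? (λ s → split? v (lookup s))))
    ... | yes w = inj₂ w
    ... | no ¬w = inj₁ (split⇒band
        (λ y′ h → decidable-stable (vertexAvoiding? x y′) λ ¬avoid → ¬w (y′ , (_ , _ , t213 (proj₂ h)) , unsplit-neighbour h ¬avoid))
        (decidable-stable (anySubset? (λ s → split? x (lookup s))) λ ¬split → ¬w (x , (_ , _ , t) , ¬split)))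

    -- Supplies the first triangle of a star. If link and deletion of v had no common vertex, vxy
    -- and pqr would be disjoint and `Mixing` would produce one. From a common vertex a, `links` at
    -- a leads to a common edge.
    linkEdge : ∀ {v x y p q r} → T v x y → T p q r → p ≢ v → q ≢ v → r ≢ v → ∃[ a ] ∃[ b ] (T v a b × EdgeAvoiding v a b)
    linkEdge {v} {x} {y} {p} {q} {r} t t′ p≢v q≢v r≢v with any? (linkVertex? v)
    ... | yes (a , (b , tab) , c , d , c≢v , d≢v , tcd) with b Fin.≟ c | b Fin.≟ d
    ...   | yes refl | _ = a , b , tab , d , d≢v , tcd
    ...   | no _ | yes refl = a , b , tab , c , c≢v , t132 tcd
    ...   | no b≢c | no b≢d = case₄ (λ s → a , c , t213 s , d , d≢v , tcd)
        (λ s → a , d , t213 s , c , c≢v , t132 tcd)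
        (λ s → a , b , tab , c , c≢v , s)
        (λ s → a , b , tab , d , d≢v , s)
        (links (t213 tab) tcd (c≢v ∘ sym) (d≢v ∘ sym) b≢c b≢d)
    linkEdge {v} {x} {y} {p} {q} {r} t t′ p≢v q≢v r≢v | no ¬L = ⊥-elim (absurd (mixing t t′ disjoint))
      where
      avoids : ∀ {z} → z ≡ p ⊎ z ≡ q ⊎ z ≡ r → VertexAvoiding v z × z ≢ v
      avoids (inj₁ refl) = (q , r , q≢v , r≢v , t′) , p≢v
      avoids (inj₂ (inj₁ refl)) = (p , r , p≢v , r≢v , t213 t′) , q≢v
      avoids (inj₂ (inj₂ refl)) = (p , q , p≢v , q≢v , t312 t′) , r≢v
      disjoint : ∀ {z} → z ≡ v ⊎ z ≡ x ⊎ z ≡ y → ¬ (z ≡ p ⊎ z ≡ q ⊎ z ≡ r)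
      disjoint (inj₁ refl) h = proj₂ (avoids h) refl
      disjoint (inj₂ (inj₁ refl)) h = ¬L (_ , (y , t) , proj₁ (avoids h))
      disjoint (inj₂ (inj₂ refl)) h = ¬L (_ , (x , t132 t) , proj₁ (avoids h))
      absurd : ¬ _
      absurd (a , b , c , s , inj₁ refl , hc , _) = ¬L (c , (b , t132 s) , proj₁ (avoids hc))
      absurd (a , b , c , s , inj₂ ha , hc , _) with b Fin.≟ v
      ... | yes refl = ¬L (c , (a , t132 (t213 s)) , proj₁ (avoids hc))
      ... | no b≢v = ¬L (a , link ha , b , c , b≢v , proj₂ (avoids hc) , s)
        where
        link : a ≡ x ⊎ a ≡ y → ∃[ z ] T v a z
        link (inj₁ refl) = y , t
        link (inj₂ refl) = x , t132 t

-- Construction of shellings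

delete : ∀ {A : Set} {x : A} (xs : List A) → x ∈ₗ xs →
  ∃[ ys ] (length xs ≡ suc (length ys) × (∀ {y} → y ∈ₗ xs → y ≡ x ⊎ y ∈ₗ ys))
delete (x ∷ xs) (here refl) = xs , refl , λ { (here e) → inj₁ e ; (there h) → inj₂ h }
delete (x ∷ xs) (there i) = let ys , e , f = delete xs i in
  x ∷ ys , cong suc e , λ { (here refl) → inj₂ (here refl) ; (there h) → [ inj₁ , inj₂ ∘ there ]′ (f h) }

_∈ₗ?_ : ∀ (σ : Subset n) l → Dec (σ ∈ₗ l)
σ ∈ₗ? l = Any.any? (σ ≟ₛ_) l

record Stage {n} (pre todo full : List (Subset n)) : Set where
  field
    shelled : Shelled full
    extends : ∀ {σ} → σ ∈ₗ pre → σ ∈ₗ full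
    within : ∀ {σ} → σ ∈ₗ full → σ ∈ₗ pre ⊎ σ ∈ₗ todo

Missing Attachable : List (Subset n) → List (Subset n) → Set
Missing todo full = ∃[ σ ] (σ ∈ₗ todo × σ ∉ₗ full)
Attachable todo full = ∃[ σ ] (σ ∈ₗ todo × ¬ Cov full σ × Attach full σ)

-- `rem` bounds the number of rounds: an attached face must still be in it, since a face already in
-- `full` would be covered.
greedy : ∀ {pre todo : List (Subset n)} → Shelled pre →
  (∀ full → Stage pre todo full → Missing todo full → Attachable todo full) →
  ∃[ full ] (Stage pre todo full × (∀ {σ} → σ ∈ₗ todo → σ ∈ₗ full))
greedy {n} {pre} {todo} shelled-pre next =
  go (length todo) todo pre refl (record { shelled = shelled-pre ; extends = id ; within = inj₁ }) inj₂
  where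
  go : ∀ k rem full → length rem ≡ k → Stage pre todo full → (∀ {σ} → σ ∈ₗ todo → σ ∈ₗ full ⊎ σ ∈ₗ rem) →
    ∃[ full ] (Stage pre todo full × (∀ {σ} → σ ∈ₗ todo → σ ∈ₗ full))
  go k rem full e S left with Any.any? (λ σ → ¬? (σ ∈ₗ? full)) todo
  ... | no none = full , S , λ {σ} i → decidable-stable (σ ∈ₗ? full) λ σ∉ → none (LM.lose i σ∉)
  ... | yes some with next full S (let σ , i , σ∉ = LM.find some in σ , i , σ∉)
  ... | σ , σ∈todo , fresh , attach with left σ∈todo
  ...   | inj₁ σ∈full = ⊥-elim (fresh (∈⇒Cov σ∈full id))
  ...   | inj₂ σ∈rem with delete rem σ∈rem | k | e
  ...     | rem′ , e′ , f | zero | z with () ← trans (sym z) e′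
  ...     | rem′ , e′ , f | suc k | z = go k rem′ (σ ∷ full) (ℕₚ.suc-injective (trans (sym e′) z))
    (record { shelled = add fresh attach shelled ; extends = there ∘ extends
            ; within = λ { (here refl) → inj₂ σ∈todo ; (there i) → within i } })
    λ i → [ inj₁ ∘ there , (λ j → [ inj₁ ∘ here , inj₂ ]′ (f j)) ]′ (left i)
    where open Stage S

Cov-pair : ∀ {l : List (Subset n)} {σ x y} → σ ∈ₗ l → x ∈ σ → y ∈ σ → Cov l (pair x y)
Cov-pair i hx hy = ∈⇒Cov i (pair-⊆ hx hy)

triple-del₁ : ∀ {x y z : Fin n} {p} → y ∈ p → z ∈ p → triple x y z - x ⊆ p
triple-del₁ {x = x} {y} {z} hy hz h with ∈-triple⁻ (∈-del⁻ h)
... | inj₁ refl = ⊥-elim (∈-del≢ h refl)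
... | inj₂ (inj₁ refl) = hy
... | inj₂ (inj₂ refl) = hz

triple-del₂ : ∀ {x y z : Fin n} {p} → x ∈ p → z ∈ p → triple x y z - y ⊆ p
triple-del₂ {x = x} {y} {z} hx hz h with ∈-triple⁻ (∈-del⁻ h)
... | inj₁ refl = hx
... | inj₂ (inj₁ refl) = ⊥-elim (∈-del≢ h refl)
... | inj₂ (inj₂ refl) = hz

triple-del₃ : ∀ {x y z : Fin n} {p} → x ∈ p → y ∈ p → triple x y z - z ⊆ p
triple-del₃ {x = x} {y} {z} hx hy h with ∈-triple⁻ (∈-del⁻ h)
... | inj₁ refl = hx
... | inj₂ (inj₁ refl) = hy
... | inj₂ (inj₂ refl) = ⊥-elim (∈-del≢ h refl)

-- With the edge xy covered, the intersection can fail to be pure only if z is an isolated point of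
-- it, and this is what the second hypothesis excludes.
attach-triple : ∀ {pre : List (Subset n)} {x y z} → Cov pre (pair x y) → (Cov pre ⁅ z ⁆ → Cov pre (pair x z) ⊎ Cov pre (pair y z)) →
  ¬ Cov pre (triple x y z) → Attach pre (triple x y z)
attach-triple {n} {pre} {x} {y} {z} xy z-ok fresh η η⊆ c with z ∈? η
... | no z∉η = z , ∈-triple₃ , z∉η , Cov-⊆ (triple-del₃ ∈-pairˡ ∈-pairʳ) xy
... | yes z∈η with z-ok (Cov-⊆ (⁅⁆⊆ z∈η) c) | x ∈? η | y ∈? η
...   | _ | yes x∈η | yes y∈η = ⊥-elim (fresh (Cov-⊆ (triple-⊆ x∈η y∈η z∈η) c))
...   | inj₁ xz | _ | no y∉η = y , ∈-triple₂ , y∉η , Cov-⊆ (triple-del₂ ∈-pairˡ ∈-pairʳ) xz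
...   | inj₂ yz | no x∉η | _ = x , ∈-triple₁ , x∉η , Cov-⊆ (triple-del₁ ∈-pairˡ ∈-pairʳ) yz
...   | inj₁ xz | no x∉η | yes y∈η = x , ∈-triple₁ , x∉η , Cov-⊆ (triple-del₁ y∈η z∈η) c
...   | inj₂ yz | yes x∈η | no y∉η = y , ∈-triple₂ , y∉η , Cov-⊆ (triple-del₂ x∈η z∈η) c

size-3 : ∀ {σ : Subset n} {v} → ∣ σ ∣ ≡ 3 → v ∈ σ → ∃[ a ] ∃[ b ] (v ≢ a × a ≢ b × v ≢ b × σ ≡ triple v a b)
size-3 {n} {σ} {v} e v∈ with nonempty {p = σ - v} (ℕₚ.suc-injective (trans (∣-del∣ {p = σ} v∈) e))
... | a , a∈ with nonempty {p = (σ - v) - a} (ℕₚ.suc-injective (trans (∣-del∣ {p = σ - v} a∈) (ℕₚ.suc-injective (trans (∣-del∣ {p = σ} v∈) e))))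
... | b , b∈ = a , b , v≢a , a≢b , v≢b ,
    sym (⊆∧∣≤∣⇒≡ (triple v a b) σ (triple-⊆ v∈ (∈-del⁻ a∈) (∈-del⁻ (∈-del⁻ {p = σ - v} b∈)))
      (ℕₚ.≤-reflexive (trans e (sym (∣triple∣ v≢a v≢b a≢b)))))
  where
  v≢a : v ≢ a
  v≢a = ∈-del≢ a∈ ∘ sym
  a≢b : a ≢ b
  a≢b = ∈-del≢ b∈ ∘ sym
  v≢b : v ≢ b
  v≢b = ∈-del≢ (∈-del⁻ {p = σ - v} b∈) ∘ sym

module Triangles {n} (F : Fam n) (F? : ∀ σ → Dec (F σ)) where

  record Triangle (W σ : Subset n) : Set where
    constructor mkTriangle
    field
      is-face : F σ
      size : ∣ σ ∣ ≡ 3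
      enclosed : σ ⊆ W
  open Triangle

  tri? : ∀ W σ → Dec (Triangle W σ)
  tri? W σ = map′ to from (F? σ ×-dec (∣ σ ∣ ℕ.≟ 3) ×-dec (σ ⊆? W))
    where
    to : F σ × ∣ σ ∣ ≡ 3 × σ ⊆ W → Triangle W σ
    to (f , s , w) = mkTriangle f s w
    from : Triangle W σ → F σ × ∣ σ ∣ ≡ 3 × σ ⊆ W
    from (mkTriangle f s w) = f , s , w

  △ : Subset n → Fin n → Fin n → Fin n → Set
  △ W x y z = x ≢ y × y ≢ z × x ≢ z × Triangle W (triple x y z)

  △? : ∀ W x y z → Dec (△ W x y z)
  △? W x y z = ¬? (x Fin.≟ y) ×-dec ¬? (y Fin.≟ z) ×-dec ¬? (x Fin.≟ z) ×-dec tri? W (triple x y z)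

  △-231 : ∀ {W x y z} → △ W x y z → △ W y z x
  △-231 {W} {x} {y} {z} (xy , yz , xz , t) = yz , xz ∘ sym , xy ∘ sym , subst (Triangle W) (triple-rotate x y z) t

  △-213 : ∀ {W x y z} → △ W x y z → △ W y x z
  △-213 {W} {x} {y} {z} (xy , yz , xz , t) = xy ∘ sym , xz , yz , subst (Triangle W) (triple-swap x y z) t

  △-132 : ∀ {W x y z} → △ W x y z → △ W x z y
  △-132 = △-213 ∘ △-231 ∘ △-231

  tri⇒△ : ∀ {W σ v} → Triangle W σ → v ∈ σ → ∃[ a ] ∃[ b ] (σ ≡ triple v a b × △ W v a b)
  tri⇒△ {W} t v∈ = let a , b , v≢a , a≢b , v≢b , e = size-3 (size t) v∈ in
    a , b , e , v≢a , a≢b , v≢b , subst (Triangle W) e t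

  △-tri : ∀ {W x y z} → △ W x y z → Triangle W (triple x y z)
  △-tri (_ , _ , _ , t) = t

  △-inside : ∀ {W x y z} → △ W x y z → x ∈ W
  △-inside (_ , _ , _ , t) = enclosed t ∈-triple₁

  tri-del : ∀ {W σ v} → Triangle W σ → v ∉ σ → Triangle (W - v) σ
  tri-del (mkTriangle f s w) v∉ = mkTriangle f s (⊆-del w v∉)

  tri-undel : ∀ {W σ v} → Triangle (W - v) σ → Triangle W σ
  tri-undel (mkTriangle f s w) = mkTriangle f s (∈-del⁻ ∘ w)

  TriShelling : Subset n → List (Subset n) → Set
  TriShelling W l = Shelled l × (∀ {σ} → σ ∈ₗ l → Triangle W σ) × (∀ {σ} → Triangle W σ → σ ∈ₗ l)

  same-size-cov : ∀ {W l σ} → (∀ {ρ} → ρ ∈ₗ l → Triangle W ρ) → Triangle W σ → Cov l σ → σ ∈ₗ l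
  same-size-cov {σ = σ} tris t c = let ρ , i , f = Cov⇒∈ c in
    subst (_∈ₗ _) (sym (⊆∧∣≤∣⇒≡ σ ρ f (ℕₚ.≤-reflexive (trans (size (tris i)) (sym (size t)))))) i

  module _ (W : Subset n)
    (links : ∀ {x a b c d} → △ W x a b → △ W x c d → a ≢ c → a ≢ d → b ≢ c → b ≢ d →
      △ W x a c ⊎ △ W x a d ⊎ △ W x b c ⊎ △ W x b d) where

    open Hypergraph (△ W) (△? W) △-231 △-213 proj₁ links

    module _ {v l} (shelling : TriShelling (W - v) l) (¬split : ¬ IsSplit v) where

      private
        todo : List (Subset n)
        todo = filter (tri? W) (allSubsets n)

        in-todo : ∀ {σ} → Triangle W σ → σ ∈ₗ todo
        in-todo t = LMₚ.∈-filter⁺ (tri? W) (∈-allSubsets _) t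

        from-todo : ∀ {σ} → σ ∈ₗ todo → Triangle W σ
        from-todo i = proj₂ (LMₚ.∈-filter⁻ (tri? W) {xs = allSubsets n} i)

      -- The star of v is attached to the deletion of v, beginning with an edge a₀b₀ of the deletion if
      -- there is one; when no triangle can be attached, the set of visited vertices of the link splits v.
      shell-star : ∀ {a₀ b₀} → △ W v a₀ b₀ → EdgeAvoiding v a₀ b₀ ⊎ l ≡ [] → ∃[ l′ ] TriShelling W l′
      shell-star {a₀} {b₀} t₀ start =
        let full , S , complete = greedy {pre = pre} {todo} shelled-pre step
        in full , Stage.shelled S , tris full S , λ t → complete (in-todo t)
        where
        σ₀ = triple a₀ b₀ v
        pre = σ₀ ∷ l
        v∉ : ∀ {σ} → σ ∈ₗ l → v ∉ σ
        v∉ i h = ∉-del v (enclosed (proj₁ (proj₂ shelling) i) h)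
        ¬Cov-v : ∀ {σ} → v ∈ σ → ¬ Cov l σ
        ¬Cov-v h c = let ρ , i , f = Cov⇒∈ c in v∉ i (f h)
        Triangle-σ₀ : Triangle W σ₀
        Triangle-σ₀ = △-tri (△-231 t₀)
        avoiding⇒∈ : ∀ {x y z} → △ W x y z → x ≢ v → y ≢ v → z ≢ v → triple x y z ∈ₗ l
        avoiding⇒∈ (_ , _ , _ , t) x≢v y≢v z≢v = proj₂ (proj₂ shelling)
          (tri-del t λ h → [ x≢v ∘ sym , [ y≢v ∘ sym , z≢v ∘ sym ]′ ]′ (∈-triple⁻ h))
        edge-cov : ∀ {a b} → △ W v a b → EdgeAvoiding v a b → Cov l (pair a b)
        edge-cov t (z , z≢v , t′) = Cov-pair (avoiding⇒∈ t′ (proj₁ t ∘ sym) (irr₁₃ t ∘ sym) z≢v) ∈-triple₁ ∈-triple₂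
        shelled-pre : Shelled pre
        shelled-pre = add (¬Cov-v ∈-triple₃) (attach₀ start) (proj₁ shelling)
          where
          -- No triangle of l contains v, so σ₀ meets l in faces of a₀b₀ only, and that edge itself
          -- is covered.
          attach₀ : EdgeAvoiding v a₀ b₀ ⊎ l ≡ [] → Attach l σ₀
          attach₀ (inj₁ e) = attach-triple (edge-cov t₀ e) (⊥-elim ∘ ¬Cov-v (x∈⁅x⁆ v)) (¬Cov-v ∈-triple₃)
          attach₀ (inj₂ refl) = λ _ _ ()
        tris : ∀ full → Stage pre todo full → ∀ {σ} → σ ∈ₗ full → Triangle W σ
        tris full S i with Stage.within S i
        ... | inj₁ (here refl) = Triangle-σ₀
        ... | inj₁ (there j) = tri-undel (proj₁ (proj₂ shelling) j)
        ... | inj₂ j = from-todo j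
        step : ∀ full → Stage pre todo full → Missing todo full →
          Attachable todo full
        step full S (σ , σ∈todo , σ∉) = attachable (any? λ a → any? λ b → candidate? a b)
          where
          open Stage S
          Visited : Fin n → Set
          Visited x = Cov full (pair v x)
          visited? : ∀ x → Dec (Visited x)
          visited? x = Cov? full (pair v x)
          Candidate : Fin n → Fin n → Set
          Candidate a b = △ W v a b × triple v a b ∉ₗ full × Visited a × (Cov full ⁅ b ⁆ → Visited b ⊎ Cov full (pair a b))
          candidate? : ∀ a b → Dec (Candidate a b)
          candidate? a b = △? W v a b ×-dec ¬? (triple v a b ∈ₗ? full) ×-dec visited? a ×-dec
            (Cov? full ⁅ b ⁆ →-dec (visited? b ⊎-dec Cov? full (pair a b)))
          old : ∀ {η} → Cov l η → Cov full η
          old c = let ρ , i , f = Cov⇒∈ c in ∈⇒Cov (extends (there i)) f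
          visited-a₀ : Visited a₀
          visited-a₀ = Cov-pair (extends (here refl)) ∈-triple₃ ∈-triple₁
          visited-b₀ : Visited b₀
          visited-b₀ = Cov-pair (extends (here refl)) ∈-triple₃ ∈-triple₂
          attachable : Dec (∃[ a ] ∃[ b ] Candidate a b) → Attachable todo full
          attachable (yes (a , b , t@(_ , _ , _ , tri) , absent , va , ok)) =
            triple v a b , in-todo tri , fresh , attach-triple va ok fresh
            where
            fresh : ¬ Cov full (triple v a b)
            fresh c = absent (same-size-cov (tris full S) tri c)
          attachable (no none) = ⊥-elim stuck
            where
            V : Subset n
            V = ⟪ visited? ⟫
            covered⇒visited : ∀ {a b} → triple v a b ∈ₗ full → Visited a × Visited b
            covered⇒visited {a} i = Cov-pair i ∈-triple₁ ∈-triple₂ , Cov-pair i ∈-triple₁ ∈-triple₃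
            -- When ab is an edge of the deletion it is covered from the start, so vab is attachable
            -- once a is visited. Being stuck thus makes the visited set a colouring constant on
            -- such edges.
            spread-edge : ∀ {a b} → △ W v a b → EdgeAvoiding v a b → Visited a → Visited b
            spread-edge {a} {b} t e va with triple v a b ∈ₗ? full
            ... | yes i = proj₂ (covered⇒visited i)
            ... | no absent = ⊥-elim (none (a , b , t , absent , va , λ _ → inj₂ (old (edge-cov t e))))
            flip-edge : ∀ {x y} → EdgeAvoiding v x y → EdgeAvoiding v y x
            flip-edge (z , z≢v , t) = z , z≢v , △-213 t
            V-const : ∀ x y → △ W v x y → EdgeAvoiding v x y → lookup V x ≡ lookup V y
            V-const x y t e with lookup V x in ex | lookup V y in ey
            ... | true | true = refl
            ... | false | false = refl
            ... | true | false with () ← trans (sym ey) (∈⇒lookup (∈-⟪⟫⁺ visited? (spread-edge t e (∈-⟪⟫⁻ visited? (lookup⇒∈ ex)))))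
            ... | false | true with () ← trans (sym ex) (∈⇒lookup (∈-⟪⟫⁺ visited? (spread-edge (t132 t) (flip-edge e) (∈-⟪⟫⁻ visited? (lookup⇒∈ ey)))))
            -- An unvisited x would make this colouring split v, as a₀ is visited and lies in the
            -- deletion. If l is empty, the deletion has no triangles and there is no such x.
            link-visited : ∀ {x} → LinkVertex v x → Visited x
            link-visited {x} L@((w , t) , y , z , y≢v , z≢v , t′) = decidable-stable (visited? x) λ ¬vx → [ split ¬vx , empty ]′ start
              where
              split : ¬ Visited x → ¬ EdgeAvoiding v a₀ b₀
              split ¬vx (z₀ , z₀≢v , t₁) = ¬split (V , V-const , a₀ , x
                , ((b₀ , t₀) , b₀ , z₀ , irr₁₃ t₀ ∘ sym , z₀≢v , t₁) , L
                , λ e → ¬vx (∈-⟪⟫⁻ visited? (lookup⇒∈ (trans (sym e) (∈⇒lookup (∈-⟪⟫⁺ visited? visited-a₀))))))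
              empty : l ≢ []
              empty e with () ← subst (_ ∈ₗ_) e (avoiding⇒∈ t′ (proj₁ t ∘ sym) y≢v z≢v)
            -- A covered b lies in a triangle of `full` through v, or in one avoiding v and is then
            -- a link vertex; it is visited either way. So an unvisited b is uncovered and vab would
            -- be attachable.
            spread : ∀ {a b} → △ W v a b → Visited a → Visited b
            spread {a} {b} t va with triple v a b ∈ₗ? full
            ... | yes i = proj₂ (covered⇒visited i)
            ... | no absent = decidable-stable (visited? b) λ ¬vb → none (a , b , t , absent , va , λ c → ⊥-elim (¬vb (reach c)))
              where
              reach : Cov full ⁅ b ⁆ → Visited b
              reach c with Cov⇒∈ c
              ... | ρ , i , f with v ∈? ρ
              ...   | yes v∈ρ = Cov-pair i v∈ρ (f (x∈⁅x⁆ b))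
              ...   | no v∉ρ with tri⇒△ (tris full S i) (f (x∈⁅x⁆ b))
              ...     | y , z , refl , t′ = link-visited ((a , t132 t) , y , z
                          , (λ { refl → v∉ρ ∈-triple₂ }) , (λ { refl → v∉ρ ∈-triple₃ }) , t′)
            -- By `links` at v every link edge is at most one edge away from ab. Applied to a₀b₀, it
            -- makes both ends of a missing triangle visited, which renders that triangle
            -- attachable.
            spread-end : ∀ {a b c d} → △ W v a b → Visited a → Visited b → △ W v c d → Visited c
            spread-end {a} {b} {c} {d} t va vb t′ with a Fin.≟ c | a Fin.≟ d | b Fin.≟ c | b Fin.≟ d
            ... | yes refl | _ | _ | _ = va
            ... | no _ | yes refl | _ | _ = spread (t132 t′) va
            ... | no _ | no _ | yes refl | _ = vb
            ... | no _ | no _ | no _ | yes refl = spread (t132 t′) vb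
            ... | no a≢c | no a≢d | no b≢c | no b≢d =
              [ (λ s → spread s va) , [ (λ s → spread (t132 t′) (spread s va)) , [ (λ s → spread s vb) , (λ s → spread (t132 t′) (spread s vb)) ]′ ]′ ]′
              (links t t′ a≢c a≢d b≢c b≢d)
            stuck : Empty.⊥
            stuck with v ∈? σ
            ... | no v∉σ = σ∉ (extends (there (proj₂ (proj₂ shelling) (tri-del (from-todo σ∈todo) v∉σ))))
            ... | yes v∈σ with tri⇒△ (from-todo σ∈todo) v∈σ
            ...   | a , b , refl , t = none (a , b , t , σ∉ , spread-end t₀ visited-a₀ visited-b₀ t
                      , λ _ → inj₁ (spread-end t₀ visited-a₀ visited-b₀ (t132 t)))

-- Obstacles as induced subcomplexes

restrict-closed : ∀ {F : Fam n} {W} → Closed F → Closed (Restrict F W)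
restrict-closed closed σ η f (Fσ , g) = closed σ η f Fσ , λ {_} → g ∘ f

facet-above : ∀ {F : Fam n} → (∀ σ → Dec (F σ)) → ∀ η → F η → ∃[ σ ] (IsFacet F σ × η ⊆ σ)
facet-above {n} {F} F? η Fη = go n η Fη (ℕₚ.m≤n+m n ∣ η ∣)
  where
  go : ∀ k η → F η → n ≤ ∣ η ∣ ℕ.+ k → ∃[ σ ] (IsFacet F σ × η ⊆ σ)
  go k η Fη le with anySubset? (λ τ → F? τ ×-dec (η ⊆? τ) ×-dec ¬? (τ ≟ₛ η))
  ... | no none = η , (Fη , λ τ Fτ f → decidable-stable (τ ≟ₛ η) λ ne → none (τ , Fτ , (λ {_} → f) , ne)) , id
  ... | yes (τ , Fτ , f , ne) with k
  ...   | zero = ⊥-elim (ne (sym (⊆∧∣≤∣⇒≡ η τ f (ℕₚ.≤-trans (Subₚ.∣p∣≤n τ) (subst (n ≤_) (ℕₚ.+-identityʳ ∣ η ∣) le)))))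
  ...   | suc k = let σ , fac , g = go k τ Fτ (ℕₚ.≤-trans le (subst (_≤ ∣ τ ∣ ℕ.+ k) (sym (ℕₚ.+-suc ∣ η ∣ k)) (ℕₚ.+-monoˡ-≤ k bigger)))
                  in σ , fac , g ∘ f
    where
    bigger : ∣ η ∣ < ∣ τ ∣
    bigger = ℕₚ.≰⇒> λ le → ne (sym (⊆∧∣≤∣⇒≡ η τ f le))

Obstacle : Fam n → Set
Obstacle F = ∃[ W ] ((∀ v → v ∈ W → F ⁅ v ⁆) × (Disconnection (Restrict F W) ⊎ Band (Restrict F W)))

module Search {n} (F : Fam n) (F? : ∀ σ → Dec (F σ)) (closed : Closed F) (dim : ∀ σ → F σ → ∣ σ ∣ ≤ 3) where

  open Triangles F F?
  open Triangle

  △-vertex : ∀ {W x y z v} → △ W x y z → v ∈ triple x y z → F ⁅ v ⁆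
  △-vertex (_ , _ , _ , t) h = closed _ _ (⁅⁆⊆ h) (is-face t)

  ∣△∣ : ∀ {W x y z} → △ W x y z → ∣ triple x y z ∣ ≡ 3
  ∣△∣ (_ , _ , _ , t) = size t

  triangle-≡ : ∀ {σ ρ : Subset n} → ∣ σ ∣ ≡ 3 → ∣ ρ ∣ ≡ 3 → σ ⊆ ρ → σ ≡ ρ
  triangle-≡ {σ} {ρ} s s′ f = ⊆∧∣≤∣⇒≡ σ ρ f (ℕₚ.≤-reflexive (trans s′ (sym s)))

  module _ (W : Subset n) where

    Links : Set
    Links = ∀ {x a b c d} → △ W x a b → △ W x c d → a ≢ c → a ≢ d → b ≢ c → b ≢ d →
      △ W x a c ⊎ △ W x a d ⊎ △ W x b c ⊎ △ W x b d

    disconnected-link : ∀ {x a b c d} → △ W x a b → △ W x c d → a ≢ c → a ≢ d → b ≢ c → b ≢ d →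
      ¬ (△ W x a c ⊎ △ W x a d ⊎ △ W x b c ⊎ △ W x b d) → Obstacle F
    disconnected-link {x} {a} {b} {c} {d} t t′ a≢c a≢d b≢c b≢d none = U , vertices , inj₁ record
      { i = 2 ; τ = ⁅ x ⁆ ; α = pair a b ; β = pair c d
      ; τα = avoid t ; τβ = avoid t′ ; αβ = separate
      ; ∣β∣ = trans (∣pair∣ (proj₁ (proj₂ t′))) (sym (∣pair∣ (proj₁ (proj₂ t))))
      ; 2≤∣α∣ = ℕₚ.≤-reflexive (sym (∣pair∣ (proj₁ (proj₂ t))))
      ; face-α = subst (Restrict F U) (assoc a b) (is-face (△-tri t) , λ {_} → ∈-left)
      ; face-β = subst (Restrict F U) (assoc c d) (is-face (△-tri t′) , λ {_} → ∈-right)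
      ; size = trans (cong ∣_∣ (sym (assoc a b))) (∣△∣ t)
      ; top = λ ρ (Fρ , _) → dim ρ Fρ
      ; only = only }
      where
      U : Subset n
      U = triple x a b ∪ triple x c d
      assoc : ∀ y z → triple x y z ≡ ⁅ x ⁆ ∪ pair y z
      assoc y z = Subₚ.∪-assoc ⁅ x ⁆ ⁅ y ⁆ ⁅ z ⁆
      vertices : ∀ v → v ∈ U → F ⁅ v ⁆
      vertices v h = [ △-vertex t , △-vertex t′ ]′ (∈-split h)
      avoid : ∀ {y z} → △ W x y z → Disjoint ⁅ x ⁆ (pair y z)
      avoid (x≢y , _ , x≢z , _) v h i with refl ← x∈⁅y⁆⇒x≡y x h = [ x≢y , x≢z ]′ (∈-pair⁻ i)
      separate : Disjoint (pair a b) (pair c d)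
      separate v h i with ∈-pair⁻ h | ∈-pair⁻ i
      ... | inj₁ refl | inj₁ e = a≢c e
      ... | inj₁ refl | inj₂ e = a≢d e
      ... | inj₂ refl | inj₁ e = b≢c e
      ... | inj₂ refl | inj₂ e = b≢d e
      absent : ∀ {y z} → y ∈ pair a b → z ∈ pair c d → ¬ △ W x y z
      absent h i s with ∈-pair⁻ h | ∈-pair⁻ i
      ... | inj₁ refl | inj₁ refl = none (inj₁ s)
      ... | inj₁ refl | inj₂ refl = none (inj₂ (inj₁ s))
      ... | inj₂ refl | inj₁ refl = none (inj₂ (inj₂ (inj₁ s)))
      ... | inj₂ refl | inj₂ refl = none (inj₂ (inj₂ (inj₂ s)))
      sides : ∀ {v} → v ∈ U → x ≢ v → v ∈ pair a b ⊎ v ∈ pair c d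
      sides {v} h x≢v with ∈-split {p = triple x a b} h
      ... | inj₁ i = inj₁ ([ (λ j → ⊥-elim (x≢v (sym (x∈⁅y⁆⇒x≡y x j)))) , id ]′ (∈-split (subst (v ∈_) (assoc a b) i)))
      ... | inj₂ i = inj₂ ([ (λ j → ⊥-elim (x≢v (sym (x∈⁅y⁆⇒x≡y x j)))) , id ]′ (∈-split (subst (v ∈_) (assoc c d) i)))
      only : ∀ ρ → Restrict F U ρ → ∣ ρ ∣ ≡ 3 → ⁅ x ⁆ ⊆ ρ → (ρ ≡ ⁅ x ⁆ ∪ pair a b) ⊎ (ρ ≡ ⁅ x ⁆ ∪ pair c d)
      only ρ (Fρ , f) s g with size-3 s (g (x∈⁅x⁆ x))
      ... | y , z , x≢y , y≢z , x≢z , refl = classify (sides (f ∈-triple₂) x≢y) (sides (f ∈-triple₃) x≢z)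
        where
        U⊆W : U ⊆ W
        U⊆W = ∪-lub (enclosed (△-tri t)) (enclosed (△-tri t′))
        xyz : △ W x y z
        xyz = x≢y , y≢z , x≢z , mkTriangle Fρ s (U⊆W ∘ f)
        fill : ∀ {y′ z′} → △ W x y′ z′ → y ∈ pair y′ z′ → z ∈ pair y′ z′ → triple x y z ≡ ⁅ x ⁆ ∪ pair y′ z′
        fill {y′} {z′} u hy hz = triangle-≡ s (trans (cong ∣_∣ (sym (assoc y′ z′))) (∣△∣ u))
          (triple-⊆ (∈-left (x∈⁅x⁆ x)) (∈-right hy) (∈-right hz))
        classify : y ∈ pair a b ⊎ y ∈ pair c d → z ∈ pair a b ⊎ z ∈ pair c d →
          (triple x y z ≡ ⁅ x ⁆ ∪ pair a b) ⊎ (triple x y z ≡ ⁅ x ⁆ ∪ pair c d)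
        classify (inj₁ hy) (inj₁ hz) = inj₁ (fill t hy hz)
        classify (inj₂ hy) (inj₂ hz) = inj₂ (fill t′ hy hz)
        classify (inj₁ hy) (inj₂ hz) = ⊥-elim (absent hy hz xyz)
        classify (inj₂ hy) (inj₁ hz) = ⊥-elim (absent hz hy (△-132 xyz))

    links-or-obstacle : Obstacle F ⊎ Links
    links-or-obstacle with any? (λ x → any? λ a → any? λ b → any? λ c → any? λ d →
      △? W x a b ×-dec △? W x c d ×-dec ¬? (a Fin.≟ c) ×-dec ¬? (a Fin.≟ d) ×-dec ¬? (b Fin.≟ c) ×-dec ¬? (b Fin.≟ d)
        ×-dec ¬? (△? W x a c ⊎-dec △? W x a d ⊎-dec △? W x b c ⊎-dec △? W x b d))
    ... | yes (_ , _ , _ , _ , _ , t , t′ , ac , ad , bc , bd , none) = inj₁ (disconnected-link t t′ ac ad bc bd none)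
    ... | no ¬w = inj₂ λ {x} {a} {b} {c} {d} t t′ ac ad bc bd →
      decidable-stable (△? W x a c ⊎-dec △? W x a d ⊎-dec △? W x b c ⊎-dec △? W x b d)
        λ none → ¬w (x , a , b , c , d , t , t′ , ac , ad , bc , bd , none)

    OneOf : Fin n → Fin n → Fin n → Fin n → Set
    OneOf x a b c = x ≡ a ⊎ x ≡ b ⊎ x ≡ c

    oneOf? : ∀ x a b c → Dec (OneOf x a b c)
    oneOf? x a b c = (x Fin.≟ a) ⊎-dec (x Fin.≟ b) ⊎-dec (x Fin.≟ c)

    Mixed : (a p q b r s : Fin n) → Set
    Mixed a p q b r s = ∃[ x ] ∃[ y ] ∃[ z ] (△ W x y z × OneOf x a p q × OneOf z b r s × (OneOf y a p q ⊎ OneOf y b r s))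

    mixed? : ∀ a p q b r s → Dec (Mixed a p q b r s)
    mixed? a p q b r s = any? λ x → any? λ y → any? λ z →
      △? W x y z ×-dec oneOf? x a p q ×-dec oneOf? z b r s ×-dec (oneOf? y a p q ⊎-dec oneOf? y b r s)

    Mixes : Set
    Mixes = ∀ {a p q b r s} → △ W a p q → △ W b r s → (∀ {x} → OneOf x a p q → ¬ OneOf x b r s) → Mixed a p q b r s

    separate-triangles : ∀ {a p q b r s} → △ W a p q → △ W b r s → (∀ x → OneOf x a p q → ¬ OneOf x b r s) →
      ¬ Mixed a p q b r s → Obstacle F
    separate-triangles {a} {p} {q} {b} {r} {s} t t′ apart none = U , vertices , inj₁ record
      { i = 2 ; τ = ⊥ ; α = A ; β = B
      ; τα = λ _ h → ⊥-elim (Subₚ.∉⊥ h) ; τβ = λ _ h → ⊥-elim (Subₚ.∉⊥ h)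
      ; αβ = λ x h i → apart x (∈-triple⁻ h) (∈-triple⁻ i)
      ; ∣β∣ = trans (∣△∣ t′) (sym (∣△∣ t))
      ; 2≤∣α∣ = subst (2 ≤_) (sym (∣△∣ t)) (s≤s (s≤s z≤n))
      ; face-α = subst (Restrict F U) (sym (⊥∪ A)) (is-face (△-tri t) , λ {_} → ∈-left)
      ; face-β = subst (Restrict F U) (sym (⊥∪ B)) (is-face (△-tri t′) , λ {_} → ∈-right)
      ; size = trans (cong ∣_∣ (⊥∪ A)) (∣△∣ t)
      ; top = λ ρ (Fρ , _) → dim ρ Fρ
      ; only = λ ρ Fρ s _ → only ρ Fρ s }
      where
      A B U : Subset n
      A = triple a p q
      B = triple b r s
      U = A ∪ B
      vertices : ∀ v → v ∈ U → F ⁅ v ⁆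
      vertices v h = [ △-vertex t , △-vertex t′ ]′ (∈-split h)
      only : ∀ ρ → Restrict F U ρ → ∣ ρ ∣ ≡ 3 → (ρ ≡ ⊥ ∪ A) ⊎ (ρ ≡ ⊥ ∪ B)
      only ρ (Fρ , f) size-ρ with ρ ⊆? A | ρ ⊆? B
      ... | yes g | _ = inj₁ (trans (triangle-≡ size-ρ (∣△∣ t) g) (sym (⊥∪ A)))
      ... | no _ | yes g = inj₂ (trans (triangle-≡ size-ρ (∣△∣ t′) g) (sym (⊥∪ B)))
      ... | no ρ⊈A | no ρ⊈B with ⊈⇒∃ ρ⊈A | ⊈⇒∃ ρ⊈B
      ...   | z , z∈ρ , z∉A | x , x∈ρ , x∉B = ⊥-elim (third (size-3 size-ρ x∈ρ))
        where
        x∈A : x ∈ A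
        x∈A = [ id , ⊥-elim ∘ x∉B ]′ (∈-split (f x∈ρ))
        z∈B : z ∈ B
        z∈B = [ ⊥-elim ∘ z∉A , id ]′ (∈-split (f z∈ρ))
        U⊆W : U ⊆ W
        U⊆W = ∪-lub (enclosed (△-tri t)) (enclosed (△-tri t′))
        finish : ∀ {y} → △ W x y z → y ∈ ρ → Empty.⊥
        finish u y∈ρ = none (_ , _ , _ , u , ∈-triple⁻ x∈A , ∈-triple⁻ z∈B , [ inj₁ ∘ ∈-triple⁻ , inj₂ ∘ ∈-triple⁻ ]′ (∈-split (f y∈ρ)))
        third : ¬ (∃[ y ] ∃[ w ] (x ≢ y × y ≢ w × x ≢ w × ρ ≡ triple x y w))
        third (y , w , x≢y , y≢w , x≢w , refl) with ∈-triple⁻ z∈ρ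
        ... | inj₁ refl = z∉A x∈A
        ... | inj₂ (inj₁ refl) = finish (△-132 (x≢y , y≢w , x≢w , mkTriangle Fρ size-ρ (U⊆W ∘ f))) ∈-triple₃
        ... | inj₂ (inj₂ refl) = finish (x≢y , y≢w , x≢w , mkTriangle Fρ size-ρ (U⊆W ∘ f)) ∈-triple₂

    mixes-or-obstacle : Obstacle F ⊎ Mixes
    mixes-or-obstacle with any? (λ a → any? λ p → any? λ q → any? λ b → any? λ r → any? λ s →
      △? W a p q ×-dec △? W b r s ×-dec (all? λ x → oneOf? x a p q →-dec ¬? (oneOf? x b r s)) ×-dec ¬? (mixed? a p q b r s))
    ... | yes (_ , _ , _ , _ , _ , _ , t , t′ , apart , none) = inj₁ (separate-triangles t t′ apart none)
    ... | no ¬w = inj₂ λ {a} {p} {q} {b} {r} {s} t t′ apart → decidable-stable (mixed? a p q b r s)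
      λ none → ¬w (a , p , q , b , r , s , t , t′ , (λ x → apart {x}) , none)

    module _ (links : Links) where

      open Hypergraph (△ W) (△? W) △-231 △-213 proj₁ links

      band-obstacle : HyperBand → Obstacle F
      band-obstacle H = U , vertices , inj₂ record
        { cycle = cycle ; u = u ; u-injective = u-injective
        ; face-tri = λ i → is-face (tri i) , λ {_} → triple-⊆ (u∈U _) (u∈U _) (u∈U _)
        ; top = λ ρ (Fρ , _) → dim ρ Fρ
        ; only = only-tri
        ; vertex = λ v (_ , f) → let i , e = ∈-⟪⟫⁻ image? (f (x∈⁅x⁆ v)) in i , sym e }
        where
        open HyperBand H
        open Cycle cycle
        image? : ∀ x → Dec (∃[ i ] u i ≡ x)
        image? x = any? λ i → u i Fin.≟ x
        U : Subset n
        U = ⟪ image? ⟫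
        u∈U : ∀ i → u i ∈ U
        u∈U i = ∈-⟪⟫⁺ image? (i , refl)
        tri : ∀ i → Triangle W (triple (u i) (u (next i)) (u (next (next i))))
        tri i = △-tri (consecutive i)
        vertices : ∀ v → v ∈ U → F ⁅ v ⁆
        vertices v h with ∈-⟪⟫⁻ image? h
        ... | i , refl = △-vertex (consecutive i) ∈-triple₁
        U⊆W : U ⊆ W
        U⊆W h with ∈-⟪⟫⁻ image? h
        ... | i , refl = △-inside (consecutive i)
        in-tri : ∀ {i m} → Within next i m → u i ∈ triple (u m) (u (next m)) (u (next (next m)))
        in-tri (inj₁ refl) = ∈-triple₁
        in-tri {m = m} (inj₂ (inj₁ refl)) = ∈-triple₂
        in-tri {m = m} (inj₂ (inj₂ refl)) = ∈-triple₃
        only-tri : ∀ ρ → Restrict F U ρ → ∣ ρ ∣ ≡ 3 → ∃[ i ] ρ ≡ triple (u i) (u (next i)) (u (next (next i)))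
        only-tri ρ (Fρ , f) s with nonempty {p = ρ} s
        ... | x , x∈ρ with size-3 s x∈ρ
        ... | y , z , x≢y , y≢z , x≢z , refl with ∈-⟪⟫⁻ image? (f ∈-triple₁) | ∈-⟪⟫⁻ image? (f ∈-triple₂) | ∈-⟪⟫⁻ image? (f ∈-triple₃)
        ... | i , refl | j , refl | l , refl with only i j l (x≢y , y≢z , x≢z , mkTriangle Fρ s (U⊆W ∘ f))
        ... | m , hi , hj , hl = m , triangle-≡ s (size (tri m)) (triple-⊆ (in-tri hi) (in-tri hj) (in-tri hl))

  -- Induction on W with only its triangles in view. An `Obstacle` of F carries its own vertex set,
  -- so one found inside W - v is returned unchanged.
  shell-triangles : ∀ k W → ∣ W ∣ ≡ k → Obstacle F ⊎ ∃[ l ] TriShelling W l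
  shell-triangles k W e with any? (λ x → any? λ y → any? λ z → △? W x y z)
  ... | no none = inj₂ ([] , [] , (λ ()) , λ {σ} t → ⊥-elim (absent t))
    where
    absent : ∀ {σ} → ¬ Triangle W σ
    absent {σ} t with nonempty {p = σ} (size t)
    ... | x , x∈σ with tri⇒△ t x∈σ
    ... | y , z , _ , u = none (x , y , z , u)
  ... | yes (x , y , z , t) with links-or-obstacle W
  ... | inj₁ o = inj₁ o
  ... | inj₂ links with mixes-or-obstacle W
  ... | inj₁ o = inj₁ o
  ... | inj₂ mixes with Hypergraph.unsplit-or-band (△ W) (△? W) △-231 △-213 proj₁ links mixes t
  ... | inj₁ band = inj₁ (band-obstacle W links band)
  ... | inj₂ (v , (a , b , tv) , unsplit) with k | trans (∣-del∣ {p = W} (△-inside tv)) e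
  ... | suc k′ | e′ with shell-triangles k′ (W - v) (ℕₚ.suc-injective e′)
  ... | inj₁ o = inj₁ o
  ... | inj₂ ([] , shelling) = inj₂ (shell-star W links shelling unsplit tv (inj₂ refl))
  ... | inj₂ (σ ∷ l , shelling) = inj₂ (shell-star W links shelling unsplit (proj₁ (proj₂ (proj₂ first))) (inj₁ (proj₂ (proj₂ (proj₂ first)))))
    where
    σ-tri : Triangle (W - v) σ
    σ-tri = proj₁ (proj₂ shelling) (here refl)
    -- The deletion contains the triangle σ, so the star has to start along an edge; `linkEdge`
    -- finds it from σ and a triangle at v.
    first : ∃[ a ] ∃[ b ] (△ W v a b × ∃[ z ] (z ≢ v × △ W a b z))
    first with nonempty {p = σ} (size σ-tri)
    ... | p , p∈σ with tri⇒△ (tri-undel σ-tri) p∈σ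
    ... | q , r , refl , u = Hypergraph.linkEdge (△ W) (△? W) △-231 △-213 proj₁ links mixes tv u
        (off ∈-triple₁) (off ∈-triple₂) (off ∈-triple₃)
      where
      off : ∀ {z} → z ∈ triple p q r → z ≢ v
      off h = ∈-del≢ (enclosed σ-tri h)

  attach-pair : ∀ {pre : List (Subset n)} {x y} → Cov pre ⁅ x ⁆ → ¬ Cov pre (pair x y) → Attach pre (pair x y)
  attach-pair {pre} {x} {y} cx fresh η η⊆ c with y ∈? η | x ∈? η
  ... | no y∉η | _ = y , ∈-pairʳ , y∉η , Cov-⊆ minus cx
    where
    minus : pair x y - y ⊆ ⁅ x ⁆
    minus h with ∈-pair⁻ (∈-del⁻ h)
    ... | inj₁ refl = x∈⁅x⁆ x
    ... | inj₂ refl = ⊥-elim (∈-del≢ h refl)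
  ... | yes y∈η | yes x∈η = ⊥-elim (fresh (Cov-⊆ (pair-⊆ x∈η y∈η) c))
  ... | yes y∈η | no x∉η = x , ∈-pairˡ , x∉η , Cov-⊆ minus c
    where
    minus : pair x y - x ⊆ η
    minus h with ∈-pair⁻ (∈-del⁻ h)
    ... | inj₁ refl = ⊥-elim (∈-del≢ h refl)
    ... | inj₂ refl = y∈η

  attach-point : ∀ {pre : List (Subset n)} {σ} → ∣ σ ∣ ≤ 1 → ¬ Cov pre σ → Attach pre σ
  attach-point {pre} {σ} le fresh η η⊆ c =
    let x , x∈σ , x∉η = ⊈⇒∃ λ f → fresh (Cov-⊆ f c)
        empty = ∣∣≡0⇒≡⊥ {p = σ - x} (ℕₚ.n≤0⇒n≡0 (ℕₚ.≤-pred (subst (_≤ 1) (sym (∣-del∣ {p = σ} x∈σ)) le)))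
    in x , x∈σ , x∉η , subst (Cov pre) (sym empty) (Cov-⊆ Subₚ.⊥⊆ c)

  size-2 : ∀ {σ : Subset n} {v} → ∣ σ ∣ ≡ 2 → v ∈ σ → ∃[ a ] (v ≢ a × σ ≡ pair v a)
  size-2 {σ} {v} e v∈ with nonempty {p = σ - v} (ℕₚ.suc-injective (trans (∣-del∣ {p = σ} v∈) e))
  ... | a , a∈ = a , v≢a , sym (⊆∧∣≤∣⇒≡ (pair v a) σ (pair-⊆ v∈ (∈-del⁻ a∈)) (ℕₚ.≤-reflexive (trans e (sym (∣pair∣ v≢a)))))
    where
    v≢a : v ≢ a
    v≢a = ∈-del≢ a∈ ∘ sym

  facet? : ∀ σ → Dec (IsFacet F σ)
  facet? σ = F? σ ×-dec allSubset? λ τ → F? τ →-dec ((σ ⊆? τ) →-dec (τ ≟ₛ σ))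

  facet-fresh : ∀ {l σ} → (∀ {ρ} → ρ ∈ₗ l → F ρ) → IsFacet F σ → σ ∉ₗ l → ¬ Cov l σ
  facet-fresh faces (_ , max) σ∉ c = let ρ , i , f = Cov⇒∈ c in σ∉ (subst (_∈ₗ _) (max ρ (faces i) f) i)

  separate-edges : ∀ {a b x y} → a ≢ b → x ≢ y → F (pair a b) → F (pair x y) →
    (∀ {c z} → c ∈ pair a b → z ∈ pair x y → c ≢ z × ¬ F (pair c z)) → Obstacle F
  separate-edges {a} {b} {x} {y} a≢b x≢y Fab Fxy apart = U , vertices , inj₁ record
    { i = 1 ; τ = ⊥ ; α = pair a b ; β = pair x y
    ; τα = λ _ h → ⊥-elim (Subₚ.∉⊥ h) ; τβ = λ _ h → ⊥-elim (Subₚ.∉⊥ h)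
    ; αβ = λ v h i → proj₁ (apart h i) refl
    ; ∣β∣ = trans (∣pair∣ x≢y) (sym (∣pair∣ a≢b))
    ; 2≤∣α∣ = ℕₚ.≤-reflexive (sym (∣pair∣ a≢b))
    ; face-α = subst (Restrict F U) (sym (⊥∪ (pair a b))) (Fab , λ {_} → ∈-left)
    ; face-β = subst (Restrict F U) (sym (⊥∪ (pair x y))) (Fxy , λ {_} → ∈-right)
    ; size = trans (cong ∣_∣ (⊥∪ (pair a b))) (∣pair∣ a≢b)
    ; top = λ ρ Fρ → bound (one-side ρ Fρ)
    ; only = λ ρ Fρ s _ → exact s (one-side ρ Fρ) }
    where
    U : Subset n
    U = pair a b ∪ pair x y
    vertices : ∀ v → v ∈ U → F ⁅ v ⁆
    vertices v h = [ (λ i → closed _ _ (⁅⁆⊆ i) Fab) , (λ i → closed _ _ (⁅⁆⊆ i) Fxy) ]′ (∈-split h)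
    one-side : ∀ ρ → Restrict F U ρ → ρ ⊆ pair a b ⊎ ρ ⊆ pair x y
    one-side ρ (Fρ , f) with ρ ⊆? pair a b | ρ ⊆? pair x y
    ... | yes g | _ = inj₁ g
    ... | no _ | yes g = inj₂ g
    ... | no ¬f | no ¬g with ⊈⇒∃ ¬f | ⊈⇒∃ ¬g
    ...   | z , z∈ρ , z∉ | c , c∈ρ , c∉ = ⊥-elim (proj₂ (apart ([ id , ⊥-elim ∘ c∉ ]′ (∈-split (f c∈ρ))) ([ ⊥-elim ∘ z∉ , id ]′ (∈-split (f z∈ρ))))
              (closed ρ (pair c z) (pair-⊆ c∈ρ z∈ρ) Fρ))
    bound : ∀ {ρ} → ρ ⊆ pair a b ⊎ ρ ⊆ pair x y → ∣ ρ ∣ ≤ 2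
    bound {ρ} (inj₁ f) = subst (∣ ρ ∣ ≤_) (∣pair∣ a≢b) (∣⊆∣ ρ (pair a b) f)
    bound {ρ} (inj₂ f) = subst (∣ ρ ∣ ≤_) (∣pair∣ x≢y) (∣⊆∣ ρ (pair x y) f)
    exact : ∀ {ρ} → ∣ ρ ∣ ≡ 2 → ρ ⊆ pair a b ⊎ ρ ⊆ pair x y → (ρ ≡ ⊥ ∪ pair a b) ⊎ (ρ ≡ ⊥ ∪ pair x y)
    exact {ρ} s (inj₁ f) = inj₁ (trans (⊆∧∣≤∣⇒≡ ρ (pair a b) f (ℕₚ.≤-reflexive (trans (∣pair∣ a≢b) (sym s)))) (sym (⊥∪ (pair a b))))
    exact {ρ} s (inj₂ f) = inj₂ (trans (⊆∧∣≤∣⇒≡ ρ (pair x y) f (ℕₚ.≤-reflexive (trans (∣pair∣ x≢y) (sym s)))) (sym (⊥∪ (pair x y))))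

  SeparateEdges : Set
  SeparateEdges = ∃[ a ] ∃[ b ] ∃[ x ] ∃[ y ] (a ≢ b × x ≢ y × F (pair a b) × F (pair x y) ×
    (∀ c z → c ∈ pair a b → z ∈ pair x y → c ≢ z × ¬ F (pair c z)))

  separateEdges? : Dec SeparateEdges
  separateEdges? = any? λ a → any? λ b → any? λ x → any? λ y →
    ¬? (a Fin.≟ b) ×-dec ¬? (x Fin.≟ y) ×-dec F? (pair a b) ×-dec F? (pair x y) ×-dec
    all? λ c → all? λ z → (c ∈? pair a b) →-dec ((z ∈? pair x y) →-dec (¬? (c Fin.≟ z) ×-dec ¬? (F? (pair c z))))

  facetsOf : {P : ℕ → Set} → (∀ k → Dec (P k)) → List (Subset n)
  facetsOf P? = filter (λ σ → facet? σ ×-dec P? ∣ σ ∣) (allSubsets n)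

  ∈-facetsOf⁺ : ∀ {P : ℕ → Set} (P? : ∀ k → Dec (P k)) {σ} → IsFacet F σ → P ∣ σ ∣ → σ ∈ₗ facetsOf P?
  ∈-facetsOf⁺ P? {σ} fac p = LMₚ.∈-filter⁺ (λ σ → facet? σ ×-dec P? ∣ σ ∣) (∈-allSubsets σ) (fac , p)

  ∈-facetsOf⁻ : ∀ {P : ℕ → Set} (P? : ∀ k → Dec (P k)) {σ} → σ ∈ₗ facetsOf P? → IsFacet F σ × P ∣ σ ∣
  ∈-facetsOf⁻ P? i = proj₂ (LMₚ.∈-filter⁻ (λ σ → facet? σ ×-dec P? ∣ σ ∣) {xs = allSubsets n} i)

  -- Edge facets follow all triangles, and one can be attached when an endpoint is covered. If none
  -- can, a missing edge and an edge of a shelled face are separate: a face joining them would lie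
  -- in a triangle, which is already shelled, or in an edge facet with a covered endpoint.
  extend-by-edges : ∀ {l} → ¬ SeparateEdges → TriShelling ⊤ l → ∃[ full ] (Stage l (facetsOf (ℕ._≟ 2)) full
    × (∀ {σ} → σ ∈ₗ facetsOf (ℕ._≟ 2) → σ ∈ₗ full))
  extend-by-edges {l} ¬separate (shelled , tris , complete) = greedy shelled step
    where
    todo = facetsOf (ℕ._≟ 2)
    member : ∀ {full σ} → Stage l todo full → σ ∈ₗ full → F σ × 2 ≤ ∣ σ ∣
    member S i with Stage.within S i
    ... | inj₁ j = is-face (tris j) , subst (2 ≤_) (sym (size (tris j))) (s≤s (s≤s z≤n))
    ... | inj₂ j = let fac , s = ∈-facetsOf⁻ (ℕ._≟ 2) j in proj₁ fac , ℕₚ.≤-reflexive (sym s)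
    Touching : List (Subset n) → Subset n → Set
    Touching full σ = σ ∉ₗ full × ∃[ x ] (x ∈ σ × Cov full ⁅ x ⁆)
    touching? : ∀ full σ → Dec (Touching full σ)
    touching? full σ = ¬? (σ ∈ₗ? full) ×-dec any? λ x → (x ∈? σ) ×-dec Cov? full ⁅ x ⁆
    stuck : ∀ {ρ rest σ} → Stage l todo (ρ ∷ rest) → σ ∈ₗ todo → σ ∉ₗ ρ ∷ rest → ¬ Any (Touching (ρ ∷ rest)) todo → SeparateEdges
    stuck {ρ} {rest} {σ} S σ∈ σ∉ none with nonempty {p = σ} (proj₂ (∈-facetsOf⁻ (ℕ._≟ 2) σ∈))
    ... | x , x∈σ with size-2 (proj₂ (∈-facetsOf⁻ (ℕ._≟ 2) σ∈)) x∈σ | another {p = ρ} (proj₂ (member S (here refl))) x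
    ... | y , x≢y , refl | a , a∈ρ , _ with another {p = ρ} (proj₂ (member S (here refl))) a
    ... | b , b∈ρ , b≢a = a , b , x , y , b≢a ∘ sym , x≢y , closed ρ (pair a b) ab⊆ρ (proj₁ (member S (here refl)))
        , proj₁ (proj₁ (∈-facetsOf⁻ (ℕ._≟ 2) σ∈)) , λ c z hc hz → (λ { refl → uncovered hz (covered hc) }) , no-edge hc hz
      where
      ab⊆ρ : pair a b ⊆ ρ
      ab⊆ρ = pair-⊆ a∈ρ b∈ρ
      covered : ∀ {c} → c ∈ pair a b → Cov (ρ ∷ rest) ⁅ c ⁆
      covered h = here (⁅⁆⊆ (ab⊆ρ h))
      uncovered : ∀ {z} → z ∈ pair x y → ¬ Cov (ρ ∷ rest) ⁅ z ⁆
      uncovered {z} h c = none (LM.lose σ∈ (σ∉ , z , h , c))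
      no-edge : ∀ {c z} → c ∈ pair a b → z ∈ pair x y → ¬ F (pair c z)
      no-edge {c} {z} hc hz Fcz with facet-above F? (pair c z) Fcz
      ... | φ , fac , f = by-size ∣ φ ∣ refl
        where
        missed : φ ∉ₗ ρ ∷ rest
        missed i = uncovered hz (∈⇒Cov i (⁅⁆⊆ (f ∈-pairʳ)))
        by-size : ∀ k → ∣ φ ∣ ≡ k → Empty.⊥
        by-size 0 e = Subₚ.∉⊥ (subst (z ∈_) (∣∣≡0⇒≡⊥ {p = φ} e) (f ∈-pairʳ))
        by-size 1 e = ℕₚ.<⇒≱ (ℕₚ.≤-reflexive (cong suc e)) (subst (_≤ ∣ φ ∣) (∣pair∣ {x = c} {z} λ { refl → uncovered hz (covered hc) }) (∣⊆∣ (pair c z) φ f))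
        by-size 2 e = none (LM.lose (∈-facetsOf⁺ (ℕ._≟ 2) fac e) (missed , c , f ∈-pairˡ , covered hc))
        by-size 3 e = missed (Stage.extends S (complete (mkTriangle (proj₁ fac) e (λ _ → Subₚ.∈⊤))))
        by-size (suc (suc (suc (suc k)))) e = ℕₚ.<⇒≱ (s≤s (s≤s (s≤s (s≤s z≤n)))) (subst (_≤ 3) e (dim φ (proj₁ fac)))
    step : ∀ full → Stage l todo full → Missing todo full → Attachable todo full
    step full S missing = attachable full S missing (Any.any? (touching? full) todo)
      where
      attachable : ∀ full → Stage l todo full → Missing todo full → Dec (Any (Touching full) todo) →
        Attachable todo full
      attachable full S _ (yes w) with LM.find w
      ... | σ , i , absent , x , x∈ , cx with ∈-facetsOf⁻ (ℕ._≟ 2) i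
      ... | fac , s with size-2 s x∈
      ... | y , x≢y , refl = pair x y , i , fresh , attach-pair cx fresh
        where
        fresh : ¬ Cov full (pair x y)
        fresh = facet-fresh (proj₁ ∘ member S) fac absent
      attachable [] S (σ , i , _) (no _) = σ , i , (λ ()) , λ _ _ ()
      attachable (ρ ∷ rest) S (σ , σ∈ , σ∉) (no none) = ⊥-elim (¬separate (stuck S σ∈ σ∉ none))

  obstacle-or-shellable : Obstacle F ⊎ Shellable F
  obstacle-or-shellable with separateEdges?
  ... | yes (a , b , x , y , a≢b , x≢y , Fab , Fxy , apart) = inj₁ (separate-edges a≢b x≢y Fab Fxy λ {c} {z} → apart c z)
  ... | no ¬separate with shell-triangles ∣ ⊤ {n} ∣ ⊤ refl
  ... | inj₁ o = inj₁ o
  ... | inj₂ (l , shelling@(_ , tris , complete)) with extend-by-edges ¬separate shelling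
  ... | l₂ , S₂ , complete₂ with greedy {pre = l₂} {facetsOf (ℕ._≤? 1)} (Stage.shelled S₂) points
    where
    l₂-faces : ∀ {σ} → σ ∈ₗ l₂ → F σ
    l₂-faces i = [ is-face ∘ tris , proj₁ ∘ proj₁ ∘ ∈-facetsOf⁻ (ℕ._≟ 2) ]′ (Stage.within S₂ i)
    points : ∀ full → Stage l₂ (facetsOf (ℕ._≤? 1)) full → Missing (facetsOf (ℕ._≤? 1)) full →
      Attachable (facetsOf (ℕ._≤? 1)) full
    points full S (σ , σ∈ , σ∉) = σ , σ∈ , fresh , attach-point (proj₂ (∈-facetsOf⁻ (ℕ._≤? 1) σ∈)) fresh
      where
      fresh : ¬ Cov full σ
      fresh = facet-fresh (λ i → [ l₂-faces , proj₁ ∘ proj₁ ∘ ∈-facetsOf⁻ (ℕ._≤? 1) ]′ (Stage.within S i)) (proj₁ (∈-facetsOf⁻ (ℕ._≤? 1) σ∈)) σ∉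
  ... | l₃ , S₃ , complete₃ = inj₂ (shelledBy⇒shellable (Stage.shelled S₃ , All.tabulate facets , λ σ fac → all σ fac ∣ σ ∣ refl))
    where
    facets : ∀ {σ} → σ ∈ₗ l₃ → IsFacet F σ
    facets i with Stage.within S₃ i
    ... | inj₂ j = proj₁ (∈-facetsOf⁻ (ℕ._≤? 1) j)
    ... | inj₁ j with Stage.within S₂ j
    ...   | inj₁ j′ = top-face⇒facet dim (is-face (tris j′)) (size (tris j′))
    ...   | inj₂ j′ = proj₁ (∈-facetsOf⁻ (ℕ._≟ 2) j′)
    all : ∀ σ → IsFacet F σ → ∀ k → ∣ σ ∣ ≡ k → σ ∈ₗ l₃
    all σ fac 0 e = complete₃ (∈-facetsOf⁺ (ℕ._≤? 1) fac (subst (_≤ 1) (sym e) z≤n))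
    all σ fac 1 e = complete₃ (∈-facetsOf⁺ (ℕ._≤? 1) fac (ℕₚ.≤-reflexive e))
    all σ fac 2 e = Stage.extends S₃ (complete₂ (∈-facetsOf⁺ (ℕ._≟ 2) fac e))
    all σ fac 3 e = Stage.extends S₃ (Stage.extends S₂ (complete (mkTriangle (proj₁ fac) e (λ _ → Subₚ.∈⊤))))
    all σ fac (suc (suc (suc (suc k)))) e = ⊥-elim (ℕₚ.<⇒≱ (s≤s (s≤s (s≤s (s≤s z≤n)))) (subst (_≤ 3) e (dim σ (proj₁ fac))))

-- Comparison of the obstructions

Extensional : (Fam n → Set) → Set₁
Extensional {n} P = ∀ (F G : Fam n) → (∀ σ → F σ → G σ) → (∀ σ → G σ → F σ) → P F → P G

facet-ext : ∀ {F G : Fam n} → (∀ σ → F σ → G σ) → (∀ σ → G σ → F σ) → ∀ {σ} → IsFacet F σ → IsFacet G σ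
facet-ext to from (Fσ , max) = to _ Fσ , λ τ Gτ f → max τ (from τ Gτ) f

partitionable-ext : Extensional {n} Partitionable
partitionable-ext F G to from (r , r⊆ , cover , disjoint) =
  r , (λ σ fac → r⊆ σ (back fac))
    , (λ η Gη → let σ , fac , f , g = cover η (from η Gη) in σ , facet-ext to from fac , f , λ {_} → g)
    , λ η σ σ′ fac fac′ → disjoint η σ σ′ (back fac) (back fac′)
  where
  back : ∀ {σ} → IsFacet G σ → IsFacet F σ
  back = facet-ext from to

scm-ext : Extensional {n} SeqCohenMacaulay
scm-ext {n} F G to from scm D ((σ , Gσ , s) , max) i i<D = pure , acyclic
  where
  cm : CohenMacaulay (PureSkel F i)
  cm = scm D ((σ , from σ Gσ , s) , λ τ Fτ → max τ (to τ Fτ)) i i<D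
  up : ∀ η → PureSkel F i η → PureSkel G i η
  up η (ρ , Fρ , f , s) = ρ , to ρ Fρ , f , s
  down : ∀ η → PureSkel G i η → PureSkel F i η
  down η (ρ , Gρ , f , s) = ρ , from ρ Gρ , f , s
  pure : Pure (PureSkel G i)
  pure = let d , p = proj₁ cm in d , λ η Gη →
    let le , ρ , f , Fρ , s = p η (down η Gη) in le , ρ , f , up ρ Fρ , s
  acyclic : ∀ τ → PureSkel G i τ → ∀ d → HasTopSize (Link (PureSkel G i) τ) d → ∀ m → m ≢ d → Acyclic (Link (PureSkel G i) τ) m
  acyclic τ Gτ d ((ρ , (e , Gρ) , s) , max) m m≢d =
    acyclic-⇔ (Link (PureSkel F i) τ) (Link (PureSkel G i) τ) (λ η (e , h) → e , up _ h) (λ η (e , h) _ → e , down _ h)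
      (proj₂ cm τ (down τ Gτ) d ((ρ , (e , down _ Gρ) , s) , λ η (e , h) → max η (e , up _ h)) m m≢d)

module _ {n} (P : Fam n → Set) (ext : Extensional P)
  (from-shellable : ∀ F → Closed F → (∀ σ → Dec (F σ)) → Shellable F → P F)
  (obstructed : ∀ {F} → Closed F → Disconnection F ⊎ Band F → ¬ P F) where

  -- An obstacle on a proper vertex set of an obstruction to shellability would be shellable and
  -- hence satisfy P, which is impossible; so it spans everything, and P fails for F. Conversely, if
  -- a proper restriction of an obstruction to P were not shellable, it would contain an obstacle,
  -- yet that obstacle satisfies P by minimality.
  shellable-obstructions : ∀ F → Closed F → (∀ σ → Dec (F σ)) → (∀ σ → F σ → ∣ σ ∣ ≤ 3) →
    Obstruction Shellable F ⇔ Obstruction P F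
  shellable-obstructions F closed F? dim = mk⇔ to from
    where
    restrict? : ∀ W σ → Dec (Restrict F W σ)
    restrict? W σ = F? σ ×-dec (σ ⊆? W)
    promote : ∀ W → Shellable (Restrict F W) → P (Restrict F W)
    promote W = from-shellable (Restrict F W) (restrict-closed closed) (restrict? W)
    to : Obstruction Shellable F → Obstruction P F
    to (¬shellable , strict) = refute , λ W verts proper → promote W (strict W verts proper)
      where
      refute : ¬ P F
      refute PF with Search.obstacle-or-shellable F F? closed dim
      ... | inj₂ shellable = ¬shellable shellable
      ... | inj₁ (W , verts , o) with Finₚ.any? (λ v → F? ⁅ v ⁆ ×-dec ¬? (v ∈? W))
      ...   | yes proper = obstructed (restrict-closed closed) o (promote W (strict W verts proper))
      -- Here W contains every vertex: the restriction has the same faces as F without being the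
      -- same family, and `ext` transports P.
      ...   | no none = obstructed (restrict-closed closed) o (ext F (Restrict F W)
                (λ σ Fσ → Fσ , λ {x} h → decidable-stable (x ∈? W) λ x∉ → none (x , closed σ ⁅ x ⁆ (⁅⁆⊆ h) Fσ , x∉))
                (λ σ → proj₁) PF)
    from : Obstruction P F → Obstruction Shellable F
    from (¬P , strict) = (λ shellable → ¬P (from-shellable F closed F? shellable)) , shell
      where
      shell : ∀ W → (∀ v → v ∈ W → Vert F v) → ∃[ v ] (Vert F v × v ∉ W) → Shellable (Restrict F W)
      shell W verts (v , Fv , v∉W) with Search.obstacle-or-shellable (Restrict F W) (restrict? W) (restrict-closed closed) (λ σ (Fσ , _) → dim σ Fσ)
      ... | inj₂ shellable = shellable
      -- U lies in W and so misses v, which makes it a proper vertex set of F; restricting to W and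
      -- then to U has the same faces as restricting to U.
      ... | inj₁ (U , verts′ , o) = ⊥-elim (obstructed (restrict-closed (restrict-closed closed)) o
              (ext (Restrict F U) (Restrict (Restrict F W) U) (λ σ (Fσ , f) → (Fσ , λ {_} → U⊆W ∘ f) , λ {_} → f) (λ σ ((Fσ , _) , f) → Fσ , λ {_} → f)
                (strict U (λ x h → proj₁ (verts′ x h)) (v , Fv , v∉W ∘ U⊆W))))
        where
        U⊆W : U ⊆ W
        U⊆W {x} h = proj₂ (verts′ x h) (x∈⁅x⁆ x)

theorem3p10 : (n : ℕ) (Γ : SimplicialComplex n) → DimAtMost2 Γ →
    (Obstruction Shellable (Faces Γ) ⇔ Obstruction Partitionable (Faces Γ)) ×
    (Obstruction Partitionable (Faces Γ) ⇔ Obstruction SeqCohenMacaulay (Faces Γ))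
theorem3p10 n Γ dim = part , mk⇔ (Equivalence.to scm ∘ Equivalence.from part) (Equivalence.to part ∘ Equivalence.from scm)
  where
  closed : Closed (Faces Γ)
  closed σ η f = down-closed Γ σ η f
  face? : ∀ σ → Dec (Faces Γ σ)
  face? σ = Boolₚ.T? (face Γ σ)
  part : Obstruction Shellable (Faces Γ) ⇔ Obstruction Partitionable (Faces Γ)
  part = shellable-obstructions Partitionable partitionable-ext
    (λ F _ F? → shellable⇒partitionable (facet-above F?))
    (λ closed → [ disconnection⇒¬partitionable closed , band⇒¬partition closed ]′)
    (Faces Γ) closed face? dim
  scm : Obstruction Shellable (Faces Γ) ⇔ Obstruction SeqCohenMacaulay (Faces Γ)
  scm = shellable-obstructions SeqCohenMacaulay scm-ext
    (λ F closed F? → shellable⇒scm closed (facet-above F?))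
    (λ _ → [ disconnection⇒¬scm , band⇒¬scm ]′)
    (Faces Γ) closed face? dim
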